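{- The ordinary generating function $T^c(t)=\sum_{n\geq0}t^c_nt^n$, where $t^c_n$ is the number of (unlabelled) complete rooted plane $\{2,3\}$-trees with $n$ leaves, is differentially transcendental over $\mathbb{C}(t)$.
   Context: A rooted plane tree is a finite rooted tree in which the children of each vertex are linearly ordered; a leaf is a vertex with no children, and the size of a tree is its number of leaves. For a set $\mathcal{S}$ of integers $>1$, an $\mathcal{S}$-tree is a rooted plane tree in which every non-leaf vertex has $k$ children for some $k\in\mathcal{S}$. It is complete if all leaves are at the same distance from the root (the single vertex counts as a complete tree with one leaf). Differentially transcendental over $\mathbb{C}(t)$: no nonzero polynomial $P$ over $\mathbb{C}(t)$ with $P(f,f',\dots,f^{(n)})=0$. -}

module Defs where

open import Level using (Level; _⊔_)
open import Data.Nat using (ℕ; zero; suc; _∸_; _≤?_) renaming (_+_ to _+ℕ_)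
open import Data.Fin using (fromℕ)
open import Data.Unit using (⊤)
open import Data.Empty using (⊥)
open import Relation.Nullary using (yes; no)
open import Data.Fin using (Fin; toℕ)
open import Data.List using (List; []; _∷_; map; concatMap; foldr; length; allFin; upTo)
open import Data.List.Membership.Propositional using (_∈_)
open import Data.List.Relation.Unary.Unique.Propositional using (Unique)
open import Data.Vec using (Vec; []; _∷_; lookup)
open import Data.Product using (Σ; ∃; _×_; _,_)
open import Relation.Nullary using (¬_)
open import Relation.Binary.PropositionalEquality using (_≡_)
open import Function.Bundles using (_⇔_)
open import Algebra.Bundles using (CommutativeRing)

data Tree : Set where
  leaf  : Tree
  node2 : Tree → Tree → Tree
  node3 : Tree → Tree → Tree → Tree

leaves : Tree → ℕ
leaves leaf = 1
leaves (node2 a b) = leaves a +ℕ leaves b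
leaves (node3 a b c) = leaves a +ℕ leaves b +ℕ leaves c

LeavesAtDepth : ℕ → Tree → Set
LeavesAtDepth zero    leaf          = ⊤
LeavesAtDepth zero    (node2 _ _)   = ⊥
LeavesAtDepth zero    (node3 _ _ _) = ⊥
LeavesAtDepth (suc d) leaf          = ⊥
LeavesAtDepth (suc d) (node2 a b)   = LeavesAtDepth d a × LeavesAtDepth d b
LeavesAtDepth (suc d) (node3 a b c) =
  LeavesAtDepth d a × LeavesAtDepth d b × LeavesAtDepth d c

Complete : Tree → Set
Complete t = ∃ λ d → LeavesAtDepth d t

CountsCompleteTrees : (ℕ → ℕ) → Set
CountsCompleteTrees a = ∀ n → Σ (List Tree) λ L →
  Unique L × (∀ t → (t ∈ L) ⇔ (Complete t × leaves t ≡ n)) × length L ≡ a n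

-- Algebraically closed fields of characteristic zero
-- (standing in for ℂ, which is not available).

module Over {c ℓ : Level} (K : CommutativeRing c ℓ) where
  open CommutativeRing K

  emb : ℕ → Carrier
  emb zero = 0#
  emb (suc n) = 1# + emb n

  Σl : {A : Set} → List A → (A → Carrier) → Carrier
  Σl xs f = foldr (λ x s → f x + s) 0# xs

  evalPoly : (m : ℕ) → (Fin (suc m) → Carrier) → Carrier → Carrier
  evalPoly m p x = Σl (allFin (suc m)) (λ i → p i * pow (toℕ i) x)
    where
    pow : ℕ → Carrier → Carrier
    pow zero _ = 1#
    pow (suc k) y = y * pow k y

  IsField : Set (c ⊔ ℓ)
  IsField = ∀ x → ¬ (x ≈ 0#) → ∃ λ y → x * y ≈ 1#

  CharZero : Set ℓ
  CharZero = ∀ n → ¬ (emb (suc n) ≈ 0#)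

  AlgClosed : Set (c ⊔ ℓ)
  AlgClosed = ∀ m (p : Fin (suc (suc m)) → Carrier) →
    ¬ (p (fromℕ (suc m)) ≈ 0#) →
    ∃ λ x → evalPoly (suc m) p x ≈ 0#

  Series : Set c
  Series = ℕ → Carrier

  deriv : Series → Series
  deriv f k = emb (suc k) * f (suc k)

  derivN : ℕ → Series → Series
  derivN zero f = f
  derivN (suc i) f = deriv (derivN i f)

  one : Series
  one zero = 1#
  one (suc _) = 0#

  mul : Series → Series → Series
  mul f g k = Σl (upTo (suc k)) (λ i → f i * g (k ∸ i))

  powS : Series → ℕ → Series
  powS f zero = one
  powS f (suc e) = mul f (powS f e)

  shift : ℕ → Series → Series
  shift j f k with j ≤? k
  ... | yes _ = f (k ∸ j)
  ... | no _ = 0#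

  addS : Series → Series → Series
  addS f g k = f k + g k

  zeroS : Series
  zeroS _ = 0#

  ΣS : {A : Set} → List A → (A → Series) → Series
  ΣS xs F = foldr (λ x s → addS (F x) s) zeroS xs

  vecs : ∀ {k} n → List (Vec (Fin k) n)
  vecs zero = [] ∷ []
  vecs {k} (suc n) = concatMap (λ i → map (i ∷_) (vecs n)) (allFin k)

  -- A polynomial P in variables y₀,…,y_n with coefficients in K[t]
  -- (denominators of K(t)-coefficients cleared), given densely:
  -- exponents of each y_i are < suc d, the t-degree is ≤ m;
  -- coefficient of t^j y₀^{e₀}⋯y_n^{e_n} is P e j.

  DiffPoly : (n d m : ℕ) → Set c
  DiffPoly n d m = Vec (Fin (suc d)) (suc n) → Fin (suc m) → Carrier

  NonZeroPoly : ∀ {n d m} → DiffPoly n d m → Set ℓ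
  NonZeroPoly P = ∃ λ e → ∃ λ j → ¬ (P e j ≈ 0#)

  evalDiff : ∀ {n d m} → DiffPoly n d m → Series → Series
  evalDiff {n} {d} {m} P f =
    ΣS (vecs (suc n)) λ e → ΣS (allFin (suc m)) λ j →
      shift (toℕ j)
        (mul (λ k → P e j * one k)
          (prodS (allFin (suc n)) e))
    where
    prodS : List (Fin (suc n)) → Vec (Fin (suc d)) (suc n) → Series
    prodS [] _ = one
    prodS (i ∷ is) e = mul (powS (derivN (toℕ i) f) (toℕ (lookup e i))) (prodS is e)

  DiffAlgebraic : Series → Set (c ⊔ ℓ)
  DiffAlgebraic f = ∃ λ n → ∃ λ d → ∃ λ m → Σ (DiffPoly n d m) λ P →
    NonZeroPoly P × (∀ k → evalDiff P f k ≈ 0#)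

  DiffTranscendental : Series → Set (c ⊔ ℓ)
  DiffTranscendental f = ¬ DiffAlgebraic f

{-# OPTIONS --safe #-}

-- The series f = Σ t^c_n t^n satisfies f(t) = t + f(p(t)) with p = t² + t³, since complete trees of
-- depth d + 1 arise from those of depth d by replacing t with p(t).  Write σ(g) = g ∘ p, θ = t d/dt
-- and q = t p′ / p = (2 + 3t) / (1 + t), so that θσ = q σθ.  For x_n = t^n f⁽ⁿ⁾ this gives
--   q^n σ(x_n) = x_n + l_n  with  l_0 = l_1 = - t  and  l_n = - C(n,2) ω x_(n-1) + …  for n ≥ 2,
-- where ω = t p″ / p′ and … is a polynomial in x_0, …, x_(n-2) over the rational functions.
-- By induction on n, x_n is transcendental over x_0, …, x_(n-1).  Otherwise, comparing a relation of
-- minimal degree with its image under σ, and using that q^k σ(g) = g has only the zero solution among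
-- Laurent series for k ≠ 0 and only constants for k = 0, one finds that x_n is a rational
-- function of x_0, …, x_(n-1).  Taking leading coefficients in x_(n-1), …, x_0 successively turns
-- the resulting equation q^n σ(x_n) = x_n + l_n into one for a rational function h of t, namely
--   σ(h) = h - t,   q σ(h) = h - t   or   q σ(h) = h + γ ω + δ t  with γ ≠ 0.
-- The first two are impossible by comparison of degrees.  In the third, -1 is a pole of h, and so are
-- all points of a backward orbit of -1 under p, which are infinitely many.
module Submission where

open import Defs
open import Level using (Level; _⊔_; Lift; lift) renaming (suc to lsuc)
open import Data.Nat using (ℕ; zero; suc; z≤n; s≤s; _∸_; _≤?_; _≟_) renaming (_+_ to _+ℕ_; _*_ to _*ℕ_; _≤_ to _≤ℕ_; _<_ to _<ℕ_)
import Data.Nat.Properties as ℕ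
import Data.Nat.Tactic.RingSolver as ℕ
open import Data.Integer using (ℤ; +_; -[1+_])
import Data.Integer as ℤ
import Data.Integer.Properties as ℤ
open import Data.Fin using (Fin; toℕ) renaming (zero to fzero; suc to fsuc)
import Data.Fin.Properties as Fin
open import Data.Vec using (Vec; []; _∷_; lookup)
open import Data.List using (List; []; _∷_; _++_; map; concatMap; tabulate; allFin; applyUpTo; filter; length; cartesianProduct; cartesianProductWith)
open import Data.List.Properties using (filter-accept; filter-reject)
open import Data.List.Membership.Propositional using (_∈_)
open import Data.List.Membership.Propositional.Properties
  using (∈-++⁺ˡ; ∈-++⁺ʳ; ∈-++⁻; ∈-cartesianProductWith⁺; ∈-cartesianProductWith⁻; ∈-cartesianProduct⁺; ∈-cartesianProduct⁻; ∈-filter⁺; ∈-filter⁻)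
open import Data.List.Membership.Propositional.Properties.WithK using (unique∧set⇒bag)
open import Data.List.Relation.Binary.BagAndSetEquality using (∼bag⇒↭)
open import Data.List.Relation.Binary.Disjoint.Propositional using (Disjoint)
open import Data.List.Relation.Binary.Permutation.Propositional.Properties using (↭-length)
open import Data.List.Relation.Unary.All using ([])
open import Data.List.Relation.Unary.Any using (here)
open import Data.List.Relation.Unary.AllPairs using ([]; _∷_)
open import Data.List.Relation.Unary.Unique.Propositional using (Unique)
import Data.List.Relation.Unary.Unique.Propositional.Properties as Unique
open import Data.Maybe using (just; nothing)
open import Data.Product using (∃; _×_; _,_; proj₁; proj₂)
open import Data.Sum using (_⊎_; inj₁; inj₂)
open import Data.Unit using (tt)
open import Data.Empty using (⊥; ⊥-elim)
open import Function using (_∘_; id)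
open import Function.Bundles using (mk⇔; Equivalence)
open import Relation.Nullary using (¬_; yes; no)
open import Relation.Binary.Definitions using (WeaklyDecidable; tri<; tri≈; tri>)
open import Relation.Binary.PropositionalEquality as ≡ using (_≡_)
open import Algebra.Bundles using (CommutativeRing)
open import Algebra.Solver.Ring.AlmostCommutativeRing using (fromCommutativeRing; Induced-equivalence; _-Raw-AlmostCommutative⟶_)
import Algebra.Properties.Ring
import Algebra.Properties.Semiring.Exp
import Algebra.Properties.CommutativeSemiring.Exp

-- No fraction field is formed. An equation for h = u / v is written with denominators cleared, as
-- in q v σ(u) = σ(v) (u + ρ v), and a polynomial in x_n is a series equipped with a representation
-- by coefficients. Such a representation is unique only once x_n is known to be transcendental, so
-- leading coefficients in x_0, ..., x_(n-1) can be compared only after the induction has dealt with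
-- these. The term δ t of the third equation originates at x_1. Since q σ(x_1) = x_1 - t, a constant
-- multiple of a suitable power of x_1 carries the same weight as h, and so can be neither excluded
-- nor determined; splitting it off adds a multiple of t to the inhomogeneous term. The coefficient
-- of ω is untouched by this, and stays nonzero because C(n,2) is nonzero in characteristic zero.
-- Equality with zero is undecidable, so leading terms and common roots exist only up to double
-- negation. This is harmless, as every conclusion is either empty or an equation that is stable
-- under double negation.

-- Computation in commutative rings

module IntegerSolver {c ℓ : Level} (R : CommutativeRing c ℓ) where
  open CommutativeRing R
  open import Algebra.Properties.Ring ring
  open import Algebra.Properties.AbelianGroup +-abelianGroup using (⁻¹-∙-comm)
  open import Algebra.Properties.Semiring.Mult.TCOptimised semiring using (1+×; ×-homo-+; ×1-homo-*) renaming (_×_ to _·_)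
  open import Relation.Binary.Reasoning.Setoid setoid

  private
    ⟦_⟧ : ℤ → Carrier
    ⟦ + n ⟧ = n · 1#
    ⟦ -[1+ n ] ⟧ = - (suc n · 1#)

    ⊖-homo : ∀ m n → ⟦ m ℤ.⊖ n ⟧ ≈ m · 1# - n · 1#
    ⊖-homo m zero = sym (trans (+-congˡ -0#≈0#) (+-identityʳ _))
    ⊖-homo zero (suc n) = sym (+-identityˡ _)
    ⊖-homo (suc m) (suc n) = begin
      ⟦ suc m ℤ.⊖ suc n ⟧                ≈⟨ reflexive (≡.cong ⟦_⟧ (ℤ.[1+m]⊖[1+n]≡m⊖n m n)) ⟩
      ⟦ m ℤ.⊖ n ⟧                        ≈⟨ ⊖-homo m n ⟩
      m · 1# - n · 1#                    ≈⟨ +-congˡ (sym (trans (+-congʳ (-‿inverseʳ 1#)) (+-identityˡ _))) ⟩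
      m · 1# + (1# - 1# - n · 1#)        ≈⟨ +-congˡ (trans (+-assoc _ _ _) (+-congˡ (⁻¹-∙-comm _ _))) ⟩
      m · 1# + (1# - (1# + n · 1#))      ≈⟨ sym (+-assoc _ _ _) ⟩
      m · 1# + 1# - (1# + n · 1#)        ≈⟨ +-cong (trans (+-comm _ _) (sym (1+× m 1#))) (-‿cong (sym (1+× n 1#))) ⟩
      suc m · 1# - suc n · 1#            ∎

    -‿homo : ∀ i → ⟦ ℤ.- i ⟧ ≈ - ⟦ i ⟧
    -‿homo (+ zero) = sym -0#≈0#
    -‿homo (+ suc n) = refl
    -‿homo -[1+ n ] = sym (-‿involutive _)

    +-homo : ∀ i j → ⟦ i ℤ.+ j ⟧ ≈ ⟦ i ⟧ + ⟦ j ⟧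
    +-homo (+ m) (+ n) = ×-homo-+ 1# m n
    +-homo (+ m) -[1+ n ] = ⊖-homo m (suc n)
    +-homo -[1+ m ] (+ n) = trans (⊖-homo n (suc m)) (+-comm _ _)
    +-homo -[1+ m ] -[1+ n ] = begin
      - (suc (suc (m +ℕ n)) · 1#)  ≈⟨ -‿cong (reflexive (≡.cong (λ k → suc k · 1#) (≡.sym (ℕ.+-suc m n)))) ⟩
      - ((suc m +ℕ suc n) · 1#)  ≈⟨ -‿cong (×-homo-+ 1# (suc m) (suc n)) ⟩
      - (suc m · 1# + suc n · 1#)        ≈⟨ sym (⁻¹-∙-comm _ _) ⟩
      - (suc m · 1#) - (suc n · 1#)      ∎

    *-homo⁺ : ∀ m n → ⟦ + m ℤ.* + n ⟧ ≈ m · 1# * n · 1#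
    *-homo⁺ m n = trans (reflexive (≡.cong ⟦_⟧ (≡.sym (ℤ.pos-* m n)))) (×1-homo-* m n)

    *-homo : ∀ i j → ⟦ i ℤ.* j ⟧ ≈ ⟦ i ⟧ * ⟦ j ⟧
    *-homo (+ m) (+ n) = *-homo⁺ m n
    *-homo (+ m) -[1+ n ] = begin
      ⟦ + m ℤ.* -[1+ n ] ⟧            ≈⟨ reflexive (≡.cong ⟦_⟧ (≡.sym (ℤ.neg-distribʳ-* (+ m) (+ suc n)))) ⟩
      ⟦ ℤ.- (+ m ℤ.* + suc n) ⟧       ≈⟨ -‿homo (+ m ℤ.* + suc n) ⟩
      - ⟦ + m ℤ.* + suc n ⟧           ≈⟨ -‿cong (*-homo⁺ m (suc n)) ⟩
      - (m · 1# * suc n · 1#)         ≈⟨ -‿distribʳ-* _ _ ⟩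
      m · 1# * - (suc n · 1#)         ∎
    *-homo -[1+ m ] (+ n) = begin
      ⟦ -[1+ m ] ℤ.* + n ⟧            ≈⟨ reflexive (≡.cong ⟦_⟧ (≡.sym (ℤ.neg-distribˡ-* (+ suc m) (+ n)))) ⟩
      ⟦ ℤ.- (+ suc m ℤ.* + n) ⟧       ≈⟨ -‿homo (+ suc m ℤ.* + n) ⟩
      - ⟦ + suc m ℤ.* + n ⟧           ≈⟨ -‿cong (*-homo⁺ (suc m) n) ⟩
      - (suc m · 1# * n · 1#)         ≈⟨ -‿distribˡ-* _ _ ⟩
      - (suc m · 1#) * n · 1#         ∎
    *-homo -[1+ m ] -[1+ n ] = begin
      (suc m *ℕ suc n) · 1#       ≈⟨ ×1-homo-* (suc m) (suc n) ⟩
      suc m · 1# * suc n · 1#             ≈⟨ sym (-‿involutive _) ⟩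
      - - (suc m · 1# * suc n · 1#)       ≈⟨ -‿cong (-‿distribʳ-* _ _) ⟩
      - (suc m · 1# * - (suc n · 1#))     ≈⟨ -‿distribˡ-* _ _ ⟩
      - (suc m · 1#) * - (suc n · 1#)     ∎

    morphism : CommutativeRing.rawRing ℤ.+-*-commutativeRing -Raw-AlmostCommutative⟶ fromCommutativeRing R
    morphism = record
      { ⟦_⟧ = ⟦_⟧ ; +-homo = +-homo ; *-homo = *-homo ; -‿homo = -‿homo ; 0-homo = refl ; 1-homo = refl }

    -- Only integers are ever compared, so the solver serves rings whose own equality is
    -- undecidable, such as rings of power series.
    _coeff≟_ : WeaklyDecidable (Induced-equivalence morphism)
    i coeff≟ j with i ℤ.≟ j
    ... | yes i≡j = just (reflexive (≡.cong ⟦_⟧ i≡j))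
    ... | no _ = nothing

  open import Algebra.Solver.Ring (CommutativeRing.rawRing ℤ.+-*-commutativeRing) (fromCommutativeRing R) morphism _coeff≟_ public
    using (solve; _:=_; _:+_; _:*_; _:-_; :-_; con)

module RingFacts {c ℓ : Level} (R : CommutativeRing c ℓ) where
  open CommutativeRing R
  open Algebra.Properties.Ring ring public
    using (-‿distribˡ-*; -‿distribʳ-*; -0#≈0#; -‿involutive; x∙y⁻¹≈ε⇒x≈y; x≈y⇒x∙y⁻¹≈ε; +-cancelˡ; +-cancelʳ)
  open Algebra.Properties.Semiring.Exp semiring public using (_^_; ^-congˡ; ^-congʳ; ^-homo-*; ^-assocʳ)
  open Algebra.Properties.CommutativeSemiring.Exp commutativeSemiring public using (^-distrib-*)
  open IntegerSolver R

  -- Deduces an equation from hypotheses: L - R is a combination of the differences of their sides.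
  combine₁ : ∀ {A B L R} k → A ≈ B → L + k * B ≈ R + k * A → L ≈ R
  combine₁ k A≈B e = +-cancelʳ _ _ _ (trans e (+-congˡ (*-congˡ A≈B)))

  combine₂ : ∀ {A B A′ B′ L R} k k′ → A ≈ B → A′ ≈ B′ → L + (k * B + k′ * B′) ≈ R + (k * A + k′ * A′) → L ≈ R
  combine₂ k k′ A≈B A′≈B′ e = +-cancelʳ _ _ _ (trans e (+-congˡ (+-cong (*-congˡ A≈B) (*-congˡ A′≈B′))))

  unit-cancel : ∀ {x x⁻¹ a b} → x * x⁻¹ ≈ 1# → x * a ≈ x * b → a ≈ b
  unit-cancel {x} {x⁻¹} {a} {b} u e = combine₂ (b - a) x⁻¹ u e
    (solve 4 (λ x x⁻¹ a b → a :+ ((b :- a) :* con (+ 1) :+ x⁻¹ :* (x :* b)) := b :+ ((b :- a) :* (x :* x⁻¹) :+ x⁻¹ :* (x :* a)))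
       refl x x⁻¹ a b)

  ^-unit : ∀ {x x⁻¹} → x * x⁻¹ ≈ 1# → ∀ n → x ^ n * x⁻¹ ^ n ≈ 1#
  ^-unit {x} {x⁻¹} u n = trans (sym (^-distrib-* x x⁻¹ n)) (trans (^-congˡ n u) (1^n≈1 n))
    where
    1^n≈1 : ∀ n → 1# ^ n ≈ 1#
    1^n≈1 zero = refl
    1^n≈1 (suc n) = trans (*-identityˡ _) (1^n≈1 n)

-- Polynomials in one element over a subring

module Spans {c ℓ : Level} (R : CommutativeRing c ℓ) where
  open CommutativeRing R
  open RingFacts R
  open IntegerSolver R
  open Over R using (emb)

  record Subring (B : Carrier → Set (c ⊔ ℓ)) : Set (c ⊔ ℓ) where
    field
      resp : ∀ {g h} → g ≈ h → B g → B h
      0∈ : B 0#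
      1∈ : B 1#
      +∈ : ∀ {g h} → B g → B h → B (g + h)
      *∈ : ∀ {g h} → B g → B h → B (g * h)
      neg∈ : ∀ {g} → B g → B (- g)

    ^∈ : ∀ {g} → B g → ∀ n → B (g ^ n)
    ^∈ g∈ zero = 1∈
    ^∈ g∈ (suc n) = *∈ g∈ (^∈ g∈ n)

    emb∈ : ∀ n → B (emb n)
    emb∈ zero = 0∈
    emb∈ (suc n) = +∈ 1∈ (emb∈ n)

  module Polynomials {B : Carrier → Set (c ⊔ ℓ)} (subring : Subring B) (y : Carrier) where
    open Subring subring

    -- A polynomial in `y` is a ring element together with a representation, which need not be
    -- unique. The index counts coefficients, so the degree is below `d`, and `Span 0` contains only
    -- zero.
    data Span : ℕ → Carrier → Set (c ⊔ ℓ) where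
      nil : ∀ {g} → g ≈ 0# → Span 0 g
      snoc : ∀ {d a r g} → B a → Span d r → g ≈ a * y ^ d + r → Span (suc d) g

    -- The coefficient `a` may be zero: it leads formally, in one representation of degree at most
    -- `d`.
    Lead : ℕ → Carrier → Carrier → Set (c ⊔ ℓ)
    Lead d a g = B a × ∃ λ r → Span d r × g ≈ a * y ^ d + r

    Adjoin : Carrier → Set (c ⊔ ℓ)
    Adjoin g = ∃ λ d → Span d g

    -- Stated for the top coefficient alone; once that one vanishes, the same statement applies to
    -- the rest of the relation.
    Transcendental : Set (c ⊔ ℓ)
    Transcendental = ∀ d {a g} → Lead d a g → g ≈ 0# → a ≈ 0#

    lead⇒span : ∀ {d a g} → Lead d a g → Span (suc d) g
    lead⇒span (a∈ , r , r∈ , e) = snoc a∈ r∈ e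

    span⇒lead : ∀ {d g} → Span (suc d) g → ∃ λ a → Lead d a g
    span⇒lead (snoc a∈ r∈ e) = _ , a∈ , _ , r∈ , e

    span-resp : ∀ {d g h} → g ≈ h → Span d g → Span d h
    span-resp g≈h (nil e) = nil (trans (sym g≈h) e)
    span-resp g≈h (snoc a∈ r∈ e) = snoc a∈ r∈ (trans (sym g≈h) e)

    lead-resp : ∀ {d a b g h} → a ≈ b → g ≈ h → Lead d a g → Lead d b h
    lead-resp a≈b g≈h (a∈ , r , r∈ , e) =
      resp a≈b a∈ , r , r∈ , trans (sym g≈h) (trans e (+-congʳ (*-congʳ a≈b)))

    span-cast : ∀ {d e g} → d ≡ e → Span d g → Span e g
    span-cast ≡.refl g∈ = g∈

    lead-cast : ∀ {d e a g} → d ≡ e → Lead d a g → Lead e a g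
    lead-cast ≡.refl g∈ = g∈

    lead-0 : ∀ {d g} → Span d g → Lead d 0# g
    lead-0 g∈ = 0∈ , _ , g∈ , sym (trans (+-congʳ (zeroˡ _)) (+-identityˡ _))

    span-suc : ∀ {d g} → Span d g → Span (suc d) g
    span-suc g∈ = lead⇒span (lead-0 g∈)

    span-+ˡ : ∀ e {d g} → Span d g → Span (e +ℕ d) g
    span-+ˡ zero g∈ = g∈
    span-+ˡ (suc e) g∈ = span-suc (span-+ˡ e g∈)

    span-≤ : ∀ {d e g} → d ≤ℕ e → Span d g → Span e g
    span-≤ {d} {e} d≤e g∈ = span-cast (ℕ.m∸n+n≡m d≤e) (span-+ˡ (e ∸ d) g∈)

    span-0 : ∀ d → Span d 0#
    span-0 zero = nil refl
    span-0 (suc d) = span-suc (span-0 d)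

    span-+ : ∀ {d g h} → Span d g → Span d h → Span d (g + h)
    span-+ (nil e) (nil e′) = nil (trans (+-cong e e′) (+-identityˡ _))
    span-+ (snoc a∈ r∈ e) (snoc b∈ s∈ e′) = snoc (+∈ a∈ b∈) (span-+ r∈ s∈)
      (trans (+-cong e e′) (solve 5 (λ a b r s z → (a :* z :+ r) :+ (b :* z :+ s) := (a :+ b) :* z :+ (r :+ s)) refl _ _ _ _ _))

    span-scale : ∀ {d b g} → B b → Span d g → Span d (b * g)
    span-scale b∈ (nil e) = nil (trans (*-congˡ e) (zeroʳ _))
    span-scale b∈ (snoc a∈ r∈ e) = snoc (*∈ b∈ a∈) (span-scale b∈ r∈)
      (trans (*-congˡ e) (solve 4 (λ a b r z → b :* (a :* z :+ r) := (b :* a) :* z :+ b :* r) refl _ _ _ _))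

    span-neg : ∀ {d g} → Span d g → Span d (- g)
    span-neg g∈ = span-resp (solve 1 (λ g → :- con (+ 1) :* g := :- g) refl _) (span-scale (neg∈ 1∈) g∈)

    span-y : ∀ {d g} → Span d g → Span (suc d) (y * g)
    span-y (nil e) = span-resp (sym (trans (*-congˡ e) (zeroʳ _))) (span-0 1)
    span-y (snoc a∈ r∈ e) = snoc a∈ (span-y r∈)
      (trans (*-congˡ e) (solve 4 (λ a y z r → y :* (a :* z :+ r) := a :* (y :* z) :+ y :* r) refl _ _ _ _))

    span-y^ : ∀ e {d g} → Span d g → Span (e +ℕ d) (y ^ e * g)
    span-y^ zero g∈ = span-resp (sym (*-identityˡ _)) g∈
    span-y^ (suc e) g∈ = span-resp (sym (*-assoc _ _ _)) (span-y (span-y^ e g∈))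

    span-const : ∀ {a} → B a → Span 1 a
    span-const a∈ = snoc a∈ (nil refl) (sym (trans (+-identityʳ _) (*-identityʳ _)))

    span-* : ∀ {d e g h} → Span d g → Span e h → Span (d +ℕ e) (g * h)
    span-* {d} g∈ (nil e) = span-resp (sym (trans (*-congˡ e) (zeroʳ _))) (span-0 (d +ℕ 0))
    span-* {d} {suc e} g∈ (snoc {a = a} {r} a∈ r∈ eq) = span-cast (≡.sym (ℕ.+-suc d e))
      (span-resp (trans (solve 4 (λ a z g r → z :* (a :* g) :+ g :* r := g :* (a :* z :+ r)) refl _ _ _ _) (*-congˡ (sym eq)))
        (span-+ (span-suc (span-cast (ℕ.+-comm e d) (span-y^ e (span-scale a∈ g∈))))
                (span-suc (span-* g∈ r∈))))

    lead-+ : ∀ {d a b g h} → Lead d a g → Lead d b h → Lead d (a + b) (g + h)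
    lead-+ (a∈ , r , r∈ , e) (b∈ , s , s∈ , e′) = +∈ a∈ b∈ , r + s , span-+ r∈ s∈ ,
      trans (+-cong e e′) (solve 5 (λ a b r s z → (a :* z :+ r) :+ (b :* z :+ s) := (a :+ b) :* z :+ (r :+ s)) refl _ _ _ _ _)

    lead-+span : ∀ {d a g h} → Lead d a g → Span d h → Lead d a (g + h)
    lead-+span g∈ h∈ = lead-resp (+-identityʳ _) refl (lead-+ g∈ (lead-0 h∈))

    lead-scale : ∀ {d a b g} → B b → Lead d a g → Lead d (b * a) (b * g)
    lead-scale b∈ (a∈ , r , r∈ , e) = *∈ b∈ a∈ , _ , span-scale b∈ r∈ ,
      trans (*-congˡ e) (solve 4 (λ a b r z → b :* (a :* z :+ r) := (b :* a) :* z :+ b :* r) refl _ _ _ _)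

    lead-neg : ∀ {d a g} → Lead d a g → Lead d (- a) (- g)
    lead-neg g∈ = lead-resp -1* -1* (lead-scale (neg∈ 1∈) g∈)
      where
      -1* : ∀ {g} → - 1# * g ≈ - g
      -1* = solve 1 (λ g → :- con (+ 1) :* g := :- g) refl _

    lead-const : ∀ {a} → B a → Lead 0 a a
    lead-const a∈ = a∈ , 0# , nil refl , sym (trans (+-identityʳ _) (*-identityʳ _))

    lead-y^ : ∀ d → Lead d 1# (y ^ d)
    lead-y^ d = 1∈ , 0# , span-0 d , sym (trans (+-identityʳ _) (*-identityˡ _))

    lead-* : ∀ {d e a b g h} → Lead d a g → Lead e b h → Lead (d +ℕ e) (a * b) (g * h)
    lead-* {d} {e} {a} {b} {g} {h} (a∈ , r , r∈ , eg) (b∈ , s , s∈ , eh) =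
      *∈ a∈ b∈ , _ ,
      span-+ (span-+ (span-y^ d (span-scale a∈ s∈)) (span-cast (ℕ.+-comm e d) (span-y^ e (span-scale b∈ r∈))))
             (span-* r∈ s∈) ,
      trans (*-cong eg eh) (trans
        (solve 6 (λ a b r s z w → (a :* z :+ r) :* (b :* w :+ s)
                    := a :* b :* (z :* w) :+ (z :* (a :* s) :+ w :* (b :* r) :+ r :* s)) refl a b r s (y ^ d) (y ^ e))
        (+-congʳ (*-congˡ (sym (^-homo-* y d e)))))

    lead-unique : Transcendental → ∀ d {a b g} → Lead d a g → Lead d b g → a ≈ b
    lead-unique tr d g∈ g∈′ = x∙y⁻¹≈ε⇒x≈y _ _ (tr d (lead-+ g∈ (lead-neg g∈′)) (-‿inverseʳ _))


    adjoin : Subring Adjoin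
    adjoin = record
      { resp = λ g≈h (d , g∈) → d , span-resp g≈h g∈
      ; 0∈ = 0 , nil refl
      ; 1∈ = 1 , span-const 1∈
      ; +∈ = λ (d , g∈) (e , h∈) → d +ℕ e , span-+ (span-cast (ℕ.+-comm e d) (span-+ˡ e g∈)) (span-+ˡ d h∈)
      ; *∈ = λ (d , g∈) (e , h∈) → d +ℕ e , span-* g∈ h∈
      ; neg∈ = λ (d , g∈) → d , span-neg g∈
      }

    ⊆adjoin : ∀ {a} → B a → Adjoin a
    ⊆adjoin a∈ = 1 , span-const a∈

    y∈adjoin : Adjoin y
    y∈adjoin = 2 , lead⇒span (lead-resp refl (*-identityʳ y) (lead-y^ 1))

    -- Only two terms need to be explicit: the first cancels against y^(e+1), and the second becomes
    -- the leading term of the difference.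
    binomial : ∀ {l} → B l → ∀ e → ∃ λ r → Span e r × (y + l) ^ suc e ≈ y ^ suc e + (emb (suc e) * l * y ^ e + r)
    binomial {l} l∈ zero = 0# , nil refl , solve 2 (λ y l → (y :+ l) :* con (+ 1)
      := y :* con (+ 1) :+ ((con (+ 1) :+ con (+ 0)) :* l :* con (+ 1) :+ con (+ 0))) refl y l
    binomial {l} l∈ (suc e) with binomial l∈ e
    ... | r , r∈ , eq = _ ,
      span-+ (span-y r∈) (span-scale l∈ (snoc (*∈ (emb∈ (suc e)) l∈) r∈ refl)) ,
      trans (*-congˡ eq) (solve 5 (λ y l z r n → (y :+ l) :* (y :* z :+ ((con (+ 1) :+ n) :* l :* z :+ r))
        := y :* (y :* z) :+ ((con (+ 1) :+ (con (+ 1) :+ n)) :* l :* (y :* z)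
             :+ (y :* r :+ l :* ((con (+ 1) :+ n) :* l :* z :+ r)))) refl y l (y ^ e) r (emb e))

-- Difference domains and solutions of q^m σ(y) = y + l

record DifferenceDomain (c ℓ : Level) : Set (lsuc (c ⊔ ℓ)) where
  field
    commutativeRing : CommutativeRing c ℓ
  open CommutativeRing commutativeRing public
  open RingFacts commutativeRing public
  open Over commutativeRing public using (emb)
  field
    stable : ∀ {x y} → ¬ ¬ (x ≈ y) → x ≈ y
    cancel-zero : ∀ {x y} → ¬ (x ≈ 0#) → x * y ≈ 0# → y ≈ 0#
    emb≉0 : ∀ n → ¬ (emb (suc n) ≈ 0#)

    σ : Carrier → Carrier
    σ-cong : ∀ {x y} → x ≈ y → σ x ≈ σ y
    σ-+ : ∀ x y → σ (x + y) ≈ σ x + σ y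
    σ-* : ∀ x y → σ (x * y) ≈ σ x * σ y
    σ-1 : σ 1# ≈ 1#

    q q⁻¹ : Carrier
    q*q⁻¹≈1 : q * q⁻¹ ≈ 1#

    Const : Carrier → Set (c ⊔ ℓ)
    const-subring : Spans.Subring commutativeRing Const
    σ-const : ∀ {κ} → Const κ → σ κ ≈ κ

    -- With h = w / v, this axiom and the next two concern q^(j+1) σ(h) = h, σ(h) = q^(j+1) h and
    -- σ(h) = h.
    semi-invariant⁺ : ∀ j {v w} → ¬ (v ≈ 0#) → q ^ suc j * (v * σ w) ≈ σ v * w → w ≈ 0#
    semi-invariant⁻ : ∀ j {v w} → ¬ (v ≈ 0#) → v * σ w ≈ q ^ suc j * (σ v * w) → w ≈ 0#
    invariant : ∀ {v w} → ¬ (v ≈ 0#) → v * σ w ≈ σ v * w → ¬ ¬ (∃ λ κ → Const κ × w ≈ κ * v)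

  σ-0 : σ 0# ≈ 0#
  σ-0 = +-cancelˡ (σ 0#) (σ 0#) 0#
    (trans (sym (σ-+ 0# 0#)) (trans (σ-cong (+-identityˡ 0#)) (sym (+-identityʳ _))))

  σ-neg : ∀ x → σ (- x) ≈ - σ x
  σ-neg x = +-cancelˡ (σ x) _ _
    (trans (sym (σ-+ x (- x))) (trans (σ-cong (-‿inverseʳ x)) (trans σ-0 (sym (-‿inverseʳ (σ x))))))

  σ-^ : ∀ x n → σ (x ^ n) ≈ σ x ^ n
  σ-^ x zero = σ-1
  σ-^ x (suc n) = trans (σ-* x (x ^ n)) (*-congˡ (σ-^ x n))

  const-emb : ∀ n → Const (emb n)
  const-emb = Spans.Subring.emb∈ const-subring

module Difference {c ℓ : Level} (D : DifferenceDomain c ℓ) where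
  open DifferenceDomain D
  open IntegerSolver commutativeRing
  open Spans commutativeRing public

  record σClosed (B : Carrier → Set (c ⊔ ℓ)) : Set (c ⊔ ℓ) where
    field
      const∈ : ∀ {κ} → Const κ → B κ
      q∈ : B q
      q⁻¹∈ : B q⁻¹
      σ∈ : ∀ {g} → B g → B (σ g)

  module Extension {B : Carrier → Set (c ⊔ ℓ)} (subring : Subring B) (closed : σClosed B)
    (y : Carrier) (m : ℕ) {l : Carrier} (l∈ : B l) (law : q ^ m * σ y ≈ y + l) where
    open Subring subring
    open σClosed closed
    open Polynomials subring y public

    private
      μ ε : Carrier
      μ = q ^ m
      ε = q⁻¹ ^ m

      με≈1 : μ * ε ≈ 1#
      με≈1 = ^-unit q*q⁻¹≈1 m

      με^≈1 : ∀ n → μ ^ n * ε ^ n ≈ 1#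
      με^≈1 = ^-unit με≈1

      μ∈ : B μ
      μ∈ = ^∈ q∈ m

      translate : ∀ e → Lead e 1# ((y + l) ^ e)
      translate zero = lead-y^ 0
      translate (suc e) with binomial l∈ e
      ... | r , r∈ , eq = lead-resp refl (sym eq) (lead-+span (lead-y^ (suc e)) (snoc (*∈ (emb∈ (suc e)) l∈) r∈ refl))

      above : ∀ e → Lead e (emb (suc e) * l) ((y + l) ^ suc e + - (y ^ suc e))
      above e with binomial l∈ e
      ... | s , s∈ , eq = *∈ (emb∈ (suc e)) l∈ , s , s∈ ,
        trans (+-congʳ eq) (solve 2 (λ Y Z → Y :+ Z :+ :- Y := Z) refl (y ^ suc e) (emb (suc e) * l * y ^ e + s))

      μσy^ : ∀ e → μ ^ e * σ y ^ e ≈ (y + l) ^ e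
      μσy^ e = trans (sym (^-distrib-* μ (σ y) e)) (^-congˡ e law)

    -- As μ σ(y) = y + l, the factor μ^d turns σ(y)^d into (y + l)^d, whose leading coefficient is
    -- 1. After this scaling, σ preserves degrees in `y` and acts on leading coefficients by σ
    -- itself.
    scaled-span : ∀ {d g} → Span d g → Span d (μ ^ d * σ g)
    scaled-lead : ∀ {d a g} → Lead d a g → Lead d (σ a) (μ ^ d * σ g)
    scaled-span (nil e) = nil (trans (*-identityˡ _) (trans (σ-cong e) σ-0))
    scaled-span g∈@(snoc a∈ r∈ e) = span-resp (sym (*-assoc _ _ _))
      (span-scale μ∈ (lead⇒span (scaled-lead (a∈ , _ , r∈ , e))))
    scaled-lead {d} {a} {g} (a∈ , r , r∈ , e) = lead-resp (*-identityʳ _) eq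
      (lead-+span (lead-scale (σ∈ a∈) (translate d)) (scaled-span r∈))
      where
      eq : σ a * (y + l) ^ d + μ ^ d * σ r ≈ μ ^ d * σ g
      eq = trans (+-congʳ (*-congˡ (sym (μσy^ d)))) (trans
        (solve 4 (λ a z w r → a :* (z :* w) :+ z :* r := z :* (a :* w :+ r)) refl (σ a) (μ ^ d) (σ y ^ d) (σ r))
        (*-congˡ (trans (+-congʳ (trans (*-congˡ (sym (σ-^ y d))) (sym (σ-* a _)))) (trans (sym (σ-+ _ _)) (σ-cong (sym e))))))

    adjoin-σ : σClosed Adjoin
    adjoin-σ = record
      { const∈ = λ κ∈ → ⊆adjoin (const∈ κ∈)
      ; q∈ = ⊆adjoin q∈
      ; q⁻¹∈ = ⊆adjoin q⁻¹∈
      ; σ∈ = λ (d , g∈) → d , span-resp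
          (trans (sym (*-assoc _ _ _)) (trans (*-congʳ (trans (*-comm _ _) (με^≈1 d))) (*-identityˡ _)))
          (span-scale (^∈ (^∈ q⁻¹∈ m) d) (scaled-span g∈))
      }

    -- In a relation a yᵉ⁺¹ + b yᵉ + … = 0 of minimal degree, comparison with its image under σ
    -- shows that w = (e + 1) a y + b satisfies q^m a σ(w) = σ(a) w; so w is 0, or κ a when m = 0.
    transcendental : (∀ {u v} → B u → B v → ¬ (v ≈ 0#) → ¬ (v * y ≈ u)) → Transcendental
    transcendental nf zero (a∈ , r , nil r≈0 , e) g≈0 =
      trans (sym (trans (+-cong (*-identityʳ _) r≈0) (+-identityʳ _))) (trans (sym e) g≈0)
    transcendental nf (suc e) {a} {g} (a∈ , r , snoc {a = b} {r′} b∈ r′∈ er , eg) g≈0 = stable contra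
      where
      n : Carrier
      n = emb (suc e)

      c₁ : Carrier
      c₁ = a * (σ a * (n * l) + μ * σ b) + - (σ a * b)

      r-lead : Lead e b r
      r-lead = b∈ , r′ , r′∈ , er

      -- This is a μ^(e+1) σ(g) - σ(a) g, rearranged so that the terms in y^(e+1) cancel and the
      -- degree drops to `e`.
      h₁ : Lead e c₁ (a * (σ a * ((y + l) ^ suc e + - (y ^ suc e)) + μ * (μ ^ e * σ r)) + - (σ a * r))
      h₁ = lead-+ (lead-scale a∈ (lead-+ (lead-scale (σ∈ a∈) (above e)) (lead-scale μ∈ (scaled-lead r-lead))))
                  (lead-neg (lead-scale (σ∈ a∈) r-lead))

      σg≈0 : σ a * (y + l) ^ suc e + μ ^ suc e * σ r ≈ 0#
      σg≈0 = trans (+-congʳ (*-congˡ (sym (μσy^ (suc e))))) (trans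
        (solve 4 (λ a z w r → a :* (z :* w) :+ z :* r := z :* (a :* w :+ r)) refl (σ a) (μ ^ suc e) (σ y ^ suc e) (σ r))
        (trans (*-congˡ (trans (+-congʳ (trans (*-congˡ (sym (σ-^ y (suc e)))) (sym (σ-* a _)))) (trans (sym (σ-+ _ _))
          (trans (σ-cong (trans (sym eg) g≈0)) σ-0)))) (zeroʳ _)))

      h₁≈0 : a * (σ a * ((y + l) ^ suc e + - (y ^ suc e)) + μ * (μ ^ e * σ r)) + - (σ a * r) ≈ 0#
      h₁≈0 = combine₂ a (- σ a) σg≈0 (trans (sym eg) g≈0)
        (solve 8 (λ a sa W Y μ M sr r →
            (a :* (sa :* (W :+ :- Y) :+ μ :* (M :* sr)) :+ :- (sa :* r)) :+ (a :* con (+ 0) :+ :- sa :* con (+ 0))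
            := con (+ 0) :+ (a :* (sa :* W :+ (μ :* M) :* sr) :+ :- sa :* (a :* Y :+ r)))
          refl a (σ a) ((y + l) ^ suc e) (y ^ suc e) μ (μ ^ e) (σ r) r)

      second : a * (σ a * (n * l) + μ * σ b) ≈ σ a * b
      second = x∙y⁻¹≈ε⇒x≈y _ _ (transcendental nf e h₁ h₁≈0)

      w : Carrier
      w = n * a * y + b

      σw : σ w ≈ n * (σ a * σ y) + σ b
      σw = trans (σ-+ _ _) (+-congʳ (trans (σ-* _ _) (trans (*-congʳ (trans (σ-* _ _) (*-congʳ (σ-const (const-emb (suc e))))))
        (*-assoc _ _ _))))

      w-invariant : μ * (a * σ w) ≈ σ a * w
      w-invariant = trans (*-congˡ (*-congˡ σw)) (combine₂ (a * n * σ a) 1# law second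
        (solve 9 (λ μ a n sa sy sb b y l → μ :* (a :* (n :* (sa :* sy) :+ sb))
             :+ (a :* n :* sa :* (y :+ l) :+ con (+ 1) :* (sa :* b))
           := sa :* (n :* a :* y :+ b)
             :+ (a :* n :* sa :* (μ :* sy) :+ con (+ 1) :* (a :* (sa :* (n :* l) :+ μ :* sb))))
          refl μ a n (σ a) (σ y) (σ b) b y l))

      contra : ¬ (a ≈ 0#) → ⊥
      contra a≉0 = go m ≡.refl
        where
        na≉0 : ¬ (n * a ≈ 0#)
        na≉0 na≈0 = a≉0 (cancel-zero (emb≉0 e) na≈0)

        na∈ : B (n * a)
        na∈ = *∈ (emb∈ (suc e)) a∈

        -- In both cases the value found for w = n a y + b exhibits `y` as a fraction with
        -- denominator n a, which is nonzero in characteristic zero.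
        go : ∀ m′ → m ≡ m′ → ⊥
        go zero ≡.refl = invariant a≉0 (trans (sym (*-identityˡ _)) w-invariant) λ (κ , κ∈ , w≈κa) →
          nf (+∈ (*∈ (const∈ κ∈) a∈) (neg∈ b∈)) na∈ na≉0
            (combine₁ 1# w≈κa (solve 3 (λ z b ka → z :+ con (+ 1) :* ka := ka :+ :- b :+ con (+ 1) :* (z :+ b)) refl (n * a * y) b (κ * a)))
        go (suc j) ≡.refl = nf (neg∈ b∈) na∈ na≉0
          (combine₁ 1# (semi-invariant⁺ j a≉0 w-invariant)
            (solve 2 (λ z b → z :+ con (+ 1) :* con (+ 0) := :- b :+ con (+ 1) :* (z :+ b)) refl (n * a * y) b))

    -- The equation satisfied by h = u / v is q σ(h) = h + ρ, up to the weight (q^m)^k carried by y^k.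
    -- Leading coefficients in y solve it over B with the same ρ, unless deg u = deg v + k + 1 and m = 1:
    -- there u / v starts with κ y^(k+1) for a constant κ, whose removal shifts ρ.
    module Descent (P : Carrier → Set (c ⊔ ℓ)) (k : ℕ)
      (P-shift : m ≡ 1 → ∀ {κ ρ} → Const κ → P ρ → P (ρ + - (κ * (emb (suc k) * l))))
      (unsolvable : ∀ {u v ρ} → B u → B v → ¬ (v ≈ 0#) → P ρ → ¬ (q * (v * σ u) ≈ σ v * (u + ρ * v)))
      (tr : Transcendental) where

      private
        q*-cancel : ∀ {a b} → q * a ≈ q * b → a ≈ b
        q*-cancel = unit-cancel q*q⁻¹≈1

        lhs-lead : ∀ α β {u u₀ v b} → Lead α u₀ u → Lead β b v →
          Lead (β +ℕ α) (μ ^ k * μ ^ β * (q * (b * σ u₀))) (μ ^ α * μ ^ β * (q * μ ^ k * (v * σ u)))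
        lhs-lead α β {u} {u₀} {v} {b} u-lead v-lead = lead-resp
          (solve 5 (λ K M q b s → q :* K :* M :* (b :* s) := K :* M :* (q :* (b :* s))) refl (μ ^ k) (μ ^ β) q b (σ u₀))
          (solve 6 (λ K M N q v s → q :* K :* M :* (v :* (N :* s)) := N :* M :* (q :* K :* (v :* s))) refl (μ ^ k) (μ ^ β) (μ ^ α) q v (σ u))
          (lead-scale (*∈ (*∈ q∈ (^∈ μ∈ k)) (^∈ μ∈ β)) (lead-* v-lead (scaled-lead u-lead)))

        rhs-lead : ∀ α β {v b g g₀} → Lead β b v → Lead α g₀ g →
          Lead (β +ℕ α) (μ ^ α * (σ b * g₀)) (μ ^ α * μ ^ β * (σ v * g))
        rhs-lead α β {v} {b} {g} v-lead g-lead = lead-resp refl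
          (solve 4 (λ M N s g → N :* (M :* s :* g) := N :* M :* (s :* g)) refl (μ ^ β) (μ ^ α) (σ v) g)
          (lead-scale (^∈ μ∈ α) (lead-* (scaled-lead v-lead) g-lead))

        -- Multiplication by μ^α μ^β absorbs the weights of σ(u) and σ(v). Both sides then have
        -- degree at most β + α in `y` with explicit leading coefficients, which agree because `y`
        -- is transcendental.
        compare : ∀ α β {u u₀ v b g g₀} → Lead α u₀ u → Lead β b v → Lead α g₀ g →
          q * μ ^ k * (v * σ u) ≈ σ v * g → μ ^ k * μ ^ β * (q * (b * σ u₀)) ≈ μ ^ α * (σ b * g₀)
        compare α β u-lead v-lead g-lead e = lead-unique tr (β +ℕ α)
          (lhs-lead α β u-lead v-lead) (lead-resp refl (*-congˡ (sym e)) (rhs-lead α β v-lead g-lead))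

        unit : ∀ β → μ ^ k * μ ^ β * (ε ^ k * ε ^ β) ≈ 1#
        unit β = trans (solve 4 (λ a b c d → a :* b :* (c :* d) := (a :* c) :* (b :* d)) refl _ _ _ _)
          (trans (*-cong (με^≈1 k) (με^≈1 β)) (*-identityˡ 1#))

        μ^-split : ∀ k β i → μ ^ (k +ℕ β +ℕ i) ≈ μ ^ k * μ ^ β * μ ^ i
        μ^-split k β i = trans (^-homo-* μ (k +ℕ β) i) (*-congʳ (^-homo-* μ k β))

        lead-drop : ∀ {d a g} → Lead d a g → a ≈ 0# → Span d g
        lead-drop (_ , r , r∈ , e) a≈0 =
          span-resp (sym (trans e (trans (+-congʳ (trans (*-congʳ a≈0) (zeroˡ _))) (+-identityˡ _)))) r∈

      -- With deg u at most k + deg v, the product s v reaches the top degree and contributes ρ b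
      -- there. The powers of μ on the two sides coincide and cancel, which leaves q b σ(u₀) = σ(b)
      -- (u₀ + ρ b) over `B`; here u₀ may be zero.
      equal-degree : ∀ {u v s ρ β b} → Span (suc (k +ℕ β)) u → Lead β b v → ¬ (b ≈ 0#) →
        P ρ → Lead k ρ s → ¬ (q * μ ^ k * (v * σ u) ≈ σ v * (u + s * v))
      equal-degree {β = β} {b} u∈ v-lead b≉0 ρ∈ s-lead e with span⇒lead u∈
      ... | u₀ , u-lead = unsolvable (proj₁ u-lead) (proj₁ v-lead) b≉0 ρ∈
        (unit-cancel (unit β) (trans (compare (k +ℕ β) β u-lead v-lead (lead-+ u-lead (lead-* s-lead v-lead)) e)
          (*-congʳ (^-homo-* μ k β))))

      Descends : ℕ → Set (c ⊔ ℓ)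
      Descends d = ∀ {u v s ρ β b} → Span d u → Lead β b v → ¬ (b ≈ 0#) →
        P ρ → Lead k ρ s → ¬ (q * μ ^ k * (v * σ u) ≈ σ v * (u + s * v))

      -- Now s v lies below the top degree, so h₀ = u₀ / b satisfies the homogeneous equation q
      -- σ(h₀) = q^(m(i+1)) h₀. Unless the exponent m(i+1) is 1, this forces u₀ = 0 and the degree
      -- bound of u drops. Exponent 1 means m = 1 and i = 0, with h₀ a constant.
      higher-degree : ∀ β i → Descends (suc (k +ℕ β) +ℕ i) → ∀ {u v s ρ u₀ b} →
        Lead (suc (k +ℕ β) +ℕ i) u₀ u → Lead β b v → ¬ (b ≈ 0#) →
        P ρ → Lead k ρ s → ¬ (q * μ ^ k * (v * σ u) ≈ σ v * (u + s * v))
      higher-degree β i ih {u} {v} {s} {ρ} {u₀} {b} u-lead v-lead b≉0 ρ∈ s-lead e =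
        go (m *ℕ suc i) ≡.refl (trans leading (*-congʳ (^-assocʳ q m (suc i))))
        where
        α≡ : suc (k +ℕ β) +ℕ i ≡ k +ℕ β +ℕ suc i
        α≡ = ≡.sym (ℕ.+-suc (k +ℕ β) i)

        sv∈ : Span (suc (k +ℕ β) +ℕ i) (s * v)
        sv∈ = span-cast (ℕ.+-comm i _) (span-+ˡ i (lead⇒span (lead-* s-lead v-lead)))

        leading : q * (b * σ u₀) ≈ μ ^ suc i * (σ b * u₀)
        leading = unit-cancel (unit β) (trans (compare _ β u-lead v-lead (lead-+span u-lead sv∈) e)
          (trans (*-congʳ (trans (^-congʳ μ α≡) (μ^-split k β (suc i)))) (*-assoc _ _ _)))

        reduce : u₀ ≈ 0# → ⊥
        reduce u₀≈0 = ih (lead-drop u-lead u₀≈0) v-lead b≉0 ρ∈ s-lead e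

        exceptional : m ≡ 1 → i ≡ 0 → (∃ λ κ → Const κ × u₀ ≈ κ * b) → ⊥
        exceptional ≡.refl ≡.refl (κ , κ∈ , u₀≈κb) =
          ih u′∈ v-lead b≉0 (P-shift ≡.refl κ∈ ρ∈) s′-lead e′
          where
          u′∈ : Span (suc (k +ℕ β) +ℕ 0) (u + - (κ * y ^ suc k * v))
          u′∈ = lead-drop (lead-+ u-lead (lead-neg (lead-cast (≡.sym (ℕ.+-identityʳ _))
              (lead-* (lead-scale (const∈ κ∈) (lead-y^ (suc k))) v-lead))))
            (combine₁ 1# u₀≈κb (solve 3 (λ u k b → u :+ :- (k :* con (+ 1) :* b) :+ con (+ 1) :* (k :* b)
              := con (+ 0) :+ con (+ 1) :* u) refl u₀ κ b))

          s′-lead : Lead k (ρ + - (κ * (emb (suc k) * l))) (s + - (κ * ((y + l) ^ suc k + - (y ^ suc k))))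
          s′-lead = lead-+ s-lead (lead-neg (lead-scale (const∈ κ∈) (above k)))

          -- Because m = 1, the factor q μ^k is μ^(k+1), exactly the weight of y^(k+1).
          weight : q * μ ^ k * σ y ^ suc k ≈ (y + l) ^ suc k
          weight = trans (*-congʳ (*-congʳ (sym (*-identityʳ q)))) (μσy^ (suc k))

          e′ : q * μ ^ k * (v * σ (u + - (κ * y ^ suc k * v))) ≈
               σ v * (u + - (κ * y ^ suc k * v) + (s + - (κ * ((y + l) ^ suc k + - (y ^ suc k)))) * v)
          e′ = trans (*-congˡ (*-congˡ (trans (σ-+ _ _) (+-congˡ (trans (σ-neg _)
                 (-‿cong (trans (σ-* _ _) (*-congʳ (trans (σ-* _ _) (*-cong (σ-const κ∈) (σ-^ y (suc k))))))))))))
            (trans (solve 7 (λ q M v su κ Z sv → q :* M :* (v :* (su :+ :- (κ :* Z :* sv)))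
                      := q :* M :* (v :* su) :+ :- (κ :* (v :* sv) :* (q :* M :* Z)))
                    refl q (μ ^ k) v (σ u) κ (σ y ^ suc k) (σ v))
            (trans (+-cong e (-‿cong (*-congˡ weight)))
              (solve 7 (λ v κ sv u s W Y → sv :* (u :+ s :* v) :+ :- (κ :* (v :* sv) :* W)
                 := sv :* (u :+ :- (κ :* Y :* v) :+ (s :+ :- (κ :* (W :+ :- Y))) :* v))
                refl v κ (σ v) u s ((y + l) ^ suc k) (y ^ suc k))))

        go : ∀ j → m *ℕ suc i ≡ j → q * (b * σ u₀) ≈ q ^ j * (σ b * u₀) → ⊥
        go zero _ h = reduce (semi-invariant⁺ 0 b≉0
          (trans (*-congʳ (*-identityʳ q)) (trans h (*-identityˡ _))))
        go (suc zero) eq h = invariant b≉0 (q*-cancel (trans h (*-congʳ (*-identityʳ q))))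
          (exceptional (ℕ.m*n≡1⇒m≡1 m (suc i) eq) (ℕ.suc-injective (ℕ.m*n≡1⇒n≡1 m (suc i) eq)))
        go (suc (suc j)) _ h = reduce (semi-invariant⁻ j b≉0 (q*-cancel (trans h (*-assoc _ _ _))))

      descent : ∀ d → Descends d
      descent d {β = β} u∈ v-lead b≉0 ρ∈ s-lead e with d ℕ.≤? suc (k +ℕ β)
      ... | yes d≤ = equal-degree (span-≤ d≤ u∈) v-lead b≉0 ρ∈ s-lead e
      descent zero u∈ v-lead b≉0 ρ∈ s-lead e | no d≰ = d≰ z≤n
      descent (suc α) {β = β} u∈ v-lead b≉0 ρ∈ s-lead e | no d≰ =
        let i , eq = ℕ.m≤n⇒∃[o]m+o≡n (ℕ.≤-pred (ℕ.≰⇒> d≰))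
        in higher-degree β i (≡.subst Descends (≡.sym eq) (descent α))
             (lead-cast (≡.sym eq) (proj₂ (span⇒lead u∈))) v-lead b≉0 ρ∈ s-lead e

-- The tower generated by the derivatives of a solution of σ(f) = f - t

record AbelEquation (c ℓ : Level) : Set (lsuc (c ⊔ ℓ)) where
  field
    domain : DifferenceDomain c ℓ
  open DifferenceDomain domain public
  open Difference domain public
  field
    θ : Carrier → Carrier
    θ-cong : ∀ {x y} → x ≈ y → θ x ≈ θ y
    θ-+ : ∀ x y → θ (x + y) ≈ θ x + θ y
    θ-* : ∀ x y → θ (x * y) ≈ θ x * y + x * θ y
    θ-const : ∀ {κ} → Const κ → θ κ ≈ 0#
    θσ : ∀ g → θ (σ g) ≈ q * σ (θ g)

    t ω : Carrier
    θt≈t : θ t ≈ t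
    -- The logarithmic derivative of q = t p′ / p, namely θ(q) / q = 1 + t p″ / p′ - t p′ / p.
    θq : θ q ≈ q * (ω + (1# + - q))

    Base : Carrier → Set (c ⊔ ℓ)
    base : Subring Base
    base-σ : σClosed Base
    base-θ : ∀ {g} → Base g → Base (θ g)
    t∈ : Base t
    ω∈ : Base ω

    f : Carrier
    σf : σ f ≈ f + - t

    unsolvable₀ : ∀ {u v} → Base u → Base v → ¬ (v ≈ 0#) → ¬ (v * σ u ≈ σ v * (u + - t * v))
    unsolvable₁ : ∀ {u v} → Base u → Base v → ¬ (v ≈ 0#) → ¬ (q * (v * σ u) ≈ σ v * (u + - t * v))
    unsolvable₂ : ∀ {u v γ δ} → Base u → Base v → ¬ (v ≈ 0#) → Const γ → Const δ → ¬ (γ ≈ 0#) →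
      ¬ (q * (v * σ u) ≈ σ v * (u + (γ * ω + δ * t) * v))

module Tower {c ℓ : Level} (S : AbelEquation c ℓ) where
  open AbelEquation S
  open IntegerSolver commutativeRing

  -- The recursion is that of t^n f⁽ⁿ⁾, since θ(t^n f⁽ⁿ⁾) = n t^n f⁽ⁿ⁾ + t^(n+1) f⁽ⁿ⁺¹⁾.
  x : ℕ → Carrier
  x zero = f
  x (suc n) = θ (x n) + - (emb n * x n)

  -- The ring generated over `Base` by x 0, ..., x (n-1), so that `x n` is the first generator
  -- outside its construction.
  A : ℕ → Carrier → Set (c ⊔ ℓ)
  A-subring : ∀ n → Subring (A n)
  A zero = Base
  A (suc n) = Polynomials.Adjoin (A-subring n) (x n)
  A-subring zero = base
  A-subring (suc n) = Polynomials.adjoin (A-subring n) (x n)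

  A⊆ : ∀ n {g} → A n g → A (suc n) g
  A⊆ n = Polynomials.⊆adjoin (A-subring n) (x n)

  x∈ : ∀ n → A (suc n) (x n)
  x∈ n = Polynomials.y∈adjoin (A-subring n) (x n)

  base⊆ : ∀ n {g} → Base g → A n g
  base⊆ zero g∈ = g∈
  base⊆ (suc n) g∈ = A⊆ n (base⊆ n g∈)

  θ-0 : θ 0# ≈ 0#
  θ-0 = θ-const (const-emb 0)

  θ-neg : ∀ g → θ (- g) ≈ - θ g
  θ-neg g = +-cancelˡ (θ g) _ _
    (trans (sym (θ-+ g (- g))) (trans (θ-cong (-‿inverseʳ g)) (trans θ-0 (sym (-‿inverseʳ (θ g))))))

  θx : ∀ n → θ (x n) ≈ x (suc n) + emb n * x n
  θx n = solve 2 (λ z w → z := z :+ :- w :+ w) refl (θ (x n)) (emb n * x n)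

  θ∈ : ∀ n {g} → A n g → A (suc n) (θ g)
  θ∈ zero g∈ = A⊆ 0 (base-θ g∈)
  θ∈ (suc n) (d , g∈) = go g∈
    where
    open Polynomials (A-subring n) (x n) using (Span; nil; snoc)
    module A₁ = Subring (A-subring (suc n))
    module A₂ = Subring (A-subring (suc (suc n)))

    x∈₂ : A (suc (suc n)) (x n)
    x∈₂ = A⊆ (suc n) (x∈ n)

    θx^∈ : ∀ e → A (suc (suc n)) (θ (x n ^ e))
    θx^∈ zero = A₂.resp (sym (θ-const (Subring.1∈ const-subring))) A₂.0∈
    θx^∈ (suc e) = A₂.resp (sym (trans (θ-* _ _) (+-congʳ (*-congʳ (θx n)))))
      (A₂.+∈ (A₂.*∈ (A₂.+∈ (x∈ (suc n)) (A₂.*∈ (A₂.emb∈ n) x∈₂)) (A₂.^∈ x∈₂ e)) (A₂.*∈ x∈₂ (θx^∈ e)))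

    go : ∀ {d g} → Span d g → A (suc (suc n)) (θ g)
    go (nil e) = A₂.resp (sym (trans (θ-cong e) θ-0)) A₂.0∈
    go (snoc {d} a∈ r∈ e) = A₂.resp (sym (trans (θ-cong e) (trans (θ-+ _ _) (+-congʳ (θ-* _ _)))))
      (A₂.+∈ (A₂.+∈ (A₂.*∈ (A⊆ (suc n) (θ∈ n a∈)) (A₂.^∈ x∈₂ d)) (A₂.*∈ (A⊆ (suc n) (A⊆ n a∈)) (θx^∈ d))) (go r∈))

  X : ℕ → Carrier
  X n = q ^ n * σ (x n)

  θq^ : ∀ n → θ (q ^ n) ≈ emb n * (q ^ n * (ω + (1# + - q)))
  θq^ zero = trans (θ-const (Subring.1∈ const-subring)) (sym (zeroˡ _))
  θq^ (suc n) = trans (θ-* _ _) (trans (+-cong (*-congʳ θq) (*-congˡ (θq^ n)))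
    (solve 4 (λ q w z n → q :* w :* z :+ q :* (n :* (z :* w)) := (con (+ 1) :+ n) :* (q :* z :* w)) refl q (ω + (1# + - q)) (q ^ n) (emb n)))

  -- In θ(q^n σ(x_n)) the derivative of q^n contributes n (ω + 1 - q) q^n σ(x_n). Its part with - n
  -- q cancels the term n x_n of θ(x_n) = x_(n+1) + n x_n after σ, so no bare q survives.
  X-suc : ∀ n → X (suc n) ≈ θ (X n) + - (emb n * X n) + - (emb n * ω * X n)
  X-suc n = trans (*-congˡ (trans (σ-+ _ _) (+-congˡ (trans (σ-neg _) (-‿cong (trans (σ-* _ _) (*-congʳ (σ-const (const-emb n)))))))))
    (trans (solve 5 (λ q z y n s → q :* z :* (y :+ :- (n :* s)) := z :* (q :* y) :+ :- (n :* q :* z :* s)) refl q (q ^ n) (σ (θ (x n))) (emb n) (σ (x n)))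
    (trans (+-congʳ (*-congˡ (sym (θσ (x n)))))
    (trans (solve 6 (λ q z y n s w → z :* y :+ :- (n :* q :* z :* s) := n :* (z :* (w :+ (con (+ 1) :+ :- q))) :* s :+ z :* y :+ :- (n :* (z :* s)) :+ :- (n :* w :* (z :* s)))
       refl q (q ^ n) (θ (σ (x n))) (emb n) (σ (x n)) ω)
    (+-congʳ (+-congʳ (sym (trans (θ-* _ _) (+-congʳ (*-congʳ (θq^ n))))))))))

  -- β k is the binomial coefficient C(k + 2, 2).
  β : ℕ → ℕ
  β zero = 1
  β (suc k) = suc (suc k) +ℕ β k

  X₁ : X 1 ≈ x 1 + - t
  X₁ = trans (X-suc 0) (trans (+-congʳ (+-congʳ (trans (θ-cong (trans (*-identityˡ _) σf)) (trans (θ-+ _ _) (+-congˡ (trans (θ-neg t) (-‿cong θt≈t)))))))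
    (solve 5 (λ y t X w f → y :+ :- t :+ :- (con (+ 0) :* X) :+ :- (con (+ 0) :* w :* X) := y :+ :- (con (+ 0) :* f) :+ :- t) refl (θ f) t (X 0) ω f))

  emb-+ : ∀ m n → emb (m +ℕ n) ≈ emb m + emb n
  emb-+ zero n = sym (+-identityˡ _)
  emb-+ (suc m) n = trans (+-congˡ (emb-+ m n)) (sym (+-assoc _ _ _))

  -- With n = k + 2, applying θ turns - C(n,2) ω x_(n-1) into - C(n,2) ω x_n plus lower terms, and -
  -- n ω X_n contributes a further - n ω x_n; the coefficients add up by C(n,2) + n = C(n+1,2).
  X-law : ∀ k → ∃ λ l → A (suc k) l × X (suc (suc k)) ≈ x (suc (suc k)) + (- emb (β k) * ω * x (suc k) + l)
  X-law zero = ω * t , base⊆ 1 (Subring.*∈ base ω∈ t∈) ,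
    trans (X-suc 1) (trans (+-cong (+-cong (trans (θ-cong X₁) (trans (θ-+ _ _) (+-congˡ (trans (θ-neg t) (-‿cong θt≈t))))) (-‿cong (*-congˡ X₁))) (-‿cong (*-congˡ X₁)))
      (solve 4 (λ y x t w → y :+ :- t :+ :- ((con (+ 1) :+ con (+ 0)) :* (x :+ :- t)) :+ :- ((con (+ 1) :+ con (+ 0)) :* w :* (x :+ :- t))
         := y :+ :- ((con (+ 1) :+ con (+ 0)) :* x) :+ (:- (con (+ 1) :+ con (+ 0)) :* w :* x :+ w :* t)) refl (θ (x 1)) (x 1) t ω))
  X-law (suc k) with X-law k
  ... | l , l∈ , eq = l′ , l′∈ , eq′
    where
    n a g h l′ : Carrier
    n = emb (suc (suc k))
    a = - emb (β k) * ω
    g = a * x (suc k) + l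
    h = θ a * x (suc k) + a * (emb (suc k) * x (suc k)) + θ l
    l′ = h + - (n * g) + - (n * ω * g)

    a∈ : Base a
    a∈ = Subring.*∈ base (Subring.neg∈ base (Subring.emb∈ base (β k))) ω∈

    module A₂ = Subring (A-subring (suc (suc k)))

    g∈ : A (suc (suc k)) g
    g∈ = A₂.+∈ (A₂.*∈ (base⊆ (suc (suc k)) a∈) (x∈ (suc k))) (A⊆ (suc k) l∈)

    h∈ : A (suc (suc k)) h
    h∈ = A₂.+∈ (A₂.+∈ (A₂.*∈ (base⊆ (suc (suc k)) (base-θ a∈)) (x∈ (suc k)))
      (A₂.*∈ (base⊆ (suc (suc k)) a∈) (A₂.*∈ (A₂.emb∈ (suc k)) (x∈ (suc k))))) (θ∈ (suc k) l∈)

    l′∈ : A (suc (suc k)) l′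
    l′∈ = A₂.+∈ (A₂.+∈ h∈ (A₂.neg∈ (A₂.*∈ (A₂.emb∈ (suc (suc k))) g∈)))
      (A₂.neg∈ (A₂.*∈ (A₂.*∈ (A₂.emb∈ (suc (suc k))) (base⊆ (suc (suc k)) ω∈)) g∈))

    θg : θ g ≈ a * x (suc (suc k)) + h
    θg = trans (θ-+ _ _) (trans (+-congʳ (trans (θ-* _ _) (+-congˡ (*-congˡ (θx (suc k))))))
      (solve 6 (λ b z a w m l → b :* z :+ a :* (w :+ m) :+ l := a :* w :+ (b :* z :+ a :* m :+ l)) refl
        (θ a) (x (suc k)) a (x (suc (suc k))) (emb (suc k) * x (suc k)) (θ l)))

    a′ : - emb (β (suc k)) * ω ≈ a + - (n * ω)
    a′ = trans (*-congʳ (-‿cong (emb-+ (suc (suc k)) (β k))))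
      (solve 3 (λ n b w → :- (n :+ b) :* w := :- b :* w :+ :- (n :* w)) refl n (emb (β k)) ω)

    eq′ : X (suc (suc (suc k))) ≈ x (suc (suc (suc k))) + (- emb (β (suc k)) * ω * x (suc (suc k)) + l′)
    eq′ = trans (X-suc (suc (suc k))) (trans
      (+-cong (+-cong (trans (θ-cong eq) (trans (θ-+ _ _) (+-congˡ θg))) (-‿cong (*-congˡ eq))) (-‿cong (*-congˡ eq)))
      (trans (solve 7 (λ y w a h n g o → y :+ (a :* w :+ h) :+ :- (n :* (w :+ g)) :+ :- (n :* o :* (w :+ g))
         := y :+ :- (n :* w) :+ ((a :+ :- (n :* o)) :* w :+ (h :+ :- (n :* g) :+ :- (n :* o :* g)))) refl
         (θ (x (suc (suc k)))) (x (suc (suc k))) a h n g ω)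
      (+-congˡ (+-congʳ (*-congʳ (sym a′))))))

  law : ∀ n → ∃ λ l → A n l × q ^ n * σ (x n) ≈ x n + l
  law zero = - t , Subring.neg∈ base t∈ , trans (*-identityˡ _) σf
  law (suc zero) = - t , base⊆ 1 (Subring.neg∈ base t∈) , X₁
  law (suc (suc k)) with X-law k
  ... | l , l∈ , eq = _ , A₂.+∈ (A₂.*∈ (base⊆ (suc (suc k)) (Subring.*∈ base (Subring.neg∈ base (Subring.emb∈ base (β k))) ω∈)) (x∈ (suc k))) (A⊆ (suc k) l∈) , eq
    where module A₂ = Subring (A-subring (suc (suc k)))

  A-σ : ∀ n → σClosed (A n)
  A-σ zero = base-σ
  A-σ (suc n) = Extension.adjoin-σ (A-subring n) (A-σ n) (x n) n (proj₁ (proj₂ (law n))) (proj₂ (proj₂ (law n)))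

  module E n = Extension (A-subring n) (A-σ n) (x n) n (proj₁ (proj₂ (law n))) (proj₂ (proj₂ (law n)))

  Independent : ℕ → Set (c ⊔ ℓ)
  Independent n = Polynomials.Transcendental (A-subring n) (x n)

  Unsolvable : ℕ → (Carrier → Set (c ⊔ ℓ)) → Set (c ⊔ ℓ)
  Unsolvable n P = ∀ {u v ρ} → A n u → A n v → ¬ (v ≈ 0#) → P ρ → ¬ (q * (v * σ u) ≈ σ v * (u + ρ * v))

  nonzero-lead : ∀ n d {v} → E.Span n d v → ¬ (v ≈ 0#) → ¬ ¬ (∃ λ β → ∃ λ b → E.Lead n β b v × ¬ (b ≈ 0#))
  nonzero-lead n zero (E.nil e) v≉0 _ = v≉0 e
  nonzero-lead n (suc d) (E.snoc {a = b} b∈ r∈ e) v≉0 none =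
    none (d , b , (b∈ , _ , r∈ , e) , λ b≈0 →
      nonzero-lead n d (E.span-resp n (sym (trans e (trans (+-congʳ (trans (*-congʳ b≈0) (zeroˡ _))) (+-identityˡ _)))) r∈) v≉0 none)

  unsolvable-suc : ∀ n (P : Carrier → Set (c ⊔ ℓ)) → (∀ {ρ} → P ρ → Base ρ) →
    (n ≡ 1 → ∀ {κ ρ} → Const κ → P ρ → P (ρ + - (κ * (emb 1 * proj₁ (law n))))) →
    Independent n → Unsolvable n P → Unsolvable (suc n) P
  unsolvable-suc n P P⊆ P-shift tr un {v = v} (d , u∈) (_ , v∈) v≉0 ρ∈ e =
    nonzero-lead n _ v∈ v≉0 λ (β , b , v-lead , b≉0) →
      E.Descent.descent n P 0 P-shift un tr d u∈ v-lead b≉0 ρ∈ (E.lead-const n (base⊆ n (P⊆ ρ∈)))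
        (trans (*-congʳ (*-identityʳ q)) e)

  -- The parameter δ is free so that the family is closed under the shifts by multiples of t that
  -- occur at `x 1`, whereas γ is never changed.
  Shifted : Carrier → Set (c ⊔ ℓ)
  Shifted ρ = ∃ λ γ → ∃ λ δ → Const γ × Const δ × ¬ (γ ≈ 0#) × ρ ≈ γ * ω + δ * t

  shifted⊆ : ∀ {ρ} → Shifted ρ → Base ρ
  shifted⊆ (γ , δ , γ∈ , δ∈ , _ , e) = resp (sym e) (+∈ (*∈ (const∈ γ∈) ω∈) (*∈ (const∈ δ∈) t∈))
    where open Subring base
          open σClosed base-σ

  shifted-shift : ∀ k n → n ≡ 1 → ∀ {κ ρ} → Const κ → Shifted ρ → Shifted (ρ + - (κ * (emb (suc k) * proj₁ (law n))))
  shifted-shift k n ≡.refl {κ} κ∈ (γ , δ , γ∈ , δ∈ , γ≉0 , e) =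
    γ , δ + κ * emb (suc k) , γ∈ , +∈ δ∈ (*∈ κ∈ (const-emb (suc k))) , γ≉0 ,
    trans (+-congʳ e) (solve 6 (λ γ w δ t κ n → γ :* w :+ δ :* t :+ :- (κ :* (n :* :- t)) := γ :* w :+ (δ :+ κ :* n) :* t)
      refl γ ω δ t κ (emb (suc k)))
    where open Subring const-subring

  unsolvable-shifted : ∀ n → (∀ {m} → m <ℕ n → Independent m) → Unsolvable n Shifted
  unsolvable-shifted zero _ u∈ v∈ v≉0 (γ , δ , γ∈ , δ∈ , γ≉0 , e) eq =
    unsolvable₂ u∈ v∈ v≉0 γ∈ δ∈ γ≉0 (trans eq (*-congˡ (+-congˡ (*-congʳ e))))
  unsolvable-shifted (suc n) ind = unsolvable-suc n Shifted shifted⊆ (shifted-shift 0 n) (ind ℕ.≤-refl)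
    (unsolvable-shifted n (λ m<n → ind (ℕ.m<n⇒m<1+n m<n)))

  fraction-law : ∀ n {u v} → v * x n ≈ u → q ^ n * (v * σ u) ≈ σ v * (u + proj₁ (law n) * v)
  fraction-law n {u} {v} e = trans (*-congˡ (*-congˡ (trans (σ-cong (sym e)) (σ-* _ _)))) (trans
    (solve 4 (λ q v w y → q :* (v :* (w :* y)) := w :* v :* (q :* y)) refl (q ^ n) v (σ v) (σ (x n)))
    (trans (*-congˡ (proj₂ (proj₂ (law n)))) (trans
    (solve 4 (λ v w y l → w :* v :* (y :+ l) := w :* (v :* y :+ l :* v)) refl v (σ v) (x n) (proj₁ (law n)))
    (*-congˡ (+-congʳ e)))))

  -- The law for `x n` becomes an equation for u / v. For n ≥ 2 its inhomogeneous term has degree 1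
  -- in x (n-1), hence one descent with k = 1. The coefficient - C(n,2) ω that remains is free of
  -- the generators, so every later descent has k = 0.
  not-fraction : ∀ n → (∀ {m} → m <ℕ n → Independent m) → ∀ {u v} → A n u → A n v → ¬ (v ≈ 0#) → ¬ (v * x n ≈ u)
  not-fraction zero ind u∈ v∈ v≉0 e = unsolvable₀ u∈ v∈ v≉0 (trans (sym (*-identityˡ _)) (fraction-law 0 e))
  not-fraction (suc zero) ind u∈ v∈ v≉0 e =
    -- The only descent is along `x 0`, where m = 0. The exceptional case cannot occur there, so the
    -- family may consist of - t alone.
    unsolvable-suc 0 P (λ (lift e) → Subring.resp base (sym e) (Subring.neg∈ base t∈)) (λ ()) (ind (s≤s z≤n))
      (λ u∈ v∈ v≉0 (lift e) eq → unsolvable₁ u∈ v∈ v≉0 (trans eq (*-congˡ (+-congˡ (*-congʳ e)))))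
      u∈ v∈ v≉0 (lift refl) (trans (*-congʳ (sym (*-identityʳ q))) (fraction-law 1 e))
    where
    P : Carrier → Set (c ⊔ ℓ)
    P ρ = Lift c (ρ ≈ - t)
  not-fraction (suc (suc k)) ind {u} {v} (d , u∈) (_ , v∈) v≉0 e =
    nonzero-lead n _ v∈ v≉0 λ (_ , _ , v-lead , b≉0) →
      E.Descent.descent n Shifted 1 (shifted-shift 1 n) (unsolvable-shifted n (λ m<n → ind (ℕ.m<n⇒m<1+n m<n))) (ind ℕ.≤-refl)
        d u∈ v-lead b≉0 ρ∈ s-lead (trans (*-congʳ (*-congˡ (*-identityʳ _))) (fraction-law (suc n) e))
    where
    n : ℕ
    n = suc k

    γ : Carrier
    γ = - emb (β k)

    γ≉0 : ∀ k → ¬ (- emb (β k) ≈ 0#)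
    γ≉0 zero e = emb≉0 0 (trans (sym (-‿involutive _)) (trans (-‿cong e) -0#≈0#))
    γ≉0 (suc k) e = emb≉0 (suc k +ℕ β k) (trans (sym (-‿involutive _)) (trans (-‿cong e) -0#≈0#))

    ρ∈ : Shifted (γ * ω)
    ρ∈ = γ , 0# , Subring.neg∈ const-subring (const-emb (β k)) , Subring.0∈ const-subring , γ≉0 k ,
      sym (trans (+-congˡ (zeroˡ t)) (+-identityʳ _))

    s-lead : E.Lead n 1 (γ * ω) (proj₁ (law (suc n)))
    s-lead with X-law k
    ... | l , l∈ , _ = base⊆ n (shifted⊆ ρ∈) , l , E.span-const n l∈ , +-congʳ (*-congˡ (sym (*-identityʳ _)))

  independent-below : ∀ n {m} → m <ℕ n → Independent m
  independent-below (suc n) {m} (s≤s m≤n) = E.transcendental m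
    (not-fraction m λ k<m → independent-below n (ℕ.<-≤-trans k<m m≤n))

  independent : ∀ n → Independent n
  independent n = independent-below (suc n) ℕ.≤-refl

-- The theorem is a negation whose hypotheses use ≈ only as a conclusion or under a negation, so it may be
-- proved for the coarser equality ¬ ¬ (x ≈ y), which has the advantage of being stable.
stabilise : ∀ {c ℓ} → CommutativeRing c ℓ → CommutativeRing c ℓ
stabilise K = record
  { Carrier = Carrier
  ; _≈_ = λ x y → ¬ ¬ (x ≈ y)
  ; _+_ = _+_
  ; _*_ = _*_
  ; -_ = -_
  ; 0# = 0#
  ; 1# = 1#
  ; isCommutativeRing = record
    { isRing = record
      { +-isAbelianGroup = record
        { isGroup = record
          { isMonoid = record
            { isSemigroup = record
              { isMagma = record
                { isEquivalence = record
                  { refl = return refl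
                  ; sym = λ p k → p (k ∘ sym)
                  ; trans = λ p p′ k → p λ e → p′ λ e′ → k (trans e e′)
                  }
                ; ∙-cong = λ p p′ k → p λ e → p′ λ e′ → k (+-cong e e′)
                }
              ; assoc = λ x y z → return (+-assoc x y z)
              }
            ; identity = (λ x → return (+-identityˡ x)) , λ x → return (+-identityʳ x)
            }
          ; inverse = (λ x → return (-‿inverseˡ x)) , λ x → return (-‿inverseʳ x)
          ; ⁻¹-cong = λ p k → p (k ∘ -‿cong)
          }
        ; comm = λ x y → return (+-comm x y)
        }
      ; *-cong = λ p p′ k → p λ e → p′ λ e′ → k (*-cong e e′)
      ; *-assoc = λ x y z → return (*-assoc x y z)
      ; *-identity = (λ x → return (*-identityˡ x)) , λ x → return (*-identityʳ x)
      ; distrib = (λ x y z → return (distribˡ x y z)) , λ x y z → return (distribʳ x y z)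
      }
    ; *-comm = λ x y → return (*-comm x y)
    }
  }
  where
  open CommutativeRing K
  return : ∀ {a} {A : Set a} → A → ¬ ¬ A
  return a k = k a

-- The ring of formal power series

module SeriesRing {c ℓ : Level} (K₀ : CommutativeRing c ℓ) where
  K : CommutativeRing c ℓ
  K = stabilise K₀

  open CommutativeRing K
  open RingFacts K
  open IntegerSolver K
  open Over K₀ using (Series; Σl; mul; one; addS; zeroS)

  stable : ∀ {x y} → ¬ ¬ (x ≈ y) → x ≈ y
  stable p k = p λ e → e k

  infix 4 _≈ₛ_
  _≈ₛ_ : Series → Series → Set ℓ
  f ≈ₛ g = ∀ k → f k ≈ g k

  tail : Series → Series
  tail f k = f (suc k)

  private
    rangeSum : ℕ → (ℕ → Carrier) → Carrier
    rangeSum zero h = 0#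
    rangeSum (suc n) h = h 0 + rangeSum n (h ∘ suc)

    Σl-applyUpTo : ∀ (e : ℕ → ℕ) n h → Σl (applyUpTo e n) h ≡ rangeSum n (h ∘ e)
    Σl-applyUpTo e zero h = ≡.refl
    Σl-applyUpTo e (suc n) h = ≡.cong (_+_ (h (e 0))) (Σl-applyUpTo (e ∘ suc) n h)

  infixl 7 _*ₛ_

  -- Opaque, so that unification does not unfold the convolution.
  abstract
    _*ₛ_ : Series → Series → Series
    _*ₛ_ = mul

    *ₛ≡mul : _*ₛ_ ≡ mul
    *ₛ≡mul = ≡.refl

    mul-head : ∀ f g → (f *ₛ g) 0 ≈ f 0 * g 0
    mul-head f g = +-identityʳ (f 0 * g 0)

    -- Together with `mul-head` this recursion determines the convolution; the ring laws follow from
    -- it by induction on the index, without rearranging sums.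
    mul-tail : ∀ f g k → (f *ₛ g) (suc k) ≈ f 0 * g (suc k) + (tail f *ₛ g) k
    mul-tail f g k = reflexive (≡.cong (_+_ (f 0 * g (suc k)))
      (≡.trans (Σl-applyUpTo suc (suc k) (λ i → f i * g (suc k ∸ i))) (≡.sym (Σl-applyUpTo id (suc k) (λ i → f (suc i) * g (k ∸ i))))))

  mul-cong : ∀ {f f′ g g′} → f ≈ₛ f′ → g ≈ₛ g′ → f *ₛ g ≈ₛ f′ *ₛ g′
  mul-cong f≈ g≈ zero = trans (mul-head _ _) (trans (*-cong (f≈ 0) (g≈ 0)) (sym (mul-head _ _)))
  mul-cong f≈ g≈ (suc k) = trans (mul-tail _ _ k) (trans
    (+-cong (*-cong (f≈ 0) (g≈ (suc k))) (mul-cong (f≈ ∘ suc) g≈ k)) (sym (mul-tail _ _ k)))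

  mul-distribʳ : ∀ h f g → addS f g *ₛ h ≈ₛ addS (f *ₛ h) (g *ₛ h)
  mul-distribʳ h f g zero = trans (mul-head _ _) (trans (distribʳ _ _ _) (sym (+-cong (mul-head _ _) (mul-head _ _))))
  mul-distribʳ h f g (suc k) = trans (mul-tail _ _ k) (trans
    (+-congˡ (mul-distribʳ h (tail f) (tail g) k)) (trans
    (solve 5 (λ a b x u v → (a :+ b) :* x :+ (u :+ v) := (a :* x :+ u) :+ (b :* x :+ v)) refl _ _ _ _ _)
    (sym (+-cong (mul-tail _ _ k) (mul-tail _ _ k)))))

  mul-scale : ∀ κ f g → (λ k → κ * f k) *ₛ g ≈ₛ λ k → κ * (f *ₛ g) k
  mul-scale κ f g zero = trans (mul-head _ _) (trans (*-assoc _ _ _) (*-congˡ (sym (mul-head _ _))))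
  mul-scale κ f g (suc k) = trans (mul-tail _ _ k) (trans (+-congˡ (mul-scale κ (tail f) g k)) (trans
    (solve 4 (λ κ a b c → κ :* a :* b :+ κ :* c := κ :* (a :* b :+ c)) refl _ _ _ _)
    (*-congˡ (sym (mul-tail _ _ k)))))

  mul-zeroˡ : ∀ g → zeroS *ₛ g ≈ₛ zeroS
  mul-zeroˡ g zero = trans (mul-head _ _) (zeroˡ _)
  mul-zeroˡ g (suc k) = trans (mul-tail _ _ k) (trans (+-cong (zeroˡ _) (mul-zeroˡ g k)) (+-identityˡ _))

  mul-assoc : ∀ f g h → f *ₛ g *ₛ h ≈ₛ f *ₛ (g *ₛ h)
  mul-assoc f g h zero = trans (mul-head _ _) (trans (*-congʳ (mul-head _ _)) (trans (*-assoc _ _ _)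
    (sym (trans (mul-head _ _) (*-congˡ (mul-head _ _))))))
  mul-assoc f g h (suc k) = trans (mul-tail _ _ k) (trans
    (+-cong (*-congʳ (mul-head f g)) (trans (mul-cong (mul-tail f g) (λ _ → refl) k)
      (trans (mul-distribʳ h (λ k → f 0 * tail g k) (tail f *ₛ g) k) (+-cong (mul-scale (f 0) (tail g) h k) (mul-assoc (tail f) g h k)))))
    (trans (solve 5 (λ a b x u v → a :* b :* x :+ (a :* u :+ v) := a :* (b :* x :+ u) :+ v) refl _ _ _ _ _)
    (sym (trans (mul-tail _ _ k) (+-congʳ (*-congˡ (mul-tail g h k)))))))

  -- The recursion strips only the left factor, so the two factors are stripped alternately, which
  -- lowers the index by two; hence the separate case of index 1.
  mul-comm : ∀ f g → f *ₛ g ≈ₛ g *ₛ f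
  mul-comm f g zero = trans (mul-head _ _) (trans (*-comm _ _) (sym (mul-head _ _)))
  mul-comm f g (suc zero) = trans (mul-tail _ _ 0) (trans (+-congˡ (mul-head _ _)) (trans
    (solve 4 (λ a b c d → a :* b :+ c :* d := d :* c :+ b :* a) refl _ _ _ _)
    (sym (trans (mul-tail _ _ 0) (+-congˡ (mul-head _ _))))))
  mul-comm f g (suc (suc k)) = trans (mul-tail _ _ (suc k)) (trans
    (+-congˡ (trans (mul-comm (tail f) g (suc k)) (mul-tail _ _ k)))
    (trans (+-congˡ (+-congˡ (mul-comm (tail g) (tail f) k)))
    (trans (solve 5 (λ a b c d e → a :* b :+ (c :* d :+ e) := c :* d :+ (a :* b :+ e)) refl _ _ _ _ _)
    (sym (trans (mul-tail _ _ (suc k)) (+-congˡ (trans (mul-comm (tail g) f (suc k)) (mul-tail _ _ k))))))))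

  mul-identityˡ : ∀ f → one *ₛ f ≈ₛ f
  mul-identityˡ f zero = trans (mul-head _ _) (*-identityˡ _)
  mul-identityˡ f (suc k) = trans (mul-tail _ _ k) (trans (+-cong (*-identityˡ _) (mul-zeroˡ f k)) (+-identityʳ _))

  seriesRing : CommutativeRing c ℓ
  seriesRing = record
    { Carrier = Series
    ; _≈_ = _≈ₛ_
    ; _+_ = addS
    ; _*_ = _*ₛ_
    ; -_ = λ f k → - f k
    ; 0# = zeroS
    ; 1# = one
    ; isCommutativeRing = record
      { isRing = record
        { +-isAbelianGroup = record
          { isGroup = record
            { isMonoid = record
              { isSemigroup = record
                { isMagma = record
                  { isEquivalence = record
                    { refl = λ k → refl
                    ; sym = λ p k → sym (p k)
                    ; trans = λ p p′ k → trans (p k) (p′ k)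
                    }
                  ; ∙-cong = λ p p′ k → +-cong (p k) (p′ k)
                  }
                ; assoc = λ x y z k → +-assoc (x k) (y k) (z k)
                }
              ; identity = (λ x k → +-identityˡ (x k)) , λ x k → +-identityʳ (x k)
              }
            ; inverse = (λ x k → -‿inverseˡ (x k)) , λ x k → -‿inverseʳ (x k)
            ; ⁻¹-cong = λ p k → -‿cong (p k)
            }
          ; comm = λ x y k → +-comm (x k) (y k)
          }
        ; *-cong = mul-cong
        ; *-assoc = mul-assoc
        ; *-identity = mul-identityˡ , λ f k → trans (mul-comm f one k) (mul-identityˡ f k)
        ; distrib = (λ h f g k → trans (mul-comm h (addS f g) k) (trans (mul-distribʳ h f g k) (+-cong (mul-comm f h k) (mul-comm g h k))))
                  , mul-distribʳ
        }
      ; *-comm = mul-comm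
      }
    }

-- Composition with t² + t³ and the Euler derivation

module PowerSeries {c ℓ : Level} (K₀ : CommutativeRing c ℓ) where
  open SeriesRing K₀ public
  open Over K₀ public using (Series; emb; one; addS; zeroS)
  open CommutativeRing seriesRing public hiding (zero)
  open RingFacts seriesRing public
  open IntegerSolver seriesRing public
  module K where
    open CommutativeRing K public hiding (zero)
    open RingFacts K public
    open IntegerSolver K public

  C : K.Carrier → Series
  C κ zero = κ
  C κ (suc k) = K.0#

  X : Series
  X zero = K.0#
  X (suc k) = one k

  C-coeff : ∀ κ g k → (C κ * g) k K.≈ κ K.* g k
  C-coeff κ g zero = mul-head (C κ) g
  C-coeff κ g (suc k) = K.trans (mul-tail (C κ) g k) (K.trans (K.+-congˡ (mul-zeroˡ g k)) (K.+-identityʳ _))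

  X-coeff-0 : ∀ g → (X * g) 0 K.≈ K.0#
  X-coeff-0 g = K.trans (mul-head X g) (K.zeroˡ _)

  X-coeff : ∀ g k → (X * g) (suc k) K.≈ g k
  X-coeff g k = K.trans (mul-tail X g k) (K.trans (K.+-cong (K.zeroˡ _) (mul-identityˡ g k)) (K.+-identityˡ _))

  decompose : ∀ g → g ≈ C (g 0) + X * tail g
  decompose g zero = K.sym (K.trans (K.+-congˡ (X-coeff-0 _)) (K.+-identityʳ _))
  decompose g (suc k) = K.sym (K.trans (K.+-congˡ (X-coeff _ k)) (K.+-identityˡ _))

  tail-* : ∀ g h → tail (g * h) ≈ C (g 0) * tail h + tail g * h
  tail-* g h k = K.trans (mul-tail g h k) (K.+-congʳ (K.sym (C-coeff _ _ k)))

  C-cong : ∀ {a b} → a K.≈ b → C a ≈ C b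
  C-cong e zero = e
  C-cong e (suc k) = K.refl

  C-+ : ∀ a b → C (a K.+ b) ≈ C a + C b
  C-+ a b zero = K.refl
  C-+ a b (suc k) = K.sym (K.+-identityˡ _)

  C-* : ∀ a b → C (a K.* b) ≈ C a * C b
  C-* a b zero = K.sym (C-coeff a (C b) 0)
  C-* a b (suc k) = K.sym (K.trans (C-coeff a (C b) (suc k)) (K.zeroʳ _))

  C-neg : ∀ a → C (K.- a) ≈ - C a
  C-neg a zero = K.refl
  C-neg a (suc k) = K.sym K.-0#≈0#

  C-0 : C K.0# ≈ 0#
  C-0 zero = K.refl
  C-0 (suc k) = K.refl

  C-1 : C K.1# ≈ 1#
  C-1 zero = K.refl
  C-1 (suc k) = K.refl

  Van : ℕ → Series → Set ℓ
  Van n g = ∀ {j} → j <ℕ n → g j K.≈ K.0#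

  van-*ʳ : ∀ n {g} h → Van n h → Van n (g * h)
  van-*ʳ (suc n) {g} h v {zero} _ = K.trans (mul-head g h) (K.trans (K.*-congˡ (v (s≤s z≤n))) (K.zeroʳ _))
  van-*ʳ (suc n) {g} h v {suc j} (s≤s j<n) = K.trans (mul-tail g h j)
    (K.trans (K.+-cong (K.trans (K.*-congˡ (v (s≤s j<n))) (K.zeroʳ _))
      (van-*ʳ n h (λ i<n → v (ℕ.m<n⇒m<1+n i<n)) j<n)) (K.+-identityˡ _))

  -- Each use of the hypothesis gains a factor `X`, so every coefficient vanishes. In the
  -- applications `Φ` is the defect of an identity and `next` passes to tails: the defect reproduces
  -- itself there up to a multiple of `X`.
  contraction : ∀ {I : Set c} (next : I → I) (Φ : I → Series) (r : Series) →
    (∀ i → Φ i ≈ X * (r * Φ (next i))) → ∀ i → Φ i ≈ 0#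
  contraction next Φ r step i k = van (suc k) i ℕ.≤-refl
    where
    van : ∀ n i → Van n (Φ i)
    van (suc n) i {zero} _ = K.trans (step i 0) (X-coeff-0 _)
    van (suc n) i {suc j} (s≤s j<n) = K.trans (step i (suc j)) (K.trans (X-coeff _ j) (van-*ʳ n _ (van n (next i)) j<n))

  p : Series
  p = X * (X * (1# + X))

  -- Composition with p = t² + t³, by g ∘ p = g(0) + (t² + t³) (tail g ∘ p).
  σ : Series → Series
  σ g 0 = g 0
  σ g 1 = K.0#
  σ g 2 = σ (tail g) 0
  σ g (suc (suc (suc k))) = σ (tail g) (suc k) K.+ σ (tail g) k

  [1+X]-coeff : ∀ g k → ((1# + X) * g) (suc k) K.≈ g (suc k) K.+ g k
  [1+X]-coeff g k = K.trans (distribʳ g 1# X (suc k)) (K.+-cong (*-identityˡ g (suc k)) (X-coeff g k))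

  p-split : ∀ h → p * h ≈ X * (X * (1# + X) * h)
  p-split h = *-assoc X (X * (1# + X)) h

  σ-step : ∀ g → σ g ≈ C (g 0) + p * σ (tail g)
  σ-step g = trans go (+-congˡ (trans (*-congˡ (sym (*-assoc _ _ _))) (sym (*-assoc _ _ _))))
    where
    go : σ g ≈ C (g 0) + X * (X * ((1# + X) * σ (tail g)))
    go 0 = K.sym (K.trans (K.+-congˡ (X-coeff-0 _)) (K.+-identityʳ _))
    go 1 = K.sym (K.trans (K.+-identityˡ _) (K.trans (X-coeff _ 0) (X-coeff-0 _)))
    go 2 = K.sym (K.trans (K.+-identityˡ _) (K.trans (X-coeff _ 1) (K.trans (X-coeff _ 0)
      (K.trans (mul-head _ _) (K.trans (K.*-congʳ (K.+-identityʳ _)) (K.*-identityˡ _))))))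
    go (suc (suc (suc k))) = K.sym (K.trans (K.+-identityˡ _) (K.trans (X-coeff _ _) (K.trans (X-coeff _ _) ([1+X]-coeff _ k))))

  σ-cong : ∀ {g h} → g ≈ h → σ g ≈ σ h
  σ-cong e 0 = e 0
  σ-cong e 1 = K.refl
  σ-cong e 2 = σ-cong (e ∘ suc) 0
  σ-cong e (suc (suc (suc k))) = K.+-cong (σ-cong (e ∘ suc) (suc k)) (σ-cong (e ∘ suc) k)

  σ-+ : ∀ g h → σ (g + h) ≈ σ g + σ h
  σ-+ g h 0 = K.refl
  σ-+ g h 1 = K.sym (K.+-identityˡ _)
  σ-+ g h 2 = σ-+ (tail g) (tail h) 0
  σ-+ g h (suc (suc (suc k))) = K.trans (K.+-cong (σ-+ (tail g) (tail h) (suc k)) (σ-+ (tail g) (tail h) k))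
    (K.solve 4 (λ a b c d → a K.:+ b K.:+ (c K.:+ d) K.:= a K.:+ c K.:+ (b K.:+ d)) K.refl _ _ _ _)

  σ-0 : σ 0# ≈ 0#
  σ-0 0 = K.refl
  σ-0 1 = K.refl
  σ-0 2 = K.refl
  σ-0 (suc (suc (suc k))) = K.trans (K.+-cong (σ-0 (suc k)) (σ-0 k)) (K.+-identityˡ _)

  σ-C : ∀ κ → σ (C κ) ≈ C κ
  σ-C κ = trans (σ-step (C κ)) (trans (+-congˡ (trans (*-congˡ σ-0) (zeroʳ p))) (+-identityʳ _))

  σ-scale : ∀ κ g → σ (C κ * g) ≈ C κ * σ g
  σ-scale κ g k = K.trans (σ-cong (C-coeff κ g) k) (K.trans (go g k) (K.sym (C-coeff κ (σ g) k)))
    where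
    go : ∀ g k → σ (λ k → κ K.* g k) k K.≈ κ K.* σ g k
    go g 0 = K.refl
    go g 1 = K.sym (K.zeroʳ κ)
    go g 2 = go (tail g) 0
    go g (suc (suc (suc k))) = K.trans (K.+-cong (go (tail g) (suc k)) (go (tail g) k)) (K.sym (K.distribˡ _ _ _))

  σ-* : ∀ g h → σ (g * h) ≈ σ g * σ h
  σ-* g h = x∙y⁻¹≈ε⇒x≈y _ _ (contraction (λ (g , h) → tail g , h) (λ (g , h) → σ (g * h) + - (σ g * σ h))
    (X * (1# + X)) (λ (g , h) → step g h) (g , h))
    where
    expand : ∀ g h → σ (g * h) ≈ C (g 0) * C (h 0) + p * (C (g 0) * σ (tail h) + σ (tail g * h))
    expand g h = trans (σ-step (g * h)) (+-cong (trans (C-cong (mul-head g h)) (C-* _ _))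
      (*-congˡ (trans (σ-cong (tail-* g h)) (trans (σ-+ (C (g 0) * tail h) (tail g * h)) (+-congʳ (σ-scale (g 0) (tail h)))))))

    step : ∀ g h → σ (g * h) + - (σ g * σ h) ≈ X * (X * (1# + X) * (σ (tail g * h) + - (σ (tail g) * σ h)))
    step g h = trans (+-cong (expand g h) (-‿cong (*-congʳ (σ-step g)))) (trans
      (combine₁ (- C (g 0)) (σ-step h) (solve 7 (λ a b P u v w s →
          a :* b :+ P :* (a :* u :+ v) :+ :- ((a :+ P :* w) :* s) :+ :- a :* (b :+ P :* u)
          := P :* (v :+ :- (w :* s)) :+ :- a :* s)
        refl (C (g 0)) (C (h 0)) p (σ (tail h)) (σ (tail g * h)) (σ (tail g)) (σ h)))
      (p-split _))

  σX : σ X ≈ p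
  σX = trans (σ-step X) (trans (+-congˡ (*-congˡ (trans (σ-cong (sym C-1)) (trans (σ-C K.1#) C-1)))) (trans (+-congʳ C-0)
    (trans (+-identityˡ _) (*-identityʳ p))))

  θ : Series → Series
  θ g k = emb k K.* g k

  θ-cong : ∀ {g h} → g ≈ h → θ g ≈ θ h
  θ-cong e k = K.*-congˡ (e k)

  θ-+ : ∀ g h → θ (g + h) ≈ θ g + θ h
  θ-+ g h k = K.distribˡ _ _ _

  θ-C : ∀ κ → θ (C κ) ≈ 0#
  θ-C κ zero = K.zeroˡ _
  θ-C κ (suc k) = K.zeroʳ _

  θ-scale : ∀ κ g → θ (C κ * g) ≈ C κ * θ g
  θ-scale κ g k = K.trans (K.*-congˡ (C-coeff κ g k)) (K.trans
    (K.solve 3 (λ a b c → a K.:* (b K.:* c) K.:= b K.:* (a K.:* c)) K.refl _ _ _) (K.sym (C-coeff κ (θ g) k)))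

  θ-X : ∀ g → θ (X * g) ≈ X * (g + θ g)
  θ-X g zero = K.trans (K.zeroˡ _) (K.sym (X-coeff-0 _))
  θ-X g (suc k) = K.trans (K.*-congˡ (X-coeff g k)) (K.trans
    (K.solve 2 (λ n a → (K.con (+ 1) K.:+ n) K.:* a K.:= a K.:+ n K.:* a) K.refl _ _) (K.sym (X-coeff _ k)))

  θ-step : ∀ g → θ g ≈ X * (tail g + θ (tail g))
  θ-step g = trans (θ-cong (decompose g)) (trans (θ-+ _ _) (trans (+-cong (θ-C (g 0)) (θ-X (tail g))) (+-identityˡ _)))

  θ-* : ∀ g h → θ (g * h) ≈ θ g * h + g * θ h
  θ-* g h = x∙y⁻¹≈ε⇒x≈y _ _ (contraction (λ (g , h) → tail g , h) (λ (g , h) → θ (g * h) + - (θ g * h + g * θ h))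
    1# (λ (g , h) → step g h) (g , h))
    where
    step : ∀ g h → θ (g * h) + - (θ g * h + g * θ h) ≈ X * (1# * (θ (tail g * h) + - (θ (tail g) * h + tail g * θ h)))
    step g h = trans (+-cong
        (trans (θ-cong (trans (*-congʳ (decompose g)) (trans (distribʳ h (C (g 0)) (X * tail g)) (+-congˡ (*-assoc X (tail g) h)))))
          (trans (θ-+ _ _) (+-cong (θ-scale (g 0) h) (θ-X (tail g * h)))))
        (-‿cong (+-cong (*-congʳ (θ-step g)) (*-congʳ (decompose g)))))
      (solve 7 (λ a dh x w dw t h → a :* dh :+ x :* (t :* h :+ w) :+ :- (x :* (t :+ dw) :* h :+ (a :+ x :* t) :* dh)
         := x :* (con (+ 1) :* (w :+ :- (dw :* h :+ t :* dh))))
         refl (C (g 0)) (θ h) X (θ (tail g * h)) (θ (tail g)) (tail g) h)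

  num den : Series
  num = C (emb 2) + C (emb 3) * X
  den = 1# + X

  θX≈X : θ X ≈ X
  θX≈X zero = K.zeroˡ _
  θX≈X (suc zero) = K.solve 0 ((K.con (+ 1) K.:+ K.con (+ 0)) K.:* K.con (+ 1) K.:= K.con (+ 1)) K.refl
  θX≈X (suc (suc k)) = K.zeroʳ _

  θ-1 : θ 1# ≈ 0#
  θ-1 = trans (θ-cong (sym C-1)) (θ-C K.1#)

  C-emb : ∀ n → C (emb (suc n)) ≈ 1# + C (emb n)
  C-emb n = trans (C-+ K.1# (emb n)) (+-congʳ C-1)

  C2 : C (emb 2) ≈ 1# + 1#
  C2 = trans (C-emb 1) (+-congˡ (trans (C-emb 0) (trans (+-congˡ C-0) (+-identityʳ _))))

  C3 : C (emb 3) ≈ 1# + (1# + 1#)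
  C3 = trans (C-emb 2) (+-congˡ C2)

  θp : den * θ p ≈ num * p
  θp = trans (*-congˡ (trans (θ-X _) (*-congˡ (+-congˡ (trans (θ-X _) (*-congˡ (+-congˡ (trans (θ-+ 1# X) (trans (+-cong θ-1 θX≈X) (+-identityˡ _)))))))))) (trans
    (solve 1 (λ x → (con (+ 1) :+ x) :* (x :* (x :* (con (+ 1) :+ x) :+ x :* (con (+ 1) :+ x :+ x)))
       := (con (+ 2) :+ con (+ 3) :* x) :* (x :* (x :* (con (+ 1) :+ x)))) refl X)
    (*-congʳ (+-cong (sym C2) (*-congʳ (trans (solve 0 (con (+ 3) := con (+ 1) :+ (con (+ 1) :+ con (+ 1))) refl) (sym C3))))))

  θσ : ∀ g → den * θ (σ g) ≈ num * σ (θ g)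
  θσ g = x∙y⁻¹≈ε⇒x≈y _ _ (contraction tail (λ g → den * θ (σ g) + - (num * σ (θ g))) (X * (1# + X)) step g)
    where
    step : ∀ g → den * θ (σ g) + - (num * σ (θ g)) ≈ X * (X * (1# + X) * (den * θ (σ (tail g)) + - (num * σ (θ (tail g)))))
    step g = trans (+-cong (*-congˡ (trans (θ-cong (σ-step g)) (trans (θ-+ _ _) (trans (+-cong (θ-C (g 0)) (θ-* p (σ (tail g)))) (+-identityˡ _)))))
        (-‿cong (*-congˡ (trans (σ-cong (θ-step g)) (trans (σ-* X _) (*-cong σX (σ-+ (tail g) (θ (tail g)))))))))
      (trans (combine₁ (σ (tail g)) θp (solve 7 (λ d n P dP s ds sd → d :* (dP :* s :+ P :* ds) :+ :- (n :* (P :* (s :+ sd))) :+ s :* (n :* P)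
          := P :* (d :* ds :+ :- (n :* sd)) :+ s :* (d :* dP)) refl den num p (θ p) (σ (tail g)) (θ (σ (tail g))) (σ (θ (tail g)))))
        (p-split _))

-- Orders of vanishing at 0

module Orders {c ℓ : Level} (K₀ : CommutativeRing c ℓ) (field₀ : Over.IsField K₀) (charZero₀ : Over.CharZero K₀) where
  open PowerSeries K₀ public

  K-inverse : ∀ {x} → ¬ (x K.≈ K.0#) → ∃ λ y → x K.* y K.≈ K.1#
  K-inverse {x} x≉0 with field₀ x (λ e → x≉0 (λ k → k e))
  ... | y , e = y , λ k → k e

  K-cancel-zero : ∀ {x y} → ¬ (x K.≈ K.0#) → x K.* y K.≈ K.0# → y K.≈ K.0#
  K-cancel-zero x≉0 e = K.unit-cancel (proj₂ (K-inverse x≉0)) (K.trans e (K.sym (K.zeroʳ _)))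

  K-product : ∀ {x y} → ¬ (x K.≈ K.0#) → ¬ (y K.≈ K.0#) → ¬ (x K.* y K.≈ K.0#)
  K-product x≉0 y≉0 e = y≉0 (K-cancel-zero x≉0 e)

  K-emb≉0 : ∀ n → ¬ (emb (suc n) K.≈ K.0#)
  K-emb≉0 n e = e (charZero₀ n)

  K-emb-+ : ∀ m n → emb (m +ℕ n) K.≈ emb m K.+ emb n
  K-emb-+ zero n = K.sym (K.+-identityˡ _)
  K-emb-+ (suc m) n = K.trans (K.+-congˡ (K-emb-+ m n)) (K.sym (K.+-assoc _ _ _))

  drop : ℕ → Series → Series
  drop n g k = g (n +ℕ k)

  van-drop : ∀ n {g} → Van n g → g ≈ X ^ n * drop n g
  van-drop zero v = sym (*-identityˡ _)
  van-drop (suc n) {g} v = trans (decompose g) (trans (+-cong (trans (C-cong (v (s≤s z≤n))) C-0) (*-congˡ (van-drop n (λ j<n → v (s≤s j<n)))))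
    (trans (+-identityˡ _) (sym (*-assoc X (X ^ n) _))))

  -- Here κ may be zero, so `a` is in general only a lower bound for the order; it is the order
  -- where κ is known to be nonzero.
  record Ord (a : ℕ) (κ : K.Carrier) (g : Series) : Set (c ⊔ ℓ) where
    constructor ord
    field
      cofactor : Series
      factors : g ≈ X ^ a * cofactor
      cofactor-head : cofactor 0 K.≈ κ

  X^-coeff : ∀ a g → (X ^ a * g) a K.≈ g 0
  X^-coeff zero g = *-identityˡ g 0
  X^-coeff (suc a) g = K.trans (*-assoc X (X ^ a) g (suc a)) (K.trans (X-coeff _ a) (X^-coeff a g))

  X^-van : ∀ a g → Van a (X ^ a * g)
  X^-van (suc a) g {zero} _ = K.trans (*-assoc X (X ^ a) g 0) (X-coeff-0 _)
  X^-van (suc a) g {suc j} (s≤s j<a) = K.trans (*-assoc X (X ^ a) g (suc j)) (K.trans (X-coeff _ j) (X^-van a g j<a))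

  ord-coeff : ∀ {a κ g} → Ord a κ g → g a K.≈ κ
  ord-coeff {a} (ord g′ e e′) = K.trans (e a) (K.trans (X^-coeff a g′) e′)

  ord-van : ∀ {a κ g} → Ord a κ g → Van a g
  ord-van {a} (ord g′ e _) j<a = K.trans (e _) (X^-van a g′ j<a)

  ord-resp : ∀ {a κ g h} → g ≈ h → Ord a κ g → Ord a κ h
  ord-resp g≈h (ord g′ e e′) = ord g′ (trans (sym g≈h) e) e′

  ord-unique : ∀ {a b κ μ g} → Ord a κ g → Ord b μ g → ¬ (κ K.≈ K.0#) → ¬ (μ K.≈ K.0#) → a ≡ b
  ord-unique {a} {b} o o′ κ≉0 μ≉0 with ℕ.<-cmp a b
  ... | tri< a<b _ _ = ⊥-elim (κ≉0 (K.trans (K.sym (ord-coeff o)) (ord-van o′ a<b)))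
  ... | tri≈ _ a≡b _ = a≡b
  ... | tri> _ _ b<a = ⊥-elim (μ≉0 (K.trans (K.sym (ord-coeff o′)) (ord-van o b<a)))

  ord-0 : ∀ g → Ord 0 (g 0) g
  ord-0 g = ord g (sym (*-identityˡ g)) K.refl

  ord-* : ∀ {a b κ μ g h} → Ord a κ g → Ord b μ h → Ord (a +ℕ b) (κ K.* μ) (g * h)
  ord-* {a} {b} (ord g′ e e₀) (ord h′ e′ e₀′) = ord (g′ * h′)
    (trans (*-cong e e′) (trans (solve 4 (λ x g y h → x :* g :* (y :* h) := x :* y :* (g :* h)) refl (X ^ a) g′ (X ^ b) h′)
      (*-congʳ (sym (^-homo-* X a b)))))
    (K.trans (mul-head g′ h′) (K.*-cong e₀ e₀′))

  ^-head : ∀ g n → (g ^ n) 0 K.≈ g 0 K.^ n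
  ^-head g zero = K.refl
  ^-head g (suc n) = K.trans (mul-head g (g ^ n)) (K.*-congˡ (^-head g n))

  σ-^ : ∀ g n → σ (g ^ n) ≈ σ g ^ n
  σ-^ g zero = trans (σ-cong (sym C-1)) (trans (σ-C K.1#) C-1)
  σ-^ g (suc n) = trans (σ-* g (g ^ n)) (*-congˡ (σ-^ g n))

  -- Since p = t² (1 + t), σ(t^a) = t^(2a) (1 + t)^a: the order doubles, and the leading coefficient
  -- persists because (1 + t)^a has constant term 1.
  ord-σ : ∀ {a κ g} → Ord a κ g → Ord (a +ℕ a) κ (σ g)
  ord-σ {a} {κ} {g} (ord g′ e e₀) = ord ((1# + X) ^ a * σ g′)
    (trans (σ-cong e) (trans (σ-* (X ^ a) g′) (trans (*-congʳ (trans (σ-^ X a) (trans (^-congˡ a σX) p^a))) (*-assoc _ _ _))))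
    (K.trans (mul-head _ _) (K.trans (K.*-cong (K.trans (^-head (1# + X) a) (one^ a)) e₀) (K.*-identityˡ κ)))
    where
    p^a : p ^ a ≈ X ^ (a +ℕ a) * (1# + X) ^ a
    p^a = trans (^-distrib-* X (X * (1# + X)) a) (trans (*-congˡ (^-distrib-* X (1# + X) a))
      (trans (sym (*-assoc _ _ _)) (*-congʳ (sym (^-homo-* X a a)))))
    one^ : ∀ n → (K.1# K.+ K.0#) K.^ n K.≈ K.1#
    one^ zero = K.refl
    one^ (suc n) = K.trans (K.*-cong (K.+-identityʳ _) (one^ n)) (K.*-identityˡ _)

  leading : ∀ {g} → ¬ (g ≈ 0#) → ¬ ¬ (∃ λ a → ∃ λ κ → ¬ (κ K.≈ K.0#) × Ord a κ g)
  leading {g} g≉0 none = g≉0 λ k → van (suc k) ℕ.≤-refl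
    where
    van : ∀ n → Van n g
    van (suc n) {j} (s≤s j≤n) with ℕ.m≤n⇒m<n∨m≡n j≤n
    ... | inj₁ j<n = van n j<n
    ... | inj₂ ≡.refl = stable λ gn≉0 →
      none (n , g n , gn≉0 , ord (drop n g) (van-drop n (van n)) (K.reflexive (≡.cong g (ℕ.+-identityʳ n))))

  ≈-stable : ∀ {g h} → ¬ ¬ (g ≈ h) → g ≈ h
  ≈-stable p k = stable λ e → p λ g≈h → e (g≈h k)

  cancel-zero : ∀ {g h} → ¬ (g ≈ 0#) → g * h ≈ 0# → h ≈ 0#
  cancel-zero {g} {h} g≉0 e = ≈-stable λ h≉0 → leading g≉0 λ (a , κ , κ≉0 , o) → leading h≉0 λ (b , μ , μ≉0 , o′) →
    K-product κ≉0 μ≉0 (K.trans (K.sym (ord-coeff (ord-* o o′))) (e _))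

  geometric : K.Carrier → Series
  geometric a k = a K.^ k

  geometric-inverse : ∀ a → (1# + - (C a * X)) * geometric a ≈ 1#
  geometric-inverse a = trans (solve 3 (λ c x g → (con (+ 1) :+ :- (c :* x)) :* g := g :+ :- (x :* (c :* g))) refl (C a) X (geometric a)) go
    where
    go : geometric a + - (X * (C a * geometric a)) ≈ 1#
    go zero = K.trans (K.+-congˡ (K.trans (K.-‿cong (X-coeff-0 _)) K.-0#≈0#)) (K.+-identityʳ _)
    go (suc k) = K.trans (K.+-congˡ (K.-‿cong (K.trans (X-coeff _ k) (C-coeff a (geometric a) k)))) (K.-‿inverseʳ _)

  private
    half : K.Carrier
    half = proj₁ (K-inverse (K-emb≉0 1))

  den⁻¹ num⁻¹ : Series
  den⁻¹ = geometric (K.- K.1#)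
  num⁻¹ = C half * geometric (K.- (half K.* emb 3))

  den-inverse : den * den⁻¹ ≈ 1#
  den-inverse = trans (*-congʳ (trans
    (solve 1 (λ x → con (+ 1) :+ x := con (+ 1) :+ :- (:- con (+ 1) :* x)) refl X)
    (+-congˡ (-‿cong (*-congʳ (trans (-‿cong (sym C-1)) (sym (C-neg _)))))))) (geometric-inverse (K.- K.1#))

  num-inverse : num * num⁻¹ ≈ 1#
  num-inverse = trans (solve 5 (λ a b h x g → (a :+ b :* x) :* (h :* g) := (a :* h :+ :- (:- (h :* b) :* x)) :* g) refl
      (C (emb 2)) (C (emb 3)) (C half) X (geometric (K.- (half K.* emb 3))))
    (trans (*-congʳ (+-cong half-inverse (-‿cong (*-congʳ (trans (-‿cong (sym (C-* _ _))) (sym (C-neg _)))))))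
      (geometric-inverse (K.- (half K.* emb 3))))
    where
    half-inverse : C (emb 2) * C half ≈ 1#
    half-inverse = trans (sym (C-* _ _)) (trans (C-cong (proj₂ (K-inverse (K-emb≉0 1)))) C-1)

  q q⁻¹ : Series
  q = num * den⁻¹
  q⁻¹ = den * num⁻¹

  q*q⁻¹≈1 : q * q⁻¹ ≈ 1#
  q*q⁻¹≈1 = trans (solve 4 (λ a b c d → a :* b :* (c :* d) := (c :* b) :* (a :* d)) refl num den⁻¹ den num⁻¹)
    (trans (*-cong den-inverse num-inverse) (*-identityˡ 1#))

  den*q : den * q ≈ num
  den*q = trans (solve 3 (λ d n i → d :* (n :* i) := n :* (d :* i)) refl den num den⁻¹) (trans (*-congˡ den-inverse) (*-identityʳ num))

  q-head : q 0 K.≈ emb 2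
  q-head = K.trans (mul-head num den⁻¹) (K.trans (K.*-identityʳ _)
    (K.trans (K.+-congˡ (K.trans (C-coeff (emb 3) X 0) (K.zeroʳ _))) (K.+-identityʳ _)))

  -- The constant term of q is 2, and 2^(j+1) - 1 is a positive integer, hence nonzero in
  -- characteristic zero.
  q^-head≉1 : ∀ j → ¬ ((q ^ suc j) 0 K.≈ K.1#)
  q^-head≉1 j e with pow2 j
    where
    pow2 : ∀ j → ∃ λ m → emb 2 K.^ suc j K.≈ emb (2 +ℕ m)
    pow2 zero = 0 , K.*-identityʳ _
    pow2 (suc j) with pow2 j
    ... | m , e = suc (suc (m +ℕ m)) , K.trans (K.*-congˡ e) (K.trans
      (K.solve 1 (λ m → (K.con (+ 1) K.:+ (K.con (+ 1) K.:+ K.con (+ 0))) K.:* (K.con (+ 1) K.:+ (K.con (+ 1) K.:+ m))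
         K.:= K.con (+ 1) K.:+ (K.con (+ 1) K.:+ (K.con (+ 1) K.:+ (K.con (+ 1) K.:+ (m K.:+ m))))) K.refl (emb m))
      (K.+-congˡ (K.+-congˡ (K.+-congˡ (K.+-congˡ (K.sym (K-emb-+ m m)))))))
  ... | m , e′ = K-emb≉0 m (K.+-cancelˡ K.1# _ _ (K.trans (K.sym e′) (K.trans (K.sym (K.trans (^-head q (suc j)) (K.^-congˡ (suc j) q-head)))
    (K.trans e (K.sym (K.+-identityʳ _))))))

  private
    doubled-cancel : ∀ a b → a +ℕ (b +ℕ b) ≡ a +ℕ a +ℕ b → b ≡ a
    doubled-cancel a b e = ℕ.+-cancelʳ-≡ b b a (ℕ.+-cancelˡ-≡ a _ _ (≡.trans e (ℕ.+-assoc a a b)))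

    multiplier : ∀ {x y z} → ¬ (z K.≈ K.0#) → x K.* z K.≈ y K.* z → x K.≈ y
    multiplier {x} {y} {z} z≉0 e = K.x∙y⁻¹≈ε⇒x≈y _ _ (K-cancel-zero z≉0
      (K.combine₁ K.1# e (K.solve 3 (λ x y z → z K.:* (x K.:+ K.:- y) K.:+ K.con (+ 1) K.:* (y K.:* z)
        K.:= K.con (+ 0) K.:+ K.con (+ 1) K.:* (x K.:* z)) K.refl x y z)))

  -- Comparing orders gives a + 2 b = 2 a + b, so b = a; the leading coefficients g(0) κ μ and h(0)
  -- κ μ then sit at the same index.
  equal-orders : ∀ g h {v w a b κ μ} → ¬ (g 0 K.≈ K.0#) → ¬ (h 0 K.≈ K.0#) → ¬ (κ K.≈ K.0#) → ¬ (μ K.≈ K.0#) →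
    Ord a κ v → Ord b μ w → g * (v * σ w) ≈ h * (σ v * w) → b ≡ a × g 0 K.≈ h 0
  equal-orders g h {v} {w} {a} {b} {κ} {μ} g₀≉0 h₀≉0 κ≉0 μ≉0 ov ow e =
    b≡a , multiplier κμ≉0 (K.trans (K.sym (ord-coeff lhs)) (K.trans (K.reflexive (≡.cong (g * (v * σ w)) degree)) (ord-coeff rhs)))
    where
    κμ≉0 : ¬ (κ K.* μ K.≈ K.0#)
    κμ≉0 = K-product κ≉0 μ≉0

    lhs : Ord (a +ℕ (b +ℕ b)) (g 0 K.* (κ K.* μ)) (g * (v * σ w))
    lhs = ord-* (ord-0 g) (ord-* ov (ord-σ ow))

    rhs : Ord (a +ℕ a +ℕ b) (h 0 K.* (κ K.* μ)) (g * (v * σ w))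
    rhs = ord-resp (sym e) (ord-* (ord-0 h) (ord-* (ord-σ ov) ow))

    degree : a +ℕ (b +ℕ b) ≡ a +ℕ a +ℕ b
    degree = ord-unique lhs rhs (K-product g₀≉0 κμ≉0) (K-product h₀≉0 κμ≉0)

    b≡a : b ≡ a
    b≡a = doubled-cancel a b degree

  one-head≉0 : ¬ (one 0 K.≈ K.0#)
  one-head≉0 e = K-emb≉0 0 (K.trans (K.+-identityʳ _) e)

  q^-head≉0 : ∀ n → ¬ ((q ^ n) 0 K.≈ K.0#)
  q^-head≉0 zero = one-head≉0
  q^-head≉0 (suc n) e = K-product (λ e′ → K-emb≉0 1 (K.trans (K.sym q-head) e′)) (q^-head≉0 n) (K.trans (K.sym (mul-head q (q ^ n))) e)

  semi-invariant⁺ : ∀ j {v w} → ¬ (v ≈ 0#) → q ^ suc j * (v * σ w) ≈ σ v * w → w ≈ 0#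
  semi-invariant⁺ j v≉0 e = ≈-stable λ w≉0 → leading v≉0 λ (a , κ , κ≉0 , ov) → leading w≉0 λ (b , μ , μ≉0 , ow) →
    q^-head≉1 j (proj₂ (equal-orders (q ^ suc j) 1# (q^-head≉0 (suc j)) one-head≉0 κ≉0 μ≉0 ov ow (trans e (sym (*-identityˡ _)))))

  semi-invariant⁻ : ∀ j {v w} → ¬ (v ≈ 0#) → v * σ w ≈ q ^ suc j * (σ v * w) → w ≈ 0#
  semi-invariant⁻ j v≉0 e = ≈-stable λ w≉0 → leading v≉0 λ (a , κ , κ≉0 , ov) → leading w≉0 λ (b , μ , μ≉0 , ow) →
    q^-head≉1 j (K.sym (proj₂ (equal-orders 1# (q ^ suc j) one-head≉0 (q^-head≉0 (suc j)) κ≉0 μ≉0 ov ow (trans (*-identityˡ _) e))))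

  Const : Series → Set (c ⊔ ℓ)
  Const g = ∃ λ κ → g ≈ C κ

  σ-const : ∀ {g} → Const g → σ g ≈ g
  σ-const (κ , e) = trans (σ-cong e) (trans (σ-C κ) (sym e))

  open Spans seriesRing public using (Subring)

  const-subring : Subring Const
  const-subring = record
    { resp = λ g≈h (κ , e) → κ , trans (sym g≈h) e
    ; 0∈ = K.0# , sym C-0
    ; 1∈ = K.1# , sym C-1
    ; +∈ = λ (κ , e) (μ , e′) → κ K.+ μ , trans (+-cong e e′) (sym (C-+ κ μ))
    ; *∈ = λ (κ , e) (μ , e′) → κ K.* μ , trans (*-cong e e′) (sym (C-* κ μ))
    ; neg∈ = λ (κ , e) → K.- κ , trans (-‿cong e) (sym (C-neg κ))
    }

  -- Subtracting the constant matching the leading coefficients raises the order of w, against equal-orders.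
  invariant : ∀ {v w} → ¬ (v ≈ 0#) → v * σ w ≈ σ v * w → ¬ ¬ (∃ λ κ → Const κ × w ≈ κ * v)
  invariant {v} {w} v≉0 e none = none (0# , Subring.0∈ const-subring , trans w≈0 (sym (zeroˡ v)))
    where
    orders : ∀ {w a b κ μ} → ¬ (κ K.≈ K.0#) → ¬ (μ K.≈ K.0#) → v * σ w ≈ σ v * w → Ord a κ v → Ord b μ w → b ≡ a
    orders κ≉0 μ≉0 e ov ow = proj₁ (equal-orders 1# 1# one-head≉0 one-head≉0 κ≉0 μ≉0 ov ow (*-congˡ e))

    w≈0 : w ≈ 0#
    w≈0 = ≈-stable λ w≉0 → leading v≉0 λ (a , κ , κ≉0 , ov) → leading w≉0 λ (b , μ , μ≉0 , ow) →
      go κ≉0 μ≉0 ov ow (orders κ≉0 μ≉0 e ov ow)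
      where
      go : ∀ {a b κ μ} → ¬ (κ K.≈ K.0#) → ¬ (μ K.≈ K.0#) → Ord a κ v → Ord b μ w → b ≡ a → ⊥
      go {a} {κ = κ} {μ} κ≉0 μ≉0 ov ow ≡.refl = none (C ν , (ν , refl) ,
        x∙y⁻¹≈ε⇒x≈y _ _ (≈-stable λ w′≉0 → leading w′≉0 λ (b , μ′ , μ′≉0 , ow′) → clash μ′≉0 ow′ (orders κ≉0 μ′≉0 e′ ov ow′)))
        where
        κ⁻¹ ν : K.Carrier
        κ⁻¹ = proj₁ (K-inverse κ≉0)
        ν = μ K.* κ⁻¹

        w′ : Series
        w′ = w + - (C ν * v)

        e′ : v * σ w′ ≈ σ v * w′
        e′ = trans (*-congˡ (trans (σ-+ w _) (+-congˡ (trans (σ-cong (trans (-‿distribˡ-* _ _) (*-congʳ (sym (C-neg ν)))))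
               (σ-scale (K.- ν) v)))))
          (combine₂ 1# (v * σ v) e (C-neg ν) (solve 6 (λ v sw n nn sv w → v :* (sw :+ nn :* sv) :+ (con (+ 1) :* (sv :* w) :+ v :* sv :* :- n)
             := sv :* (w :+ :- (n :* v)) :+ (con (+ 1) :* (v :* sw) :+ v :* sv :* nn)) refl v (σ w) (C ν) (C (K.- ν)) (σ v) w))

        clash : ∀ {b μ′} → ¬ (μ′ K.≈ K.0#) → Ord b μ′ w′ → b ≡ a → ⊥
        clash μ′≉0 ow′ ≡.refl = μ′≉0 (K.trans (K.sym (ord-coeff ow′)) (K.trans
          (K.+-cong (ord-coeff ow) (K.-‿cong (K.trans (C-coeff ν v a) (K.*-congˡ (ord-coeff ov)))))
          (K.combine₁ (K.- μ) (proj₂ (K-inverse κ≉0)) (K.solve 3 (λ m k i → m K.:+ K.:- (m K.:* i K.:* k) K.:+ K.:- m K.:* K.con (+ 1)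
            K.:= K.con (+ 0) K.:+ K.:- m K.:* (k K.:* i)) K.refl μ κ κ⁻¹))))

  emb≈C : ∀ n → Over.emb seriesRing n ≈ C (emb n)
  emb≈C zero = sym C-0
  emb≈C (suc n) = trans (+-congˡ (emb≈C n)) (sym (C-emb n))

  difference-domain : DifferenceDomain c ℓ
  difference-domain = record
    { commutativeRing = seriesRing
    ; stable = ≈-stable
    ; cancel-zero = cancel-zero
    ; emb≉0 = λ n e → K-emb≉0 n (K.trans (K.sym (emb≈C (suc n) 0)) (e 0))
    ; σ = σ
    ; σ-cong = σ-cong
    ; σ-+ = σ-+
    ; σ-* = σ-*
    ; σ-1 = σ-^ one 0
    ; q = q
    ; q⁻¹ = q⁻¹
    ; q*q⁻¹≈1 = q*q⁻¹≈1
    ; Const = Const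
    ; const-subring = const-subring
    ; σ-const = σ-const
    ; semi-invariant⁺ = semi-invariant⁺
    ; semi-invariant⁻ = semi-invariant⁻
    ; invariant = invariant
    }

-- Polynomials: degrees, values and roots

module PolynomialSeries {c ℓ : Level} (K₀ : CommutativeRing c ℓ) (field₀ : Over.IsField K₀) (charZero₀ : Over.CharZero K₀) where
  open Orders K₀ field₀ charZero₀ public

  Small : ℕ → Series → Set ℓ
  Small n g = ∀ {j} → n ≤ℕ j → g j K.≈ K.0#

  small-resp : ∀ {n g h} → g ≈ h → Small n g → Small n h
  small-resp g≈h s n≤j = K.trans (K.sym (g≈h _)) (s n≤j)

  small-≤ : ∀ {m n g} → m ≤ℕ n → Small m g → Small n g
  small-≤ m≤n s n≤j = s (ℕ.≤-trans m≤n n≤j)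

  small-tail : ∀ {n g} → Small (suc n) g → Small n (tail g)
  small-tail s n≤j = s (s≤s n≤j)

  small-+ : ∀ {n g h} → Small n g → Small n h → Small n (g + h)
  small-+ s s′ n≤j = K.trans (K.+-cong (s n≤j) (s′ n≤j)) (K.+-identityˡ _)

  small-neg : ∀ {n g} → Small n g → Small n (- g)
  small-neg s n≤j = K.trans (K.-‿cong (s n≤j)) K.-0#≈0#

  small-C : ∀ κ → Small 1 (C κ)
  small-C κ (s≤s _) = K.refl

  small-scale : ∀ {n g} κ → Small n g → Small n (C κ * g)
  small-scale {g = g} κ s {j} n≤j = K.trans (C-coeff κ g j) (K.trans (K.*-congˡ (s n≤j)) (K.zeroʳ κ))

  small-X* : ∀ {n g} → Small n g → Small (suc n) (X * g)
  small-X* {g = g} s {suc j} (s≤s n≤j) = K.trans (X-coeff g j) (s n≤j)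

  small-zero : ∀ {g} → Small 0 g → g ≈ 0#
  small-zero s k = s z≤n

  -- The counterpart of `Ord` for degrees. As κ may be zero, a bare degree bound is the case κ = g
  -- a, and the rule for products bounds degrees as well.
  record Top (a : ℕ) (κ : K.Carrier) (g : Series) : Set ℓ where
    constructor top
    field
      coeff : g a K.≈ κ
      small : Small (suc a) g

  open Top

  top-resp : ∀ {a κ g h} → g ≈ h → Top a κ g → Top a κ h
  top-resp g≈h (top e s) = top (K.trans (K.sym (g≈h _)) e) (small-resp g≈h s)

  top-+small : ∀ {a n κ g h} → n ≤ℕ a → Top a κ g → Small n h → Top a κ (g + h)
  top-+small n≤a (top e s) s′ = top (K.trans (K.+-cong e (s′ n≤a)) (K.+-identityʳ _))
    (small-+ s (small-≤ (ℕ.m≤n⇒m≤1+n n≤a) s′))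

  top-X : ∀ {a κ g} → Top a κ g → Top (suc a) κ (X * g)
  top-X {a} {g = g} (top e s) = top (K.trans (X-coeff g a) e) (small-X* s)

  top-neg : ∀ {a κ g} → Top a κ g → Top a (K.- κ) (- g)
  top-neg (top e s) = top (K.-‿cong e) (small-neg s)

  top-C : ∀ κ → Top 0 κ (C κ)
  top-C κ = top K.refl (small-C κ)

  top-* : ∀ {a b κ μ g h} → Top a κ g → Top b μ h → Top (a +ℕ b) (κ K.* μ) (g * h)
  top-* {zero} {b} {κ} {μ} {g} {h} (top e s) (top e′ s′) = top-resp (*-congʳ (sym g≈C))
    (top (K.trans (C-coeff κ h b) (K.*-congˡ e′)) (small-scale κ s′))
    where
    g≈C : g ≈ C κ
    g≈C zero = e
    g≈C (suc k) = s (s≤s z≤n)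
  top-* {suc a} {b} {κ} {μ} {g} {h} (top e s) t′ = top-resp
    (trans (+-comm _ _) (trans (+-congˡ (sym (*-assoc X (tail g) h)))
      (trans (sym (distribʳ h (C (g 0)) (X * tail g))) (*-congʳ (sym (decompose g))))))
    (top-+small (s≤s (ℕ.m≤n+m b a)) (top-X (top-* (top e (small-tail s)) t′)) (small-scale (g 0) (small t′)))

  top≈0 : ∀ {a κ g} → Top a κ g → g ≈ 0# → κ K.≈ K.0#
  top≈0 {a} (top e _) g≈0 = K.trans (K.sym e) (g≈0 a)

  top-unique : ∀ {a b κ μ g} → Top a κ g → Top b μ g → ¬ (κ K.≈ K.0#) → ¬ (μ K.≈ K.0#) → a ≡ b
  top-unique {a} {b} (top e s) (top e′ s′) κ≉0 μ≉0 with ℕ.<-cmp a b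
  ... | tri< a<b _ _ = ⊥-elim (μ≉0 (K.trans (K.sym e′) (s a<b)))
  ... | tri≈ _ a≡b _ = a≡b
  ... | tri> _ _ b<a = ⊥-elim (κ≉0 (K.trans (K.sym e) (s′ b<a)))

  top-X₁ : Top 1 K.1# X
  top-X₁ = top-resp (*-identityʳ X) (top-X (top-resp C-1 (top-C K.1#)))

  top-den : Top 1 K.1# den
  top-den = top-resp (+-comm X 1#) (top-+small ℕ.≤-refl top-X₁ (small-resp C-1 (small-C K.1#)))

  top-num : Top 1 (emb 3) num
  top-num = top-resp (trans (+-congʳ (*-comm X (C (emb 3)))) (+-comm _ (C (emb 2))))
    (top-+small ℕ.≤-refl (top-X (top-C (emb 3))) (small-C (emb 2)))

  top-p : Top 3 K.1# p
  top-p = top-X (top-X top-den)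

  3×_ : ℕ → ℕ
  3×_ zero = 0
  3×_ (suc n) = 3 +ℕ 3× n

  top-σ : ∀ {a κ g} → Top a κ g → Top (3× a) κ (σ g)
  top-σ {zero} {κ} {g} (top e s) = top-resp (sym (trans (σ-cong g≈C) (σ-C κ))) (top-C κ)
    where
    g≈C : g ≈ C κ
    g≈C zero = e
    g≈C (suc k) = s (s≤s z≤n)
  top-σ {suc a} {κ} {g} (top e s) = top-resp (trans (+-comm _ (C (g 0))) (sym (σ-step g)))
    (top-+small (s≤s z≤n) (top (K.trans (coeff product) (K.*-identityˡ κ)) (small product)) (small-C (g 0)))
    where
    product : Top (3 +ℕ 3× a) (K.1# K.* κ) (p * σ (tail g))
    product = top-* top-p (top-σ (top e (small-tail s)))

  nonzero-top : ∀ n {g} → Small n g → ¬ (g ≈ 0#) → ¬ ¬ (∃ λ a → ∃ λ κ → ¬ (κ K.≈ K.0#) × Top a κ g)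
  nonzero-top zero s g≉0 _ = g≉0 (small-zero s)
  nonzero-top (suc n) {g} s g≉0 none = none (n , g n , (λ gn≈0 → nonzero-top n (smaller gn≈0) g≉0 none) , top K.refl s)
    where
    smaller : g n K.≈ K.0# → Small n g
    smaller gn≈0 {j} n≤j with ℕ.m≤n⇒m<n∨m≡n n≤j
    ... | inj₁ n<j = s n<j
    ... | inj₂ ≡.refl = gn≈0

  Poly : Series → Set ℓ
  Poly g = ∃ λ n → Small n g

  poly-resp : ∀ {g h} → g ≈ h → Poly g → Poly h
  poly-resp g≈h (n , s) = n , small-resp g≈h s

  poly-C : ∀ κ → Poly (C κ)
  poly-C κ = 1 , small-C κ

  poly-X : Poly X
  poly-X = 2 , small top-X₁

  poly-+ : ∀ {g h} → Poly g → Poly h → Poly (g + h)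
  poly-+ (m , s) (n , s′) = m +ℕ n , small-+ (small-≤ (ℕ.m≤m+n m n) s) (small-≤ (ℕ.m≤n+m n m) s′)

  poly-neg : ∀ {g} → Poly g → Poly (- g)
  poly-neg (n , s) = n , small-neg s

  poly-* : ∀ {g h} → Poly g → Poly h → Poly (g * h)
  poly-* {g} {h} (m , s) (n , s′) = suc (m +ℕ n) ,
    small (top-* (top {a = m} K.refl (small-≤ (ℕ.n≤1+n m) s)) (top {a = n} K.refl (small-≤ (ℕ.n≤1+n n) s′)))

  poly-σ : ∀ {g} → Poly g → Poly (σ g)
  poly-σ (n , s) = suc (3× n) , small (top-σ (top {a = n} K.refl (small-≤ (ℕ.n≤1+n n) s)))

  poly-θ : ∀ {g} → Poly g → Poly (θ g)
  poly-θ (n , s) = n , λ n≤j → K.trans (K.*-congˡ (s n≤j)) (K.zeroʳ _)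

  K-neg≉0 : ∀ {κ} → ¬ (κ K.≈ K.0#) → ¬ (K.- κ K.≈ K.0#)
  K-neg≉0 κ≉0 e = κ≉0 (K.trans (K.sym (K.-‿involutive _)) (K.trans (K.-‿cong e) K.-0#≈0#))

  3×-+ : ∀ a → 3× a ≡ a +ℕ a +ℕ a
  3×-+ zero = ≡.refl
  3×-+ (suc a) = ≡.trans (≡.cong (3 +ℕ_) (3×-+ a)) (arith a)
    where
    arith : ∀ a → 3 +ℕ (a +ℕ a +ℕ a) ≡ suc a +ℕ suc a +ℕ suc a
    arith = ℕ.solve-∀

  -- Degrees: if deg u = a and deg v = b, the two sides have degrees b + 3a and 3b + max(a, b + 1).
  no-rational-sum : ∀ {g h u v e γ η} → Top e γ g → Top e η h → ¬ (γ K.≈ K.0#) → ¬ (η K.≈ K.0#) →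
    Poly u → Poly v → ¬ (v ≈ 0#) → ¬ (g * (v * σ u) ≈ h * (σ v * (u + - X * v)))
  no-rational-sum {g} {h} {u} {v} {e} {γ} {η} tg th γ≉0 η≉0 (m , su) (n , sv) v≉0 eq =
    nonzero-top n sv v≉0 λ (b , ν , ν≉0 , tv) → zero-case b ν ν≉0 tv λ u≉0 →
    nonzero-top m su u≉0 λ (a , μ , μ≉0 , tu) → cases b ν ν≉0 tv a μ μ≉0 tu
    where
    swap : ∀ {u v} → - (X * v) + u ≈ u + - X * v
    swap = solve 3 (λ x u v → :- (x :* v) :+ u := u :+ :- x :* v) refl X _ _

    zero-case : ∀ b ν → ¬ (ν K.≈ K.0#) → Top b ν v → ¬ ¬ (¬ (u ≈ 0#))
    zero-case b ν ν≉0 tv k = k λ u≈0 → K-product η≉0 (K-product ν≉0 (K-neg≉0 ν≉0))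
      (top≈0 (top-* th (top-* (top-σ tv) (top-resp (trans (sym (+-identityʳ _)) (trans (+-congˡ (sym u≈0)) swap)) (top-neg (top-X tv)))))
        (trans (sym eq) (trans (*-congˡ (trans (*-congˡ (trans (σ-cong u≈0) σ-0)) (zeroʳ v))) (zeroʳ g))))

    cases : ∀ b ν → ¬ (ν K.≈ K.0#) → Top b ν v → ∀ a μ → ¬ (μ K.≈ K.0#) → Top a μ u → ⊥
    cases b ν ν≉0 tv a μ μ≉0 tu = go (ℕ.<-cmp a (suc b))
      where
      lhs : Top (e +ℕ (b +ℕ 3× a)) (γ K.* (ν K.* μ)) (g * (v * σ u))
      lhs = top-* tg (top-* tv (top-σ tu))

      lhs≉0 : ¬ (γ K.* (ν K.* μ) K.≈ K.0#)
      lhs≉0 = K-product γ≉0 (K-product ν≉0 μ≉0)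

      arith₁ : ∀ a b → b +ℕ (a +ℕ a +ℕ a) ≡ b +ℕ a +ℕ (a +ℕ a)
      arith₁ = ℕ.solve-∀

      arith₂ : ∀ a b → b +ℕ b +ℕ b +ℕ a ≡ b +ℕ a +ℕ (b +ℕ b)
      arith₂ = ℕ.solve-∀

      arith₃ : ∀ b → b +ℕ b +ℕ b +ℕ suc b ≡ b +ℕ suc (b +ℕ b +ℕ b)
      arith₃ = ℕ.solve-∀

      arith₄ : ∀ b → b +ℕ (suc b +ℕ suc b +ℕ suc b) ≡ suc (suc (b +ℕ b +ℕ b +ℕ suc b))
      arith₄ = ℕ.solve-∀

      go : _ → ⊥
      -- The term - X v dominates u, and the degrees give 3 a = 3 b + 1, against a ≤ b.
      go (tri< (s≤s a≤b) _ _) = ℕ.<-irrefl ≡.refl (ℕ.≤-<-trans (ℕ.+-mono-≤ (ℕ.+-mono-≤ a≤b a≤b) a≤b)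
          (≡.subst (b +ℕ b +ℕ b <ℕ_) (≡.sym degree′) ℕ.≤-refl))
        where
        rhs : Top (e +ℕ (3× b +ℕ suc b)) (η K.* (ν K.* K.- ν)) (g * (v * σ u))
        rhs = top-resp (sym eq) (top-* th (top-* (top-σ tv)
          (top-resp swap (top-+small (s≤s a≤b) (top-neg (top-X tv)) (small tu)))))

        degree : b +ℕ 3× a ≡ 3× b +ℕ suc b
        degree = ℕ.+-cancelˡ-≡ e _ _ (top-unique lhs rhs lhs≉0 (K-product η≉0 (K-product ν≉0 (K-neg≉0 ν≉0))))

        degree′ : a +ℕ a +ℕ a ≡ suc (b +ℕ b +ℕ b)
        degree′ = ℕ.+-cancelˡ-≡ b _ _ (≡.trans (≡.cong (b +ℕ_) (≡.sym (3×-+ a)))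
          (≡.trans degree (≡.trans (≡.cong (_+ℕ suc b) (3×-+ b)) (arith₃ b))))
      -- For a = b + 1 the top terms of u and - X v may cancel. An upper bound suffices: beyond e,
      -- the right side has degree at most 4 b + 1 and the left side has degree 4 b + 3.
      go (tri≈ _ ≡.refl _) = lhs≉0 (K.trans (K.sym (coeff lhs)) (K.trans (eq _) (small rhs degree)))
        where
        rhs : Top (e +ℕ (3× b +ℕ suc b)) (η K.* (ν K.* (u + - X * v) (suc b))) (h * (σ v * (u + - X * v)))
        rhs = top-* th (top-* (top-σ tv) (top K.refl (small-+ (small tu)
          (small-resp (-‿distribˡ-* X v) (small-neg (small (top-X tv)))))))

        degree : suc (e +ℕ (3× b +ℕ suc b)) ≤ℕ e +ℕ (b +ℕ 3× suc b)
        degree = ≡.subst (λ n → n ≤ℕ e +ℕ (b +ℕ 3× suc b)) (ℕ.+-suc e _) (ℕ.+-monoʳ-≤ e (ℕ.≤-trans (ℕ.n≤1+n _) (ℕ.≤-reflexive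
          (≡.trans (≡.cong (λ n → suc (suc (n +ℕ suc b))) (3×-+ b)) (≡.trans (≡.sym (arith₄ b)) (≡.cong (b +ℕ_) (≡.sym (3×-+ (suc b)))))))))
      go (tri> _ _ b+1<a) = ℕ.<-irrefl (≡.sym degree′) (ℕ.+-mono-< b<a b<a)
        where
        rhs : Top (e +ℕ (3× b +ℕ a)) (η K.* (ν K.* μ)) (g * (v * σ u))
        rhs = top-resp (sym eq) (top-* th (top-* (top-σ tv)
          (top-+small b+1<a tu (small-resp (-‿distribˡ-* X v) (small-neg (small (top-X tv)))))))

        degree : b +ℕ 3× a ≡ 3× b +ℕ a
        degree = ℕ.+-cancelˡ-≡ e _ _ (top-unique lhs rhs lhs≉0 (K-product η≉0 (K-product ν≉0 μ≉0)))

        b<a : b <ℕ a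
        b<a = ℕ.<-trans ℕ.≤-refl b+1<a

        degree′ : a +ℕ a ≡ b +ℕ b
        degree′ = ℕ.+-cancelˡ-≡ (b +ℕ a) _ _ (≡.trans (≡.sym (arith₁ a b)) (≡.trans (≡.cong (b +ℕ_) (≡.sym (3×-+ a)))
          (≡.trans degree (≡.trans (≡.cong (_+ℕ a) (3×-+ b)) (arith₂ a b)))))


  -- Horner's scheme on the first n coefficients; it is the value of the polynomial as soon as n
  -- exceeds the degree.
  evaluate : ℕ → Series → K.Carrier → K.Carrier
  evaluate zero g x = K.0#
  evaluate (suc n) g x = g 0 K.+ x K.* evaluate n (tail g) x

  evaluate-cong : ∀ n {g h} x → g ≈ h → evaluate n g x K.≈ evaluate n h x
  evaluate-cong zero x e = K.refl
  evaluate-cong (suc n) x e = K.+-cong (e 0) (K.*-congˡ (evaluate-cong n x (e ∘ suc)))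

  evaluate-point : ∀ n g {x y} → x K.≈ y → evaluate n g x K.≈ evaluate n g y
  evaluate-point zero g e = K.refl
  evaluate-point (suc n) g e = K.+-congˡ (K.*-cong e (evaluate-point n (tail g) e))

  evaluate-0 : ∀ n x → evaluate n 0# x K.≈ K.0#
  evaluate-0 zero x = K.refl
  evaluate-0 (suc n) x = K.trans (K.+-identityˡ _) (K.trans (K.*-congˡ (evaluate-0 n x)) (K.zeroʳ x))

  evaluate-+ : ∀ n g h x → evaluate n (g + h) x K.≈ evaluate n g x K.+ evaluate n h x
  evaluate-+ zero g h x = K.sym (K.+-identityˡ _)
  evaluate-+ (suc n) g h x = K.trans (K.+-congˡ (K.*-congˡ (evaluate-+ n (tail g) (tail h) x)))
    (K.solve 5 (λ a b x c d → a K.:+ b K.:+ x K.:* (c K.:+ d) K.:= (a K.:+ x K.:* c) K.:+ (b K.:+ x K.:* d)) K.refl _ _ _ _ _)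

  evaluate-scale : ∀ n κ g x → evaluate n (C κ * g) x K.≈ κ K.* evaluate n g x
  evaluate-scale n κ g x = K.trans (evaluate-cong n x (C-coeff κ g)) (go n g)
    where
    go : ∀ n g → evaluate n (λ k → κ K.* g k) x K.≈ κ K.* evaluate n g x
    go zero g = K.sym (K.zeroʳ κ)
    go (suc n) g = K.trans (K.+-congˡ (K.*-congˡ (go n (tail g))))
      (K.solve 4 (λ κ a x c → κ K.:* a K.:+ x K.:* (κ K.:* c) K.:= κ K.:* (a K.:+ x K.:* c)) K.refl _ _ _ _)

  evaluate-X : ∀ n g x → evaluate (suc n) (X * g) x K.≈ x K.* evaluate n g x
  evaluate-X n g x = K.trans (K.+-cong (X-coeff-0 g) (K.*-congˡ (evaluate-cong n x (X-coeff g)))) (K.+-identityˡ _)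

  evaluate-small : ∀ n m {g} x → Small n g → evaluate (n +ℕ m) g x K.≈ evaluate n g x
  evaluate-small zero m x s = K.trans (evaluate-cong m x (small-zero s)) (evaluate-0 m x)
  evaluate-small (suc n) m x s = K.+-congˡ (K.*-congˡ (evaluate-small n m x (small-tail s)))

  evaluate-≤ : ∀ {n m g} x → n ≤ℕ m → Small n g → evaluate m g x K.≈ evaluate n g x
  evaluate-≤ {n} {m} {g} x n≤m s = K.trans (K.reflexive (≡.cong (λ k → evaluate k g x) (≡.sym (ℕ.m+[n∸m]≡n n≤m)))) (evaluate-small n (m ∸ n) x s)

  evaluate-* : ∀ n m {g h} x → Small n g → Small m h → evaluate (n +ℕ m) (g * h) x K.≈ evaluate n g x K.* evaluate m h x
  evaluate-* zero m {g} {h} x s s′ = K.trans (evaluate-cong m x (trans (*-congʳ (small-zero s)) (zeroˡ h)))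
    (K.trans (evaluate-0 m x) (K.sym (K.zeroˡ _)))
  evaluate-* (suc n) m {g} {h} x s s′ = K.trans
    (evaluate-cong (suc (n +ℕ m)) x (trans (*-congʳ (decompose g)) (trans (distribʳ h (C (g 0)) (X * tail g)) (+-congˡ (*-assoc X (tail g) h)))))
    (K.trans (evaluate-+ (suc (n +ℕ m)) (C (g 0) * h) (X * (tail g * h)) x)
    (K.trans (K.+-cong (K.trans (evaluate-scale (suc (n +ℕ m)) (g 0) h x) (K.*-congˡ (evaluate-≤ x (ℕ.m≤n⇒m≤1+n (ℕ.m≤n+m m n)) s′)))
       (K.trans (evaluate-X (n +ℕ m) (tail g * h) x) (K.*-congˡ (evaluate-* n m x (small-tail s) s′))))
    (K.solve 4 (λ a v x w → a K.:* v K.:+ x K.:* (w K.:* v) K.:= (a K.:+ x K.:* w) K.:* v) K.refl _ _ _ _)))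

  -- The truncation bound is hidden, so that values of sums and products compose without tracking
  -- degrees; by `value-unique` the value does not depend on it.
  record Value (x : K.Carrier) (g : Series) (κ : K.Carrier) : Set ℓ where
    constructor value
    field
      bound : ℕ
      small : Small bound g
      evaluates : evaluate bound g x K.≈ κ

  value-unique : ∀ {x g h κ μ} → Value x g κ → Value x h μ → g ≈ h → κ K.≈ μ
  value-unique {x} {g} {h} (value n s e) (value m s′ e′) g≈h = K.trans (K.sym e) (K.trans
    (K.sym (evaluate-≤ x (ℕ.m≤m+n n m) s)) (K.trans (evaluate-cong (n +ℕ m) x g≈h) (K.trans (evaluate-≤ x (ℕ.m≤n+m m n) s′) e′)))

  value-cong : ∀ {x g κ μ} → κ K.≈ μ → Value x g κ → Value x g μ
  value-cong κ≈μ (value n s e) = value n s (K.trans e κ≈μ)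

  value-resp : ∀ {x g h κ} → g ≈ h → Value x g κ → Value x h κ
  value-resp {x} g≈h (value n s e) = value n (small-resp g≈h s) (K.trans (K.sym (evaluate-cong n x g≈h)) e)

  value-+ : ∀ {x g h κ μ} → Value x g κ → Value x h μ → Value x (g + h) (κ K.+ μ)
  value-+ {x} {g} {h} (value n s e) (value m s′ e′) = value (n +ℕ m)
    (small-+ (small-≤ (ℕ.m≤m+n n m) s) (small-≤ (ℕ.m≤n+m m n) s′))
    (K.trans (evaluate-+ (n +ℕ m) g h x) (K.+-cong (K.trans (evaluate-≤ x (ℕ.m≤m+n n m) s) e) (K.trans (evaluate-≤ x (ℕ.m≤n+m m n) s′) e′)))

  value-* : ∀ {x g h κ μ} → Value x g κ → Value x h μ → Value x (g * h) (κ K.* μ)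
  value-* {x} {g} {h} (value n s e) (value m s′ e′) = value (suc (n +ℕ m)) s″
    (K.trans
      (K.reflexive (≡.cong (λ k → evaluate k (g * h) x) (≡.sym (ℕ.+-suc n m))))
      (K.trans (evaluate-* n (suc m) x s (small-≤ (ℕ.n≤1+n m) s′)) (K.*-cong e (K.trans (evaluate-≤ x (ℕ.n≤1+n m) s′) e′))))
    where
    s″ : Small (suc (n +ℕ m)) (g * h)
    s″ = proj₂ (poly-* (n , s) (m , s′))

  value-C : ∀ {x} κ → Value x (C κ) κ
  value-C {x} κ = value 1 (small-C κ) (K.trans (K.+-congˡ (K.zeroʳ x)) (K.+-identityʳ κ))

  value-1 : ∀ {x} → Value x 1# K.1#
  value-1 = value-resp C-1 (value-C K.1#)

  value-X : ∀ {x} → Value x X x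
  value-X {x} = value 2 (proj₂ poly-X) (K.trans (K.+-identityˡ _) (K.trans (K.*-congˡ (K.trans (K.+-congˡ (K.zeroʳ x)) (K.+-identityʳ K.1#))) (K.*-identityʳ x)))

  value-neg : ∀ {x g κ} → Value x g κ → Value x (- g) (K.- κ)
  value-neg {x} {g} {κ} v = value-cong -1* (value-resp (trans (*-congʳ (trans (C-neg K.1#) (-‿cong C-1)))
      (solve 1 (λ g → :- con (+ 1) :* g := :- g) refl g)) (value-* (value-C (K.- K.1#)) v))
    where
    -1* : K.- K.1# K.* κ K.≈ K.- κ
    -1* = K.solve 1 (λ g → K.:- K.con (+ 1) K.:* g K.:= K.:- g) K.refl κ

  value-poly : ∀ {g} → ((n , _) : Poly g) → ∀ x → Value x g (evaluate n g x)
  value-poly (n , s) x = value n s K.refl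

  P : K.Carrier → K.Carrier
  P x = x K.* (x K.* (K.1# K.+ x))

  value-p : ∀ {x} → Value x p (P x)
  value-p = value-* value-X (value-* value-X (value-+ value-1 value-X))

  value-σ : ∀ {n g} x → Small n g → Value x (σ g) (evaluate n g (P x))
  value-σ {zero} x s = value-resp (sym (trans (σ-cong (small-zero s)) σ-0)) (value 0 (λ _ → K.refl) K.refl)
  value-σ {suc n} {g} x s = value-resp (sym (σ-step g))
    (value-+ (value-C (g 0)) (value-* value-p (value-σ {n} x (small-tail s))))

  linear : K.Carrier → Series
  linear x = X + - C x

  divide : ∀ n {g} x → Small (suc n) g → evaluate (suc n) g x K.≈ K.0# → ∃ λ h → Small n h × g ≈ linear x * h
  divide n {g} x s root = h , small-h , trans go (solve 3 (λ y c h → y :* h :+ :- (c :* h) := (y :+ :- c) :* h) refl X (C x) h)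
    where
    shifted : ℕ → Series
    shifted zero = tail g
    shifted (suc i) = tail (shifted i)

    shifted-head : ∀ i j → shifted i j ≡ g (suc (i +ℕ j))
    shifted-head zero j = ≡.refl
    shifted-head (suc i) j = ≡.trans (shifted-head i (suc j)) (≡.cong (g ∘ suc) (ℕ.+-suc i j))

    -- Synthetic division: coefficient i of the quotient is the Horner value at x of the
    -- coefficients of g above i.
    h : Series
    h i = evaluate n (shifted i) x

    small-h : Small n h
    small-h {j} n≤j = K.trans (evaluate-cong n x (λ k → K.trans (K.reflexive (shifted-head j k))
      (s (s≤s (ℕ.≤-trans n≤j (ℕ.m≤m+n j k)))))) (evaluate-0 n x)

    shifted-small : ∀ i → Small n (shifted i)
    shifted-small i {j} n≤j = K.trans (K.reflexive (shifted-head i j)) (s (s≤s (ℕ.≤-trans n≤j (ℕ.m≤n+m j i))))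

    h-step : ∀ i → h i K.≈ shifted i 0 K.+ x K.* h (suc i)
    h-step i = K.sym (evaluate-≤ x (ℕ.n≤1+n n) (shifted-small i))

    go : g ≈ X * h + - (C x * h)
    go zero = K.sym (K.trans (K.+-cong (X-coeff-0 h) (K.-‿cong (C-coeff x h 0)))
      (K.combine₁ (K.- K.1#) root (K.solve 3 (λ x h g → K.con (+ 0) K.:+ K.:- (x K.:* h) K.:+ K.:- K.con (+ 1) K.:* K.con (+ 0)
         K.:= g K.:+ K.:- K.con (+ 1) K.:* (g K.:+ x K.:* h)) K.refl x (h 0) (g 0))))
    go (suc i) = K.sym (K.trans (K.+-cong (X-coeff h i) (K.-‿cong (C-coeff x h (suc i)))) (K.trans (K.+-congʳ (h-step i))
      (K.trans (K.solve 2 (λ a b → a K.:+ b K.:+ K.:- b K.:= a) K.refl _ _)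
        (K.reflexive (≡.trans (shifted-head i 0) (≡.cong (g ∘ suc) (ℕ.+-identityʳ i)))))))

  value-linear : ∀ {x} y → Value x (linear y) (x K.+ K.- y)
  value-linear y = value-+ value-X (value-neg (value-C y))

  too-many-roots : ∀ n {g} → Small n g → (y : ℕ → K.Carrier) → (∀ i k → ¬ (y (suc k +ℕ i) K.≈ y i)) →
    (∀ i → Value (y i) g K.0#) → g ≈ 0#
  too-many-roots zero s y distinct roots = small-zero s
  too-many-roots (suc n) {g} s y distinct roots =
    trans g≈ (trans (*-congˡ (too-many-roots n sh (y ∘ suc) distinct′ roots′)) (zeroʳ (linear (y 0))))
    where
    quotient : ∃ λ h → Small n h × g ≈ linear (y 0) * h
    quotient = divide n (y 0) s (value-unique {y 0} {g} {g} (value (suc n) s K.refl) (roots 0) refl)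

    h : Series
    h = proj₁ quotient

    sh : Small n h
    sh = proj₁ (proj₂ quotient)

    g≈ : g ≈ linear (y 0) * h
    g≈ = proj₂ (proj₂ quotient)

    distinct′ : ∀ i k → ¬ (y (suc (suc k +ℕ i)) K.≈ y (suc i))
    distinct′ i k e = distinct (suc i) k (K.trans (K.reflexive (≡.cong (y ∘ suc) (ℕ.+-suc k i))) e)

    roots′ : ∀ i → Value (y (suc i)) h K.0#
    roots′ i = value-cong (K-cancel-zero difference (value-unique (value-* (value-linear (y 0)) h-value) (roots (suc i)) (sym g≈))) h-value
      where
      h-value : Value (y (suc i)) h (evaluate n h (y (suc i)))
      h-value = value n sh K.refl

      difference : ¬ (y (suc i) K.+ K.- y 0 K.≈ K.0#)
      difference e = distinct 0 i (K.trans (K.reflexive (≡.cong (y ∘ suc) (ℕ.+-identityʳ i))) (K.x∙y⁻¹≈ε⇒x≈y _ _ e))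

-- Rational functions and the three unsolvable equations

module RationalSeries {c ℓ : Level} (K₀ : CommutativeRing c ℓ) (field₀ : Over.IsField K₀) (charZero₀ : Over.CharZero K₀)
  (algClosed₀ : Over.AlgClosed K₀) where
  open PolynomialSeries K₀ field₀ charZero₀ public

  one≉0 : ¬ (1# ≈ 0#)
  one≉0 e = one-head≉0 (e 0)

  σ≉0 : ∀ {g} → ¬ (g ≈ 0#) → ¬ (σ g ≈ 0#)
  σ≉0 g≉0 e = leading g≉0 λ (a , _ , κ≉0 , o) → κ≉0 (K.trans (K.sym (ord-coeff (ord-σ o))) (e (a +ℕ a)))

  product≉0 : ∀ {g h} → ¬ (g ≈ 0#) → ¬ (h ≈ 0#) → ¬ (g * h ≈ 0#)
  product≉0 g≉0 h≉0 e = h≉0 (cancel-zero g≉0 e)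

  cancelˡ : ∀ {g h k} → ¬ (g ≈ 0#) → g * h ≈ g * k → h ≈ k
  cancelˡ {g} {h} {k} g≉0 e = x∙y⁻¹≈ε⇒x≈y h k (cancel-zero g≉0 (combine₁ 1# e
    (solve 3 (λ g h k → g :* (h :+ :- k) :+ con (+ 1) :* (g :* k) := con (+ 0) :+ con (+ 1) :* (g :* h)) refl g h k)))

  Rational : Series → Set (c ⊔ ℓ)
  Rational g = ∃ λ b → ∃ λ a → Poly b × Poly a × ¬ (b ≈ 0#) × b * g ≈ a

  poly-1 : Poly 1#
  poly-1 = poly-resp C-1 (poly-C K.1#)

  poly⇒rational : ∀ {g} → Poly g → Rational g
  poly⇒rational {g} pg = 1# , g , poly-1 , pg , one≉0 , *-identityˡ g

  rational : Subring Rational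
  rational = record
    { resp = λ g≈h (b , a , pb , pa , b≉0 , e) → b , a , pb , pa , b≉0 , trans (*-congˡ (sym g≈h)) e
    ; 0∈ = poly⇒rational (poly-resp C-0 (poly-C K.0#))
    ; 1∈ = poly⇒rational poly-1
    ; +∈ = λ {g} {h} (b , a , pb , pa , b≉0 , e) (b′ , a′ , pb′ , pa′ , b′≉0 , e′) →
        b * b′ , b′ * a + b * a′ , poly-* pb pb′ , poly-+ (poly-* pb′ pa) (poly-* pb pa′) , product≉0 b≉0 b′≉0 ,
        trans (solve 4 (λ b b′ g h → b :* b′ :* (g :+ h) := b′ :* (b :* g) :+ b :* (b′ :* h)) refl b b′ g h)
          (+-cong (*-congˡ e) (*-congˡ e′))
    ; *∈ = λ {g} {h} (b , a , pb , pa , b≉0 , e) (b′ , a′ , pb′ , pa′ , b′≉0 , e′) →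
        b * b′ , a * a′ , poly-* pb pb′ , poly-* pa pa′ , product≉0 b≉0 b′≉0 ,
        trans (solve 4 (λ b b′ g h → b :* b′ :* (g :* h) := b :* g :* (b′ :* h)) refl b b′ g h) (*-cong e e′)
    ; neg∈ = λ {g} (b , a , pb , pa , b≉0 , e) → b , - a , pb , poly-neg pa , b≉0 , trans (sym (-‿distribʳ-* b g)) (-‿cong e)
    }

  rational-σ : ∀ {g} → Rational g → Rational (σ g)
  rational-σ {g} (b , a , pb , pa , b≉0 , e) = σ b , σ a , poly-σ pb , poly-σ pa , σ≉0 b≉0 ,
    trans (sym (σ-* b g)) (σ-cong e)

  rational-θ : ∀ {g} → Rational g → Rational (θ g)
  rational-θ {g} (b , a , pb , pa , b≉0 , e) = b * b , b * θ a + - (θ b * a) , poly-* pb pb ,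
    poly-+ (poly-* pb (poly-θ pa)) (poly-neg (poly-* (poly-θ pb) pa)) , product≉0 b≉0 b≉0 ,
    combine₂ (- b) (- θ b) (trans (sym (θ-cong e)) (θ-* b g)) e
      (solve 6 (λ b g tb tg ta a → b :* b :* tg :+ (:- b :* (tb :* g :+ b :* tg) :+ :- tb :* a)
        := b :* ta :+ :- (tb :* a) :+ (:- b :* ta :+ :- tb :* (b :* g))) refl b g (θ b) (θ g) (θ a) a)

  den≉0 : ¬ (den ≈ 0#)
  den≉0 e = one≉0 (trans (sym den-inverse) (trans (*-congʳ e) (zeroˡ _)))

  num≉0 : ¬ (num ≈ 0#)
  num≉0 e = one≉0 (trans (sym num-inverse) (trans (*-congʳ e) (zeroˡ _)))

  poly-den : Poly den
  poly-den = 2 , Top.small top-den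

  poly-num : Poly num
  poly-num = 2 , Top.small top-num

  rational-q : Rational q
  rational-q = den , num , poly-den , poly-num , den≉0 , den*q

  num*q⁻¹ : num * q⁻¹ ≈ den
  num*q⁻¹ = trans (solve 3 (λ n d i → n :* (d :* i) := d :* (n :* i)) refl num den num⁻¹) (trans (*-congˡ num-inverse) (*-identityʳ den))

  rational-q⁻¹ : Rational q⁻¹
  rational-q⁻¹ = num , den , poly-num , poly-den , num≉0 , num*q⁻¹

  -- From p′ = t (2 + 3t) and p″ = 2 + 6t one gets t p″ / p′ = (2 + 6t) / (2 + 3t).
  ω₀ ω : Series
  ω₀ = C (emb 2) + C (emb 6) * X
  ω = ω₀ * num⁻¹

  num*ω : num * ω ≈ ω₀
  num*ω = trans (solve 3 (λ n d i → n :* (d :* i) := d :* (n :* i)) refl num ω₀ num⁻¹) (trans (*-congˡ num-inverse) (*-identityʳ ω₀))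

  poly-ω₀ : Poly ω₀
  poly-ω₀ = poly-+ (poly-C _) (poly-* (poly-C _) poly-X)

  rational-ω : Rational ω
  rational-ω = num , ω₀ , poly-num , poly-ω₀ , num≉0 , num*ω

  θσ-q : ∀ g → θ (σ g) ≈ q * σ (θ g)
  θσ-q g = unit-cancel den-inverse (trans (θσ g) (trans (*-congʳ (sym den*q)) (*-assoc den q _)))

  C6 : C (emb 6) ≈ 1# + (1# + (1# + (1# + (1# + 1#))))
  C6 = trans (C-emb 5) (+-congˡ (trans (C-emb 4) (+-congˡ (trans (C-emb 3) (+-congˡ C3)))))

  num≈ : num ≈ 1# + 1# + (1# + (1# + 1#)) * X
  num≈ = +-cong C2 (*-congʳ C3)

  ω₀≈ : ω₀ ≈ 1# + 1# + (1# + (1# + (1# + (1# + (1# + 1#))))) * X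
  ω₀≈ = +-cong C2 (*-congʳ C6)

  θq : θ q ≈ q * (ω + (1# + - q))
  θq = unit-cancel den-inverse (unit-cancel den-inverse (trans lhs (sym rhs)))
    where
    θden : θ den ≈ X
    θden = trans (θ-+ 1# X) (trans (+-cong θ-1 θX≈X) (+-identityˡ X))

    θnum : θ num ≈ (1# + (1# + 1#)) * X
    θnum = trans (θ-+ (C (emb 2)) (C (emb 3) * X)) (trans (+-cong (θ-C (emb 2)) (trans (θ-scale (emb 3) X) (*-cong C3 θX≈X))) (+-identityˡ _))

    lhs : den * (den * θ q) ≈ X
    lhs = combine₂ den (- X) (trans (sym (trans (θ-* den q) (+-congʳ (*-congʳ θden)))) (trans (θ-cong den*q) θnum)) (trans den*q num≈)
      (solve 3 (λ x q dq → (con (+ 1) :+ x) :* ((con (+ 1) :+ x) :* dq)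
          :+ ((con (+ 1) :+ x) :* ((con (+ 1) :+ (con (+ 1) :+ con (+ 1))) :* x) :+ :- x :* (con (+ 1) :+ con (+ 1) :+ (con (+ 1) :+ (con (+ 1) :+ con (+ 1))) :* x))
        := x :+ ((con (+ 1) :+ x) :* (x :* q :+ (con (+ 1) :+ x) :* dq) :+ :- x :* ((con (+ 1) :+ x) :* q))) refl X q (θ q))

    rhs : den * (den * (q * (ω + (1# + - q)))) ≈ X
    rhs = trans (solve 3 (λ d q w → d :* (d :* (q :* (w :+ (con (+ 1) :+ :- q)))) := d :* (d :* q :* w) :+ d :* q :* (d :+ :- (d :* q))) refl den q ω)
      (trans (+-cong (*-congˡ (trans (*-congʳ den*q) (trans num*ω ω₀≈))) (*-cong (trans den*q num≈) (+-congˡ (-‿cong (trans den*q num≈)))))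
      (solve 1 (λ x → (con (+ 1) :+ x) :* (con (+ 1) :+ con (+ 1) :+ (con (+ 1) :+ (con (+ 1) :+ (con (+ 1) :+ (con (+ 1) :+ (con (+ 1) :+ con (+ 1)))))) :* x)
          :+ (con (+ 1) :+ con (+ 1) :+ (con (+ 1) :+ (con (+ 1) :+ con (+ 1))) :* x) :* (con (+ 1) :+ x :+ :- (con (+ 1) :+ con (+ 1) :+ (con (+ 1) :+ (con (+ 1) :+ con (+ 1))) :* x))
          := x) refl X))

  -- The equation depends on u and v only through u / v, and the second hypothesis is the equality
  -- of two such quotients. The factor v σ(v) is introduced to substitute and then cancelled.
  fraction-transfer : ∀ {g h s u v u′ v′} → ¬ (v ≈ 0#) → u′ * v ≈ u * v′ →
    g * (v * σ u) ≈ σ v * (h * u + s * v) → g * (v′ * σ u′) ≈ σ v′ * (h * u′ + s * v′)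
  fraction-transfer {g} {h} {s} {u} {v} {u′} {v′} v≉0 e eq = cancelˡ (product≉0 v≉0 (σ≉0 v≉0)) (trans
    (solve 5 (λ v sv g v′ su′ → v :* sv :* (g :* (v′ :* su′)) := g :* v′ :* v :* (su′ :* sv)) refl v (σ v) g v′ (σ u′)) (trans
    (*-congˡ (trans (sym (σ-* u′ v)) (trans (σ-cong e) (σ-* u v′)))) (trans
    (solve 5 (λ v g v′ su sv′ → g :* v′ :* v :* (su :* sv′) := v′ :* sv′ :* (g :* (v :* su))) refl v g v′ (σ u) (σ v′)) (trans
    (*-congˡ eq) (trans
    (solve 7 (λ v′ sv′ sv h u s v → v′ :* sv′ :* (sv :* (h :* u :+ s :* v)) := sv :* sv′ :* (h :* (u :* v′) :+ s :* v :* v′)) refl v′ (σ v′) (σ v) h u s v) (trans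
    (*-congˡ (+-congʳ (*-congˡ (sym e))))
    (solve 7 (λ v′ sv′ sv h u′ s v → sv :* sv′ :* (h :* (u′ :* v) :+ s :* v :* v′) := v :* sv :* (sv′ :* (h :* u′ :+ s :* v′))) refl v′ (σ v′) (σ v) h u′ s v)))))))

  to-polynomials : ∀ {g h s u v} → Rational u → Rational v → ¬ (v ≈ 0#) → g * (v * σ u) ≈ σ v * (h * u + s * v) →
    (∀ {u v} → Poly u → Poly v → ¬ (v ≈ 0#) → ¬ (g * (v * σ u) ≈ σ v * (h * u + s * v))) → ⊥
  to-polynomials {g} {h} {s} {u} {v} (b , a , pb , pa , b≉0 , e) (b′ , a′ , pb′ , pa′ , b′≉0 , e′) v≉0 eq impossible =
    -- From u = a / b and v = a′ / b′ one has u / v = (a b′) / (a′ b).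
    impossible (poly-* pa pb′) (poly-* pa′ pb) (product≉0 a′≉0 b≉0)
      (fraction-transfer {g} {h} {s} v≉0 cross eq)
    where
    a′≉0 : ¬ (a′ ≈ 0#)
    a′≉0 a′≈0 = product≉0 b′≉0 v≉0 (trans e′ a′≈0)

    cross : a * b′ * v ≈ u * (a′ * b)
    cross = combine₂ a (- a′) e′ e (solve 6 (λ a b b′ v a′ u → a :* b′ :* v :+ (a :* a′ :+ :- a′ :* a)
      := u :* (a′ :* b) :+ (a :* (b′ :* v) :+ :- a′ :* (b :* u))) refl a b b′ v a′ u)

  unsolvable₀ : ∀ {u v} → Rational u → Rational v → ¬ (v ≈ 0#) → ¬ (v * σ u ≈ σ v * (u + - X * v))
  unsolvable₀ {u} {v} ru rv v≉0 e = to-polynomials {1#} {1#} { - X } ru rv v≉0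
    (trans (*-identityˡ _) (trans e (*-congˡ (+-congʳ (sym (*-identityˡ u))))))
    λ {u} {v} pu pv v≉0 e → no-rational-sum top-1 top-1 one-head≉0 one-head≉0 pu pv v≉0
      (trans e (trans (*-congˡ (+-congʳ (*-identityˡ u))) (sym (*-identityˡ _))))
    where
    top-1 : Top 0 K.1# 1#
    top-1 = top-resp C-1 (top-C K.1#)

  -- After multiplication by `den` the factors are `num` and `den`, of equal degree, so the
  -- comparison of degrees is the same as without q.
  unsolvable₁ : ∀ {u v} → Rational u → Rational v → ¬ (v ≈ 0#) → ¬ (q * (v * σ u) ≈ σ v * (u + - X * v))
  unsolvable₁ {u} {v} ru rv v≉0 e = to-polynomials {num} {den} {den * - X} ru rv v≉0
    (trans (*-congʳ (sym den*q)) (trans (*-assoc den q _) (trans (*-congˡ e) (expand u v))))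
    λ {u} {v} pu pv v≉0 e → no-rational-sum top-num top-den (K-emb≉0 2) one-head≉0 pu pv v≉0 (trans e (sym (expand u v)))
    where
    expand : ∀ u v → den * (σ v * (u + - X * v)) ≈ σ v * (den * u + den * - X * v)
    expand u v = solve 5 (λ d sv u x v → d :* (sv :* (u :+ :- x :* v)) := sv :* (d :* u :+ d :* :- x :* v)) refl den (σ v) u X v

  -- The equation for y is the monic cubic y³ + y² - x = 0, solvable by algebraic closedness.
  preimage : ∀ x → ∃ λ y → P y K.≈ x
  preimage x with algClosed₀ 2 cubic (λ e → charZero₀ 0 (K₀.trans (K₀.+-identityʳ _) e))
    where
    module K₀ = CommutativeRing K₀
    cubic : Fin 4 → K.Carrier
    cubic fzero = K.- x
    cubic (fsuc fzero) = K.0#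
    cubic (fsuc (fsuc fzero)) = K.1#
    cubic (fsuc (fsuc (fsuc fzero))) = K.1#
  ... | y , root = y , K.combine₁ K.1# (λ k → k root)
    (K.solve 2 (λ x y → y K.:* (y K.:* (K.con (+ 1) K.:+ y)) K.:+ K.con (+ 1) K.:* K.con (+ 0)
      K.:= x K.:+ K.con (+ 1) K.:* (K.:- x K.:* K.con (+ 1) K.:+ (K.con (+ 0) K.:* (y K.:* K.con (+ 1))
        K.:+ (K.con (+ 1) K.:* (y K.:* (y K.:* K.con (+ 1))) K.:+ (K.con (+ 1) K.:* (y K.:* (y K.:* (y K.:* K.con (+ 1)))) K.:+ K.con (+ 0)))))) K.refl x y)

  P-cong : ∀ {x y} → x K.≈ y → P x K.≈ P y
  P-cong e = K.*-cong e (K.*-cong e (K.+-congˡ e))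

  -- A backward orbit of the preimage -1 of the fixed point 0.
  orbit : ℕ → K.Carrier
  orbit zero = K.- K.1#
  orbit (suc n) = proj₁ (preimage (orbit n))

  P-orbit : ∀ n → P (orbit (suc n)) K.≈ orbit n
  P-orbit n = proj₂ (preimage (orbit n))

  P-1≈0 : P (K.- K.1#) K.≈ K.0#
  P-1≈0 = K.solve 0 (K.:- K.con (+ 1) K.:* (K.:- K.con (+ 1) K.:* (K.con (+ 1) K.:+ K.:- K.con (+ 1))) K.:= K.con (+ 0)) K.refl

  orbit≉0 : ∀ n → ¬ (orbit n K.≈ K.0#)
  orbit≉0 zero e = K-neg≉0 one-head≉0 e
  orbit≉0 (suc n) e = orbit≉0 n (K.trans (K.sym (P-orbit n)) (K.trans (K.*-congʳ e) (K.zeroˡ _)))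

  -- Applying `P` to a coincidence lowers both indices until the smaller one is 0. One more
  -- application makes a point of the orbit equal to P(-1) = 0, but 0 is fixed by `P` and the orbit
  -- ends in -1.
  orbit-distinct : ∀ i k → ¬ (orbit (suc k +ℕ i) K.≈ orbit i)
  orbit-distinct zero k e = orbit≉0 (k +ℕ 0) (K.trans (K.sym (P-orbit (k +ℕ 0))) (K.trans (P-cong e) P-1≈0))
  orbit-distinct (suc i) k e = orbit-distinct i k (K.trans (K.sym (P-orbit (suc k +ℕ i)))
    (K.trans (K.reflexive (≡.cong (λ n → P (orbit (suc n))) (≡.sym (ℕ.+-suc k i)))) (K.trans (P-cong e) (P-orbit i))))

  Positive : K.Carrier → Set ℓ
  Positive κ = ∃ λ n → κ K.≈ emb (suc n)

  positive-+ : ∀ {κ μ} → Positive κ → Positive μ → Positive (κ K.+ μ)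
  positive-+ (m , e) (n , e′) = m +ℕ suc n , K.trans (K.+-cong e e′) (K.sym (K-emb-+ (suc m) (suc n)))

  positive-multiple : ∀ m {μ} → Positive μ → Positive (emb (suc m) K.* μ)
  positive-multiple zero (n , e) = n , K.trans (K.*-cong (K.+-identityʳ _) e) (K.*-identityˡ _)
  positive-multiple (suc m) {μ} pμ with positive-+ pμ (positive-multiple m pμ)
  ... | n , e = n , K.trans (K.solve 2 (λ m μ → (K.con (+ 1) K.:+ m) K.:* μ K.:= μ K.:+ m K.:* μ) K.refl (emb (suc m)) μ) e

  positive-* : ∀ {κ μ} → Positive κ → Positive μ → Positive (κ K.* μ)
  positive-* (m , e) pμ with positive-multiple m pμ
  ... | n , e′ = n , K.trans (K.*-congʳ e) e′

  -- A substitute for an ordering of the field: the positive rationals, here given by clearing the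
  -- denominator, are preserved by `P` and do not contain -1.
  PositiveFraction : K.Carrier → Set (c ⊔ ℓ)
  PositiveFraction x = ∃ λ b → ∃ λ a → Positive b × Positive a × x K.* b K.≈ a

  positive-P : ∀ {x} → PositiveFraction x → PositiveFraction (P x)
  positive-P {x} (b , a , pb , pa , e) = b K.* (b K.* b) , a K.* (a K.* (b K.+ a)) ,
    positive-* pb (positive-* pb pb) , positive-* pa (positive-* pa (positive-+ pb pa)) ,
    K.trans (K.solve 2 (λ x b → x K.:* (x K.:* (K.con (+ 1) K.:+ x)) K.:* (b K.:* (b K.:* b))
      K.:= (x K.:* b) K.:* ((x K.:* b) K.:* (b K.:+ x K.:* b))) K.refl x b) (K.*-cong e (K.*-cong e (K.+-congˡ e)))

  positive-resp : ∀ {x y} → x K.≈ y → PositiveFraction x → PositiveFraction y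
  positive-resp x≈y (b , a , pb , pa , e) = b , a , pb , pa , K.trans (K.*-congʳ (K.sym x≈y)) e

  orbit-not-positive : ∀ n → ¬ PositiveFraction (orbit n)
  orbit-not-positive zero (b , a , pb , pa , e) with positive-+ pb pa
  ... | n , e′ = K-emb≉0 n (K.trans (K.sym e′) (K.combine₁ (K.- K.1#) e (K.solve 2 (λ a b → b K.:+ a K.:+ K.:- K.con (+ 1) K.:* a
    K.:= K.con (+ 0) K.:+ K.:- K.con (+ 1) K.:* (K.:- K.con (+ 1) K.:* b)) K.refl a b)))
  orbit-not-positive (suc n) pf = orbit-not-positive n (positive-resp (P-orbit n) (positive-P pf))

  -- P(-2/3) = 4/27 is positive, so the orbit avoids the critical point -2/3.
  orbit-regular : ∀ n → ¬ (emb 2 K.+ emb 3 K.* orbit n K.≈ K.0#)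
  orbit-regular zero e = K-neg≉0 one-head≉0 (K.trans (K.sym (K.solve 0
    ((K.con (+ 1) K.:+ (K.con (+ 1) K.:+ K.con (+ 0))) K.:+ (K.con (+ 1) K.:+ (K.con (+ 1) K.:+ (K.con (+ 1) K.:+ K.con (+ 0)))) K.:* K.:- K.con (+ 1)
      K.:= K.:- K.con (+ 1)) K.refl)) e)
  orbit-regular (suc n) e = orbit-not-positive n (positive-resp (P-orbit n)
    (emb 3 K.* (emb 3 K.* emb 3) , emb 4 , positive-* (2 , K.refl) (positive-* (2 , K.refl) (2 , K.refl)) , (3 , K.refl) , 27P≈4))
    where
    y : K.Carrier
    y = orbit (suc n)

    27P≈4 : P y K.* (emb 3 K.* (emb 3 K.* emb 3)) K.≈ emb 4
    27P≈4 = K.combine₁ ((emb 3 K.* y K.+ emb 2) K.* (emb 3 K.* y K.+ K.- K.1#)) e (K.solve 1 (λ y →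
      let n0 = K.con (+ 0); n1 = K.con (+ 1) K.:+ n0; n2 = K.con (+ 1) K.:+ n1; n3 = K.con (+ 1) K.:+ n2; n4 = K.con (+ 1) K.:+ n3
          k = (n3 K.:* y K.:+ n2) K.:* (n3 K.:* y K.:+ K.:- K.con (+ 1))
      in y K.:* (y K.:* (K.con (+ 1) K.:+ y)) K.:* (n3 K.:* (n3 K.:* n3)) K.:+ k K.:* n0 K.:= n4 K.:+ k K.:* (n2 K.:+ n3 K.:* y))
      K.refl y)

  module Poles (γ δ : K.Carrier) (γ≉0 : ¬ (γ K.≈ K.0#)) where
    s : Series
    s = C γ * (den * ω₀) + C δ * (X * (num * den))

    -- The equation q σ(h) = h + γ ω + δ t for h = u / v, multiplied by `den * num`.
    Equation : Series → Series → Set ℓ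
    Equation u v = num * num * (v * σ u) ≈ σ v * (den * num * u + s * v)

    N D W : K.Carrier → K.Carrier
    N x = emb 2 K.+ emb 3 K.* x
    D x = K.1# K.+ x
    W x = emb 2 K.+ emb 6 K.* x

    value-num : ∀ x → Value x num (N x)
    value-num x = value-+ (value-C _) (value-* (value-C _) value-X)

    value-den : ∀ x → Value x den (D x)
    value-den x = value-+ value-1 value-X

    value-s : ∀ x → Value x s (γ K.* (D x K.* W x) K.+ δ K.* (x K.* (N x K.* D x)))
    value-s x = value-+ (value-* (value-C γ) (value-* (value-den x) (value-+ (value-C _) (value-* (value-C _) value-X))))
      (value-* (value-C δ) (value-* value-X (value-* (value-num x) (value-den x))))

    at-point : ∀ {m n u v} → Small m u → Small n v → Equation u v → ∀ x →
      N x K.* N x K.* (evaluate n v x K.* evaluate m u (P x)) K.≈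
      evaluate n v (P x) K.* (D x K.* N x K.* evaluate m u x
        K.+ (γ K.* (D x K.* W x) K.+ δ K.* (x K.* (N x K.* D x))) K.* evaluate n v x)
    at-point {m} {n} su sv e x = value-unique
      (value-* (value-* (value-num x) (value-num x)) (value-* (value-poly (n , sv) x) (value-σ x su)))
      (value-* (value-σ x sv) (value-+ (value-* (value-* (value-den x) (value-num x)) (value-poly (m , su) x))
        (value-* (value-s x) (value-poly (n , sv) x)))) e

    CommonRoot : ℕ → ℕ → Series → Series → Set (c ⊔ ℓ)
    CommonRoot m n u v = ∃ λ x → evaluate m u x K.≈ K.0# × evaluate n v x K.≈ K.0#

    -- At -1 the factor `den` vanishes and P(-1) = 0, so v(-1) u(0) = 0. If u(0) = 0, the equation
    -- at the fixed point 0 reduces to 2 γ v(0)² = 0, and 0 would be a common root; hence v(-1) = 0.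
    -- A root of v at orbit i yields one at the next point y of the orbit: the right side vanishes
    -- at y, while neither 2 + 3y nor u(P(y)) is zero.
    coprime-roots : ∀ {m n u v} → Small m u → Small n v → Equation u v → ¬ CommonRoot m n u v →
      ∀ i → evaluate n v (orbit i) K.≈ K.0#
    coprime-roots {m} {n} {u} {v} su sv e coprime = roots
      where
      -1# : K.Carrier
      -1# = K.- K.1#

      at-1 : evaluate n v -1# K.* evaluate m u K.0# K.≈ K.0#
      at-1 = K.trans (K.*-congˡ (evaluate-point m u (K.sym P-1≈0))) (K.combine₁ K.1# (at-point su sv e -1#)
        (K.solve 6 (λ vx up vp ux γ δ →
          let n0 = K.con (+ 0); n1 = K.con (+ 1) K.:+ n0; n2 = K.con (+ 1) K.:+ n1; n3 = K.con (+ 1) K.:+ n2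
              n6 = K.con (+ 1) K.:+ (K.con (+ 1) K.:+ (K.con (+ 1) K.:+ n3))
              x = K.:- K.con (+ 1); N = n2 K.:+ n3 K.:* x; D = K.con (+ 1) K.:+ x; W = n2 K.:+ n6 K.:* x
          in vx K.:* up K.:+ K.con (+ 1) K.:* (vp K.:* (D K.:* N K.:* ux K.:+ (γ K.:* (D K.:* W) K.:+ δ K.:* (x K.:* (N K.:* D))) K.:* vx))
             K.:= K.con (+ 0) K.:+ K.con (+ 1) K.:* (N K.:* N K.:* (vx K.:* up)))
          K.refl (evaluate n v -1#) (evaluate m u (P -1#)) (evaluate n v (P -1#)) (evaluate m u -1#) γ δ))

      P0≈0 : P K.0# K.≈ K.0#
      P0≈0 = K.zeroˡ _

      at-0 : evaluate m u K.0# K.≈ K.0# → evaluate n v K.0# K.* (γ K.* evaluate n v K.0#) K.≈ K.0#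
      at-0 u₀≈0 = K-cancel-zero (K-emb≉0 1) (K.combine₂ (K.- K.1#) (emb 2 K.* emb 2 K.* v₀ K.+ K.- (emb 2 K.* v₀)) point u₀≈0
        (K.solve 4 (λ v u γ δ →
          let n0 = K.con (+ 0); n1 = K.con (+ 1) K.:+ n0; n2 = K.con (+ 1) K.:+ n1; n3 = K.con (+ 1) K.:+ n2
              n6 = K.con (+ 1) K.:+ (K.con (+ 1) K.:+ (K.con (+ 1) K.:+ n3))
              x = n0; N = n2 K.:+ n3 K.:* x; D = K.con (+ 1) K.:+ x; W = n2 K.:+ n6 K.:* x
          in n2 K.:* (v K.:* (γ K.:* v)) K.:+ (K.:- K.con (+ 1) K.:* (v K.:* (D K.:* N K.:* u K.:+ (γ K.:* (D K.:* W) K.:+ δ K.:* (x K.:* (N K.:* D))) K.:* v))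
               K.:+ (n2 K.:* n2 K.:* v K.:+ K.:- (n2 K.:* v)) K.:* n0)
             K.:= n0 K.:+ (K.:- K.con (+ 1) K.:* (N K.:* N K.:* (v K.:* u)) K.:+ (n2 K.:* n2 K.:* v K.:+ K.:- (n2 K.:* v)) K.:* u))
          K.refl v₀ u₀ γ δ))
        where
        v₀ u₀ : K.Carrier
        v₀ = evaluate n v K.0#
        u₀ = evaluate m u K.0#

        point : N K.0# K.* N K.0# K.* (v₀ K.* u₀) K.≈
          v₀ K.* (D K.0# K.* N K.0# K.* u₀ K.+ (γ K.* (D K.0# K.* W K.0#) K.+ δ K.* (K.0# K.* (N K.0# K.* D K.0#))) K.* v₀)
        point = K.trans (K.*-congˡ (K.*-congˡ (evaluate-point m u (K.sym P0≈0))))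
          (K.trans (at-point su sv e K.0#) (K.*-congʳ (evaluate-point n v P0≈0)))

      root-1 : evaluate n v -1# K.≈ K.0#
      root-1 = stable λ v≉0 →
        let u₀≈0 = K-cancel-zero v≉0 at-1
            γv₀≉0 = λ v₀≉0 → K-product v₀≉0 (K-product γ≉0 v₀≉0)
        in coprime (K.0# , u₀≈0 , stable λ v₀≉0 → γv₀≉0 v₀≉0 (at-0 u₀≈0))

      roots : ∀ i → evaluate n v (orbit i) K.≈ K.0#
      roots zero = root-1
      roots (suc i) = K-cancel-zero up≉0 (K.trans (K.*-comm _ _) (K-cancel-zero (K-product (orbit-regular (suc i)) (orbit-regular (suc i)))
        (K.trans (at-point su sv e (orbit (suc i))) (K.trans (K.*-congʳ (K.trans (evaluate-point n v (P-orbit i)) (roots i))) (K.zeroˡ _)))))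
        where
        up≉0 : ¬ (evaluate m u (P (orbit (suc i))) K.≈ K.0#)
        up≉0 u≈0 = coprime (orbit i , K.trans (K.sym (evaluate-point m u (P-orbit i))) u≈0 , roots i)

    remove-root : ∀ x {u v u′ v′} → u ≈ linear x * u′ → v ≈ linear x * v′ → ¬ (v ≈ 0#) → Equation u v → Equation u′ v′
    remove-root x {u} {v} {u′} {v′} eu ev v≉0 = fraction-transfer {num * num} {den * num} {s} v≉0
      (combine₂ u′ (- v′) ev eu (solve 5 (λ u v l u′ v′ → u′ :* v :+ (u′ :* (l :* v′) :+ :- v′ :* (l :* u′)) := u :* v′ :+ (u′ :* v :+ :- v′ :* u))
        refl u v (linear x) u′ v′))

    -- Induction on the degree bound of v. A common root is divided out of u and v, the bound for u
    -- being raised by one beforehand so that `m` itself stays. Without common roots, v would vanish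
    -- on the whole infinite orbit. The case distinction is classical, which is legitimate because
    -- the goal is empty.
    no-solution : ∀ m n {u v} → Small m u → Small n v → ¬ (v ≈ 0#) → ¬ Equation u v
    no-solution m zero su sv v≉0 e = v≉0 (small-zero sv)
    no-solution m (suc n) {u} {v} su sv v≉0 e = lem λ
      { (inj₁ (x , u≈0 , v≈0)) →
          let u′ , su′ , eu = divide m x (small-≤ (ℕ.n≤1+n m) su) (K.trans (evaluate-≤ x (ℕ.n≤1+n m) su) u≈0)
              v′ , sv′ , ev = divide n x sv v≈0
          in no-solution m n su′ sv′ (λ v′≈0 → v≉0 (trans ev (trans (*-congˡ v′≈0) (zeroʳ (linear x))))) (remove-root x eu ev v≉0 e)
      ; (inj₂ coprime) → v≉0 (too-many-roots (suc n) sv orbit orbit-distinct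
          λ i → value (suc n) sv (coprime-roots su sv e coprime i))
      }
      where
      lem : ¬ ¬ (CommonRoot m (suc n) u v ⊎ ¬ CommonRoot m (suc n) u v)
      lem k = k (inj₂ (λ r → k (inj₁ r)))

  unsolvable₂ : ∀ {u v γ δ} → Rational u → Rational v → ¬ (v ≈ 0#) → Const γ → Const δ → ¬ (γ ≈ 0#) →
    ¬ (q * (v * σ u) ≈ σ v * (u + (γ * ω + δ * X) * v))
  unsolvable₂ {u} {v} {γ} {δ} ru rv v≉0 (γ₀ , γ≈) (δ₀ , δ≈) γ≉0 e =
    to-polynomials {num * num} {den * num} {Poles.s γ₀ δ₀ γ₀≉0} ru rv v≉0 eq
      λ pu pv v≉0 → Poles.no-solution γ₀ δ₀ γ₀≉0 (proj₁ pu) (proj₁ pv) (proj₂ pu) (proj₂ pv) v≉0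
    where
    γ₀≉0 : ¬ (γ₀ K.≈ K.0#)
    γ₀≉0 e = γ≉0 (trans γ≈ (trans (C-cong e) C-0))

    eq : num * num * (v * σ u) ≈ σ v * (den * num * u + Poles.s γ₀ δ₀ γ₀≉0 * v)
    eq = trans (trans (*-congʳ (*-congˡ (sym den*q))) (solve 4 (λ n d q z → n :* (d :* q) :* z := d :* n :* (q :* z)) refl num den q (v * σ u)))
      (trans (*-congˡ (trans e (*-congˡ (+-congˡ (*-congʳ (+-cong (*-congʳ γ≈) (*-congʳ δ≈)))))))
      (trans (solve 8 (λ n d sv u g w dx v → d :* n :* (sv :* (u :+ (g :* w :+ dx) :* v)) := sv :* (d :* n :* u :+ (g :* (d :* (n :* w)) :+ dx :* (n :* d)) :* v))
          refl num den (σ v) u (C γ₀) ω (C δ₀ * X) v)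
        (*-congˡ (+-congˡ (*-congʳ (+-cong (*-congˡ (*-congˡ num*ω)) (*-assoc (C δ₀) X _)))))))

-- Finite sums of series

module SeriesSums {c ℓ : Level} (K₀ : CommutativeRing c ℓ) where
  open PowerSeries K₀
  open Over K₀ using (ΣS; vecs; shift; mul; deriv)

  Σ-cong : ∀ {A : Set} {F G : A → Series} → (∀ x → F x ≈ G x) → ∀ xs → ΣS xs F ≈ ΣS xs G
  Σ-cong e [] = refl
  Σ-cong e (x ∷ xs) = +-cong (e x) (Σ-cong e xs)

  Σ-0 : ∀ {A : Set} (xs : List A) → ΣS xs (λ _ → 0#) ≈ 0#
  Σ-0 [] = refl
  Σ-0 (x ∷ xs) = trans (+-identityˡ _) (Σ-0 xs)

  Σ-+ : ∀ {A : Set} (F G : A → Series) xs → ΣS xs (λ x → F x + G x) ≈ ΣS xs F + ΣS xs G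
  Σ-+ F G [] = sym (+-identityˡ 0#)
  Σ-+ F G (x ∷ xs) = trans (+-congˡ (Σ-+ F G xs))
    (solve 4 (λ a b c d → a :+ b :+ (c :+ d) := a :+ c :+ (b :+ d)) refl (F x) (G x) (ΣS xs F) (ΣS xs G))

  Σ-*ʳ : ∀ {A : Set} (F : A → Series) g xs → ΣS xs (λ x → F x * g) ≈ ΣS xs F * g
  Σ-*ʳ F g [] = sym (zeroˡ g)
  Σ-*ʳ F g (x ∷ xs) = trans (+-congˡ (Σ-*ʳ F g xs)) (sym (distribʳ g (F x) (ΣS xs F)))

  Σ-++ : ∀ {A : Set} (F : A → Series) xs ys → ΣS (xs ++ ys) F ≈ ΣS xs F + ΣS ys F
  Σ-++ F [] ys = sym (+-identityˡ _)
  Σ-++ F (x ∷ xs) ys = trans (+-congˡ (Σ-++ F xs ys)) (sym (+-assoc (F x) (ΣS xs F) (ΣS ys F)))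

  Σ-map : ∀ {A B : Set} (F : B → Series) (h : A → B) xs → ΣS (map h xs) F ≈ ΣS xs (F ∘ h)
  Σ-map F h [] = refl
  Σ-map F h (x ∷ xs) = +-congˡ (Σ-map F h xs)

  Σ-map-* : ∀ {A B : Set} (F : B → Series) (h : A → B) {g G} → (∀ x → F (h x) ≈ g * G x) → ∀ xs → ΣS (map h xs) F ≈ g * ΣS xs G
  Σ-map-* F h {g} e [] = sym (zeroʳ g)
  Σ-map-* F h {g} {G} e (x ∷ xs) = trans (+-cong (e x) (Σ-map-* F h e xs)) (sym (distribˡ g (G x) (ΣS xs G)))

  Σ-cartesianProduct : ∀ {A B D : Set} (F : D → Series) (h : A → B → D) {G H} → (∀ x y → F (h x y) ≈ G x * H y) →
    ∀ xs ys → ΣS (cartesianProductWith h xs ys) F ≈ ΣS xs G * ΣS ys H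
  Σ-cartesianProduct F h {G} {H} e [] ys = sym (zeroˡ (ΣS ys H))
  Σ-cartesianProduct F h {G} {H} e (x ∷ xs) ys = trans (Σ-++ F (map (h x) ys) (cartesianProductWith h xs ys))
    (trans (+-cong (Σ-map-* F (h x) (e x) ys) (Σ-cartesianProduct F h e xs ys)) (sym (distribʳ (ΣS ys H) (G x) (ΣS xs G))))

  Σ-concatMap : ∀ {A B : Set} (F : B → Series) (h : A → List B) xs → ΣS (concatMap h xs) F ≈ ΣS xs (λ x → ΣS (h x) F)
  Σ-concatMap F h [] = refl
  Σ-concatMap F h (x ∷ xs) = trans (Σ-++ F (h x) (concatMap h xs)) (+-congˡ (Σ-concatMap F h xs))

  Σ-swap : ∀ {A B : Set} (F : A → B → Series) xs ys → ΣS xs (λ x → ΣS ys (F x)) ≈ ΣS ys (λ y → ΣS xs (λ x → F x y))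
  Σ-swap F [] ys = sym (Σ-0 ys)
  Σ-swap F (x ∷ xs) ys = trans (+-congˡ (Σ-swap F xs ys)) (sym (Σ-+ (F x) (λ y → ΣS xs (λ x → F x y)) ys))

  -- The highest index comes first, in accordance with the constructor `snoc` of `Span`.
  sumBelow : ℕ → (ℕ → Series) → Series
  sumBelow zero h = 0#
  sumBelow (suc n) h = h n + sumBelow n h

  sumBelow-first : ∀ n h → sumBelow (suc n) h ≈ h 0 + sumBelow n (h ∘ suc)
  sumBelow-first zero h = refl
  sumBelow-first (suc n) h = trans (+-congˡ (sumBelow-first n h))
    (solve 3 (λ a b c → a :+ (b :+ c) := b :+ (a :+ c)) refl (h (suc n)) (h 0) (sumBelow n (h ∘ suc)))

  Σ-tabulate : ∀ {A : Set} n (g : Fin n → A) (F : A → Series) h → (∀ i → F (g i) ≈ h (toℕ i)) → ΣS (tabulate g) F ≈ sumBelow n h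
  Σ-tabulate zero g F h e = refl
  Σ-tabulate (suc n) g F h e = trans (+-cong (e fzero) (Σ-tabulate n (g ∘ fsuc) F (h ∘ suc) (e ∘ fsuc))) (sym (sumBelow-first n h))

  -- The sum over the first exponent is moved inside: it belongs to the lowest generator of the
  -- tower, whose powers are coefficients with respect to the higher ones.
  Σ-vecs-suc : ∀ {D} k (F : Vec (Fin D) (suc k) → Series) → ΣS (vecs (suc k)) F ≈ ΣS (vecs k) (λ es → ΣS (allFin D) (λ i → F (i ∷ es)))
  Σ-vecs-suc {D} k F = trans (Σ-concatMap F (λ i → map (i ∷_) (vecs k)) (allFin D))
    (trans (Σ-cong (λ i → Σ-map F (i ∷_) (vecs k)) (allFin D)) (Σ-swap (λ i es → F (i ∷ es)) (allFin D) (vecs k)))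

  polynomial : ∀ {n} → (Fin n → K.Carrier) → Series
  polynomial {zero} p = 0#
  polynomial {suc n} p = C (p fzero) + X * polynomial (p ∘ fsuc)

  polynomial-coeff : ∀ {n} (p : Fin n → K.Carrier) i → polynomial p (toℕ i) K.≈ p i
  polynomial-coeff p fzero = K.trans (K.+-congˡ (X-coeff-0 _)) (K.+-identityʳ _)
  polynomial-coeff p (fsuc i) = K.trans (K.+-identityˡ _) (K.trans (X-coeff _ (toℕ i)) (polynomial-coeff (p ∘ fsuc) i))

  shift-X^ : ∀ j g → shift j g ≈ X ^ j * g
  shift-X^ j g k with j ≤? k
  ... | yes j≤k = K.sym (K.trans (K.reflexive (≡.cong (X ^ j * g) (≡.sym (ℕ.m+[n∸m]≡n j≤k)))) (above j (k ∸ j)))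
    where
    above : ∀ j i → (X ^ j * g) (j +ℕ i) K.≈ g i
    above zero i = *-identityˡ g i
    above (suc j) i = K.trans (*-assoc X (X ^ j) g (suc (j +ℕ i))) (K.trans (X-coeff _ (j +ℕ i)) (above j i))
  ... | no j≰k = K.sym (below j k (ℕ.≰⇒> j≰k))
    where
    below : ∀ j k → k <ℕ j → (X ^ j * g) k K.≈ K.0#
    below (suc j) zero _ = K.trans (*-assoc X (X ^ j) g 0) (X-coeff-0 _)
    below (suc j) (suc k) (s≤s k<j) = K.trans (*-assoc X (X ^ j) g (suc k)) (K.trans (X-coeff _ k) (below j k k<j))

  Σ-shift : ∀ {A : Set} n (g : Fin n → A) (p : Fin n → K.Carrier) (F : A → Series) s M →
    (∀ i → F (g i) ≈ X ^ (s +ℕ toℕ i) * (C (p i) * M)) → ΣS (tabulate g) F ≈ X ^ s * (polynomial p * M)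
  Σ-shift zero g p F s M e = sym (trans (*-congˡ (zeroˡ M)) (zeroʳ (X ^ s)))
  Σ-shift (suc n) g p F s M e = trans (+-cong
      (trans (e fzero) (*-congʳ (^-congʳ X (ℕ.+-identityʳ s))))
      (Σ-shift n (g ∘ fsuc) (p ∘ fsuc) F (suc s) M (λ i → trans (e (fsuc i)) (*-congʳ (^-congʳ X (ℕ.+-suc s (toℕ i)))))))
    (solve 5 (λ z c m x r → z :* (c :* m) :+ x :* z :* (r :* m) := z :* ((c :+ x :* r) :* m)) refl
      (X ^ s) (C (p fzero)) M X (polynomial (p ∘ fsuc)))

  mul≈ : ∀ {f g f′ g′} → f ≈ f′ → g ≈ g′ → mul f g ≈ f′ * g′
  mul≈ {f} {g} e e′ k = K.trans (K.reflexive (≡.cong (λ m → m f g k) (≡.sym *ₛ≡mul))) (*-cong e e′ k)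

  C-one : ∀ κ → (λ k → κ K.* one k) ≈ C κ
  C-one κ zero = K.*-identityʳ κ
  C-one κ (suc k) = K.zeroʳ κ

  X*deriv : ∀ g → X * deriv g ≈ θ g
  X*deriv g zero = K.trans (X-coeff-0 _) (K.sym (K.zeroˡ _))
  X*deriv g (suc k) = X-coeff (deriv g) k

-- Enumeration of complete trees

uncurriedNode3 : Tree → Tree × Tree → Tree
uncurriedNode3 a (b , c) = node3 a b c

trees : ℕ → List Tree
trees zero = leaf ∷ []
trees (suc d) = cartesianProductWith node2 (trees d) (trees d)
             ++ cartesianProductWith uncurriedNode3 (trees d) (cartesianProduct (trees d) (trees d))

∈-trees⁺ : ∀ d t → LeavesAtDepth d t → t ∈ trees d
∈-trees⁺ zero leaf _ = here ≡.refl
∈-trees⁺ (suc d) (node2 a b) (pa , pb) =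
  ∈-++⁺ˡ (∈-cartesianProductWith⁺ node2 (∈-trees⁺ d a pa) (∈-trees⁺ d b pb))
∈-trees⁺ (suc d) (node3 a b c) (pa , pb , pc) =
  ∈-++⁺ʳ (cartesianProductWith node2 (trees d) (trees d))
    (∈-cartesianProductWith⁺ uncurriedNode3 (∈-trees⁺ d a pa) (∈-cartesianProduct⁺ (∈-trees⁺ d b pb) (∈-trees⁺ d c pc)))

∈-trees⁻ : ∀ d t → t ∈ trees d → LeavesAtDepth d t
∈-trees⁻ zero .leaf (here ≡.refl) = tt
∈-trees⁻ (suc d) t t∈ with ∈-++⁻ (cartesianProductWith node2 (trees d) (trees d)) t∈
... | inj₁ t∈₂ with ∈-cartesianProductWith⁻ node2 (trees d) (trees d) t∈₂
...   | a , b , a∈ , b∈ , ≡.refl = ∈-trees⁻ d a a∈ , ∈-trees⁻ d b b∈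
∈-trees⁻ (suc d) t t∈ | inj₂ t∈₃
  with ∈-cartesianProductWith⁻ uncurriedNode3 (trees d) (cartesianProduct (trees d) (trees d)) t∈₃
... | a , (b , c) , a∈ , bc∈ , ≡.refl with ∈-cartesianProduct⁻ (trees d) (trees d) bc∈
...   | b∈ , c∈ = ∈-trees⁻ d a a∈ , ∈-trees⁻ d b b∈ , ∈-trees⁻ d c c∈

trees-unique : ∀ d → Unique (trees d)
trees-unique zero = [] ∷ []
trees-unique (suc d) = Unique.++⁺
  (Unique.cartesianProductWith⁺ node2 (λ { ≡.refl → ≡.refl , ≡.refl }) (trees-unique d) (trees-unique d))
  (Unique.cartesianProductWith⁺ uncurriedNode3 (λ { ≡.refl → ≡.refl , ≡.refl }) (trees-unique d)
    (Unique.cartesianProduct⁺ (trees-unique d) (trees-unique d)))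
  disjoint
  where
  disjoint : Disjoint (cartesianProductWith node2 (trees d) (trees d))
                      (cartesianProductWith uncurriedNode3 (trees d) (cartesianProduct (trees d) (trees d)))
  disjoint (t∈₂ , t∈₃) with ∈-cartesianProductWith⁻ node2 (trees d) (trees d) t∈₂
    | ∈-cartesianProductWith⁻ uncurriedNode3 (trees d) (cartesianProduct (trees d) (trees d)) t∈₃
  ... | _ , _ , _ , _ , ≡.refl | _ , _ , _ , _ , ()

depth-unique : ∀ d e t → LeavesAtDepth d t → LeavesAtDepth e t → d ≡ e
depth-unique zero zero _ _ _ = ≡.refl
depth-unique zero (suc _) leaf _ ()
depth-unique zero (suc _) (node2 _ _) ()
depth-unique zero (suc _) (node3 _ _ _) ()
depth-unique (suc _) zero leaf ()
depth-unique (suc _) zero (node2 _ _) _ ()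
depth-unique (suc _) zero (node3 _ _ _) _ ()
depth-unique (suc d) (suc e) (node2 a _) (p , _) (p′ , _) = ≡.cong suc (depth-unique d e a p p′)
depth-unique (suc d) (suc e) (node3 a _ _) (p , _) (p′ , _) = ≡.cong suc (depth-unique d e a p p′)

-- This bounds the search: a complete tree with n leaves already occurs among the finitely many of
-- depth below n.
depth<leaves : ∀ d t → LeavesAtDepth d t → d <ℕ leaves t
depth<leaves zero leaf _ = s≤s z≤n
depth<leaves (suc d) (node2 a b) (pa , pb) = ℕ.+-mono-≤ (ℕ.≤-trans (s≤s z≤n) (depth<leaves d a pa)) (depth<leaves d b pb)
depth<leaves (suc d) (node3 a b c) (pa , pb , pc) = ℕ.≤-trans
  (ℕ.+-mono-≤ (ℕ.≤-trans (s≤s z≤n) (depth<leaves d a pa)) (depth<leaves d b pb)) (ℕ.m≤m+n (leaves a +ℕ leaves b) (leaves c))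

treesBelow : ℕ → List Tree
treesBelow zero = []
treesBelow (suc d) = treesBelow d ++ trees d

∈-treesBelow⁺ : ∀ n {d t} → d <ℕ n → LeavesAtDepth d t → t ∈ treesBelow n
∈-treesBelow⁺ (suc n) {d} {t} (s≤s d≤n) p with ℕ.m≤n⇒m<n∨m≡n d≤n
... | inj₁ d<n = ∈-++⁺ˡ (∈-treesBelow⁺ n d<n p)
... | inj₂ ≡.refl = ∈-++⁺ʳ (treesBelow n) (∈-trees⁺ n t p)

∈-treesBelow⁻ : ∀ n t → t ∈ treesBelow n → ∃ λ d → d <ℕ n × LeavesAtDepth d t
∈-treesBelow⁻ (suc n) t t∈ with ∈-++⁻ (treesBelow n) t∈
... | inj₂ t∈n = n , ℕ.≤-refl , ∈-trees⁻ n t t∈n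
... | inj₁ t∈< with ∈-treesBelow⁻ n t t∈<
...   | d , d<n , p = d , ℕ.m<n⇒m<1+n d<n , p

treesBelow-unique : ∀ n → Unique (treesBelow n)
treesBelow-unique zero = []
treesBelow-unique (suc n) = Unique.++⁺ (treesBelow-unique n) (trees-unique n) disjoint
  where
  disjoint : Disjoint (treesBelow n) (trees n)
  disjoint {t} (t∈< , t∈n) with ∈-treesBelow⁻ n t t∈<
  ... | d , d<n , p = ℕ.<⇒≢ d<n (depth-unique d n t p (∈-trees⁻ n t t∈n))

withLeaves : ℕ → List Tree → List Tree
withLeaves n = filter (λ t → leaves t ≟ n)

-- Two duplicate-free lists with the same members are permutations of each other, so the given list
-- may be replaced by the explicit enumeration.
count-trees : ∀ {a} → CountsCompleteTrees a → ∀ {n N} → n ≤ℕ N → length (withLeaves n (treesBelow N)) ≡ a n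
count-trees counts {n} {N} n≤N with counts n
... | L , unique , member , len = ≡.trans (↭-length (∼bag⇒↭
    (unique∧set⇒bag (Unique.filter⁺ _ (treesBelow-unique N)) unique
      (λ {t} → mk⇔ (λ t∈ → Equivalence.from (member t) (complete t t∈)) (λ t∈ → listed t (Equivalence.to (member t) t∈)))))) len
  where
  complete : ∀ t → t ∈ withLeaves n (treesBelow N) → Complete t × leaves t ≡ n
  complete t t∈ with ∈-filter⁻ (λ t → leaves t ≟ n) {xs = treesBelow N} t∈
  ... | t∈N , e with ∈-treesBelow⁻ N t t∈N
  ...   | d , _ , p = (d , p) , e

  listed : ∀ t → Complete t × leaves t ≡ n → t ∈ withLeaves n (treesBelow N)
  listed t ((d , p) , ≡.refl) =
    ∈-filter⁺ (λ t → leaves t ≟ n) (∈-treesBelow⁺ N (ℕ.<-≤-trans (depth<leaves d t p) n≤N) p) ≡.refl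

-- The functional equation of the generating function

module GeneratingFunction {c ℓ : Level} (K₀ : CommutativeRing c ℓ) where
  open PowerSeries K₀
  open SeriesSums K₀
  open Over K₀ using (ΣS)

  weight : Tree → Series
  weight t = X ^ leaves t

  F : ℕ → Series
  F d = ΣS (trees d) weight

  F-suc : ∀ d → F (suc d) ≈ F d * F d + F d * (F d * F d)
  F-suc d = trans (Σ-++ weight (cartesianProductWith node2 (trees d) (trees d)) _) (+-cong
    (Σ-cartesianProduct weight node2 (λ a b → ^-homo-* X (leaves a) (leaves b)) (trees d) (trees d))
    (trans (Σ-cartesianProduct weight uncurriedNode3 {weight} {λ (b , c) → weight b * weight c}
        (λ a (b , c) → trans (^-homo-* X (leaves a +ℕ leaves b) (leaves c)) (trans (*-congʳ (^-homo-* X (leaves a) (leaves b)))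
          (*-assoc (weight a) (weight b) (weight c)))) (trees d) (cartesianProduct (trees d) (trees d)))
      (*-congˡ (Σ-cartesianProduct _ _,_ (λ a b → refl) (trees d) (trees d)))))

  F-0 : F 0 ≈ X
  F-0 = trans (+-identityʳ _) (*-identityʳ X)

  -- By `F-suc`, F (d+1) is p composed with F d, whereas σ substitutes p inside F d. The two agree
  -- because F d is the d-th iterate of p; formally, σ is a ring homomorphism and so commutes with
  -- the recursion.
  σF : ∀ d → σ (F d) ≈ F (suc d)
  σF zero = trans (σ-cong F-0) (trans σX (trans
    (solve 1 (λ x → x :* (x :* (con (+ 1) :+ x)) := x :* x :+ x :* (x :* x)) refl X)
    (trans (sym (+-cong (*-cong F-0 F-0) (*-cong F-0 (*-cong F-0 F-0)))) (sym (F-suc 0)))))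
  σF (suc d) = trans (σ-cong (F-suc d)) (trans (σ-+ (F d * F d) (F d * (F d * F d)))
    (trans (+-cong (trans (σ-* (F d) (F d)) (*-cong (σF d) (σF d)))
      (trans (σ-* (F d) (F d * F d)) (*-cong (σF d) (trans (σ-* (F d) (F d)) (*-cong (σF d) (σF d))))))
    (sym (F-suc (suc d)))))

  G : ℕ → Series
  G n = ΣS (treesBelow n) weight

  G-suc : ∀ n → G (suc n) ≈ G n + F n
  G-suc n = Σ-++ weight (treesBelow n) (trees n)

  σG : ∀ n → σ (G n) + X ≈ G (suc n)
  σG zero = trans (+-congʳ σ-0) (trans (+-identityˡ X) (trans (sym F-0) (sym (trans (G-suc 0) (+-identityˡ (F 0))))))
  σG (suc n) = trans (+-congʳ (trans (σ-cong (G-suc n)) (trans (σ-+ (G n) (F n)) (+-congˡ (σF n))))) (trans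
    (solve 3 (λ a b x → a :+ b :+ x := a :+ x :+ b) refl (σ (G n)) (F (suc n)) X)
    (trans (+-congʳ (σG n)) (sym (G-suc (suc n)))))

  monomial-coeff : ∀ n → (X ^ n) n K.≈ K.1#
  monomial-coeff zero = K.refl
  monomial-coeff (suc n) = K.trans (X-coeff (X ^ n) n) (monomial-coeff n)

  monomial-vanishes : ∀ m n → ¬ (m ≡ n) → (X ^ m) n K.≈ K.0#
  monomial-vanishes zero zero m≢n = ⊥-elim (m≢n ≡.refl)
  monomial-vanishes zero (suc n) _ = K.refl
  monomial-vanishes (suc m) zero _ = X-coeff-0 (X ^ m)
  monomial-vanishes (suc m) (suc n) m≢n = K.trans (X-coeff (X ^ m) n) (monomial-vanishes m n (λ e → m≢n (≡.cong suc e)))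

  Σ-weight-coeff : ∀ n ts → ΣS ts weight n K.≈ emb (length (withLeaves n ts))
  Σ-weight-coeff n [] = K.refl
  Σ-weight-coeff n (t ∷ ts) with leaves t ≟ n
  ... | yes t≡n = K.trans (K.+-cong (K.trans (K.reflexive (≡.cong (λ m → (X ^ leaves t) m) (≡.sym t≡n))) (monomial-coeff (leaves t))) (Σ-weight-coeff n ts))
    (K.reflexive (≡.cong (λ ts → emb (length ts)) (≡.sym (filter-accept (λ t → leaves t ≟ n) {t} {ts} t≡n))))
  ... | no t≢n = K.trans (K.+-cong (monomial-vanishes (leaves t) n t≢n) (Σ-weight-coeff n ts)) (K.trans (K.+-identityˡ _)
    (K.reflexive (≡.cong (λ ts → emb (length ts)) (≡.sym (filter-reject (λ t → leaves t ≟ n) {t} {ts} t≢n)))))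

  van-σ : ∀ n {g} → Van n g → Van n (σ g)
  van-σ (suc n) {g} v {zero} _ = v (s≤s z≤n)
  van-σ (suc n) {g} v {suc j} (s≤s j<n) = K.trans (σ-step g (suc j)) (K.trans (K.+-identityˡ _)
    (K.trans (p-split (σ (tail g)) (suc j)) (K.trans (X-coeff _ j)
      (van-*ʳ n _ (van-σ n (λ i<n → v (s≤s i<n))) j<n))))

  module _ {a : ℕ → ℕ} (counts : CountsCompleteTrees a) where
    f : Series
    f n = emb (a n)

    f-coeff : ∀ {n N} → n ≤ℕ N → f n K.≈ G N n
    f-coeff {n} {N} n≤N = K.sym (K.trans (Σ-weight-coeff n (treesBelow N)) (K.reflexive (≡.cong emb (count-trees counts n≤N))))

    -- The infinite sum over all depths is never formed. Up to index n the series `f` agrees with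
    -- the polynomial `G n`, and σ preserves such agreement, so coefficient n is read off from the
    -- telescoping identity `σG n`.
    functional-equation : σ f ≈ f + - X
    functional-equation n = K.trans σf≈ (K.combine₁ K.1# (K.trans (σG n n) (K.sym (f-coeff (ℕ.n≤1+n n))))
      (K.solve 3 (λ a x f → a K.:+ K.con (+ 1) K.:* f K.:= f K.:+ K.:- x K.:+ K.con (+ 1) K.:* (a K.:+ x)) K.refl (σ (G n) n) (X n) (f n)))
      where
      σf≈ : σ f n K.≈ σ (G n) n
      σf≈ = K.x∙y⁻¹≈ε⇒x≈y _ _ (K.trans (K.+-congˡ (K.sym (σ-neg n))) (K.trans (K.sym (σ-+ f (- G n) n))
        (van-σ (suc n) (λ { (s≤s j≤n) → K.x≈y⇒x∙y⁻¹≈ε (f-coeff j≤n) }) ℕ.≤-refl)))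
        where
        σ-neg : ∀ k → σ (- G n) k K.≈ K.- σ (G n) k
        σ-neg = +-cancelˡ (σ (G n)) (σ (- G n)) (- σ (G n)) (trans (sym (σ-+ (G n) (- G n)))
          (trans (σ-cong (-‿inverseʳ (G n))) (trans σ-0 (sym (-‿inverseʳ (σ (G n)))))))

-- From differential equations to algebraic relations in the tower

module Products {c ℓ : Level} (K₀ : CommutativeRing c ℓ) {n d m : ℕ} (P : Over.DiffPoly K₀ n d m) (f : Over.Series K₀) where
  open CommutativeRing K₀
  open Over K₀

  -- productOver stands for the local function of evalDiff, which is not in scope here; unification
  -- finds it in evalDiff-unfold once its list argument has been abstracted.
  productOver : List (Fin (suc n)) → Vec (Fin (suc d)) (suc n) → Series
  evalDiff-unfold : ∀ k → evalDiff P f k ≡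
    ΣS (vecs (suc n)) (λ e → ΣS (allFin (suc m)) λ j → shift (toℕ j)
      (mul (λ k → P e j * one k) (mul (powS f (toℕ (lookup e fzero))) (productOver (tabulate fsuc) e)))) k
  productOver = _
  evalDiff-unfold k with tabulate {n = n} fsuc
  ... | L = ≡.refl

module DifferentialMonomials {c ℓ : Level} (K₀ : CommutativeRing c ℓ) (f : Over.Series K₀) where
  open PowerSeries K₀
  open SeriesSums K₀
  open Over K₀ using (ΣS; vecs; derivN; powS; mul; shift; DiffPoly; evalDiff)

  powS≈ : ∀ g e → powS g e ≈ g ^ e
  powS≈ g zero = refl
  powS≈ g (suc e) = mul≈ refl (powS≈ g e)

  monomial : ∀ {D k} → ℕ → Vec (Fin D) k → Series
  monomial s [] = 1#
  monomial s (e ∷ es) = derivN s f ^ toℕ e * monomial (suc s) es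

  evalDiff≈ : ∀ {n d m} (P : DiffPoly n d m) → evalDiff P f ≈ ΣS (vecs (suc n)) (λ e → polynomial (P e) * monomial 0 e)
  evalDiff≈ {n} {d} {m} P k = K.trans (K.reflexive (evalDiff-unfold k)) (Σ-cong summand (vecs (suc n)) k)
    where
    open Products K₀ P f

    tail-product : ∀ k s (g : Fin k → Fin (suc n)) E (v : Vec (Fin (suc d)) k) →
      (∀ i → toℕ (g i) ≡ s +ℕ toℕ i) → (∀ i → lookup E (g i) ≡ lookup v i) →
      productOver (tabulate g) E ≈ monomial s v
    tail-product zero s g E [] e e′ = refl
    tail-product (suc k) s g E (x ∷ v) e e′ = mul≈
      (trans (powS≈ (derivN (toℕ (g fzero)) f) (toℕ (lookup E (g fzero)))) (reflexive (≡.cong₂ (λ i j → derivN i f ^ toℕ j) (≡.trans (e fzero) (ℕ.+-identityʳ s)) (e′ fzero))))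
      (tail-product k (suc s) (g ∘ fsuc) E v (λ i → ≡.trans (e (fsuc i)) (ℕ.+-suc s (toℕ i))) (e′ ∘ fsuc))

    summand : ∀ E → ΣS (allFin (suc m)) (λ j → shift (toℕ j)
      (mul (λ k → P E j K.* one k) (mul (powS f (toℕ (lookup E fzero))) (productOver (tabulate fsuc) E)))) ≈ polynomial (P E) * monomial 0 E
    summand (x ∷ v) = trans (Σ-shift (suc m) id (P (x ∷ v)) _ 0 (monomial 0 (x ∷ v)) (λ j → trans (shift-X^ (toℕ j) _)
      (*-congˡ (mul≈ (C-one (P (x ∷ v) j)) (mul≈ (powS≈ f (toℕ x)) (tail-product n 1 fsuc (x ∷ v) v (λ _ → ≡.refl) (λ _ → ≡.refl)))))))
      (*-identityˡ _)

module Independence {c ℓ : Level} (K₀ : CommutativeRing c ℓ) (field₀ : Over.IsField K₀) (charZero₀ : Over.CharZero K₀)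
  (algClosed₀ : Over.AlgClosed K₀) (f : Over.Series K₀)
  (σf : PowerSeries._≈_ K₀ (PowerSeries.σ K₀ f) (PowerSeries._+_ K₀ f (PowerSeries.-_ K₀ (PowerSeries.X K₀)))) where
  open RationalSeries K₀ field₀ charZero₀ algClosed₀
  open Spans seriesRing using (module Polynomials)
  open SeriesSums K₀
  open DifferentialMonomials K₀ f
  open Over K₀ using (ΣS; vecs; derivN; DiffPoly; evalDiff)

  setting : AbelEquation c ℓ
  setting = record
    { domain = difference-domain
    ; θ = θ
    ; θ-cong = θ-cong
    ; θ-+ = θ-+
    ; θ-* = θ-*
    ; θ-const = λ (κ , e) → trans (θ-cong e) (θ-C κ)
    ; θσ = θσ-q
    ; t = X
    ; ω = ω
    ; θt≈t = θX≈X
    ; θq = θq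
    ; Base = Rational
    ; base = rational
    ; base-σ = record
      { const∈ = λ (κ , e) → Subring.resp rational (sym e) (poly⇒rational (poly-C κ))
      ; q∈ = rational-q
      ; q⁻¹∈ = rational-q⁻¹
      ; σ∈ = rational-σ
      }
    ; base-θ = rational-θ
    ; t∈ = poly⇒rational poly-X
    ; ω∈ = rational-ω
    ; f = f
    ; σf = σf
    ; unsolvable₀ = unsolvable₀
    ; unsolvable₁ = unsolvable₁
    ; unsolvable₂ = unsolvable₂
    }

  open Tower setting using (x; A; A-subring; base⊆; A⊆; x∈; independent)

  X^≉0 : ∀ n → ¬ (X ^ n ≈ 0#)
  X^≉0 zero = one≉0
  X^≉0 (suc n) = product≉0 (λ e → one-head≉0 (e 1)) (X^≉0 n)

  θ-X^ : ∀ n → θ (X ^ n) ≈ C (emb n) * X ^ n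
  θ-X^ zero = trans θ-1 (sym (trans (*-congʳ C-0) (zeroˡ 1#)))
  θ-X^ (suc n) = trans (θ-X (X ^ n)) (trans (*-congˡ (+-congˡ (θ-X^ n))) (trans
    (solve 3 (λ x z n → x :* (z :+ n :* z) := (con (+ 1) :+ n) :* (x :* z)) refl X (X ^ n) (C (emb n)))
    (*-congʳ (sym (C-emb n)))))

  x≈derivN : ∀ n → x n ≈ X ^ n * derivN n f
  x≈derivN zero = sym (*-identityˡ f)
  x≈derivN (suc n) = trans (+-cong (trans (θ-cong (x≈derivN n)) (θ-* (X ^ n) (derivN n f))) (-‿cong (*-cong (emb≈C n) (x≈derivN n))))
    (trans (+-cong (+-cong (*-congʳ (θ-X^ n)) (*-congˡ (sym (X*deriv (derivN n f))))) refl)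
    (solve 5 (λ n z g x d → n :* z :* g :+ z :* (x :* d) :+ :- (n :* (z :* g)) := x :* z :* d) refl
      (C (emb n)) (X ^ n) (derivN n f) X (derivN (suc n) f)))

  -- The monomial in the x n proportional to (f⁽ˢ⁾)ᵉ, with the power of X making the factor independent of e.
  factor : ℕ → ℕ → ℕ → Series
  factor d s e = (X ^ s) ^ (d ∸ e) * x s ^ e

  factor≈ : ∀ d s e → e ≤ℕ d → factor d s e ≈ (X ^ s) ^ d * derivN s f ^ e
  factor≈ d s e e≤d = trans (*-congˡ (trans (^-congˡ e (x≈derivN s)) (^-distrib-* (X ^ s) (derivN s f) e)))
    (trans (sym (*-assoc _ _ _)) (*-congʳ (trans (sym (^-homo-* (X ^ s) (d ∸ e) e)) (^-congʳ (X ^ s) (ℕ.m∸n+n≡m e≤d)))))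

  scaledMonomial : ∀ {d k} → ℕ → Vec (Fin (suc d)) k → Series
  scaledMonomial s [] = 1#
  scaledMonomial {d} s (e ∷ es) = factor d s (toℕ e) * scaledMonomial (suc s) es

  scaling : ℕ → ℕ → ℕ → Series
  scaling d s zero = 1#
  scaling d s (suc k) = (X ^ s) ^ d * scaling d (suc s) k

  scaledMonomial≈ : ∀ {d k} s (e : Vec (Fin (suc d)) k) → scaledMonomial s e ≈ monomial s e * scaling d s k
  scaledMonomial≈ s [] = sym (*-identityˡ 1#)
  scaledMonomial≈ {d} {suc k} s (e ∷ es) = trans (*-cong (factor≈ d s (toℕ e) (ℕ.≤-pred (Fin.toℕ<n e))) (scaledMonomial≈ (suc s) es))
    (solve 4 (λ a b c d → a :* b :* (c :* d) := b :* c :* (a :* d)) refl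
      ((X ^ s) ^ d) (derivN s f ^ toℕ e) (monomial (suc s) es) (scaling d (suc s) k))

  sumBelow-span : ∀ s n (b : ℕ → Series) → (∀ j → A s (b j)) → Polynomials.Span (A-subring s) (x s) n (sumBelow n (λ j → b j * x s ^ j))
  sumBelow-span s zero b b∈ = Polynomials.nil refl
  sumBelow-span s (suc n) b b∈ = Polynomials.snoc (b∈ n) (sumBelow-span s n b b∈) refl

  powers-independent : ∀ s n (b : ℕ → Series) → (∀ j → A s (b j)) → sumBelow n (λ j → b j * x s ^ j) ≈ 0# → ∀ j → j <ℕ n → b j ≈ 0#
  powers-independent s (suc n) b b∈ e j (s≤s j≤n) = go (ℕ.m≤n⇒m<n∨m≡n j≤n)
    where
    bn≈0 : b n ≈ 0#
    bn≈0 = independent s n (b∈ n , sumBelow n (λ j → b j * x s ^ j) , sumBelow-span s n b b∈ , refl) e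

    go : j <ℕ n ⊎ j ≡ n → b j ≈ 0#
    go (inj₁ j<n) = powers-independent s n b b∈
      (trans (sym (+-identityˡ _)) (trans (+-congʳ (sym (trans (*-congʳ bn≈0) (zeroˡ _)))) e)) j j<n
    go (inj₂ ≡.refl) = bn≈0

  -- A left inverse of `toℕ`, extended to all of ℕ so that families indexed by `Fin` can be fed to
  -- `sumBelow`; the values beyond d never enter the sum.
  clamp : ∀ {d} → ℕ → Fin (suc d)
  clamp zero = fzero
  clamp {zero} (suc j) = fzero
  clamp {suc d} (suc j) = fsuc (clamp j)

  clamp-toℕ : ∀ {d} (i : Fin (suc d)) → clamp (toℕ i) ≡ i
  clamp-toℕ fzero = ≡.refl
  clamp-toℕ {suc d} (fsuc i) = ≡.cong fsuc (clamp-toℕ i)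

  factors-independent : ∀ {d} s (b : Fin (suc d) → Series) → (∀ i → A s (b i)) →
    ΣS (allFin (suc d)) (λ i → b i * factor d s (toℕ i)) ≈ 0# → ∀ i → b i ≈ 0#
  factors-independent {d} s b b∈ e i = cancel-zero (X^^≉0 (d ∸ toℕ i)) (trans (*-comm ((X ^ s) ^ (d ∸ toℕ i)) (b i))
    (trans (*-congʳ (unclamp i)) (powers-independent s (suc d) b̂ b̂∈ (trans (sym sum≈) e) (toℕ i) (Fin.toℕ<n i))))
    where
    unclamp : ∀ i → b i ≈ b (clamp (toℕ i))
    unclamp i = reflexive (≡.cong b (≡.sym (clamp-toℕ i)))

    module As = Subring (A-subring s)

    X^^≉0 : ∀ k → ¬ ((X ^ s) ^ k ≈ 0#)
    X^^≉0 k h = X^≉0 (s *ℕ k) (trans (sym (^-assocʳ X s k)) h)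

    b̂ : ℕ → Series
    b̂ j = b (clamp j) * (X ^ s) ^ (d ∸ j)

    b̂∈ : ∀ j → A s (b̂ j)
    b̂∈ j = As.*∈ (b∈ (clamp j)) (As.^∈ (As.^∈ (base⊆ s (poly⇒rational poly-X)) s) (d ∸ j))

    sum≈ : ΣS (allFin (suc d)) (λ i → b i * factor d s (toℕ i)) ≈ sumBelow (suc d) (λ j → b̂ j * x s ^ j)
    sum≈ = Σ-tabulate (suc d) id (λ i → b i * factor d s (toℕ i)) (λ j → b̂ j * x s ^ j)
      (λ i → trans (sym (*-assoc (b i) ((X ^ s) ^ (d ∸ toℕ i)) (x s ^ toℕ i))) (*-congʳ (*-congʳ (unclamp i))))

  -- Grouped by the exponents of x (s+1), x (s+2), ..., the relation has coefficients in A (s+1),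
  -- which vanish by induction on the number of variables. Each of them is a polynomial in `x s`
  -- over `A s`, so its own coefficients vanish because `x s` is transcendental.
  monomials-independent : ∀ {d} k s (b : Vec (Fin (suc d)) k → Series) → (∀ e → A s (b e)) →
    ΣS (vecs k) (λ e → b e * scaledMonomial s e) ≈ 0# → ∀ e → b e ≈ 0#
  monomials-independent zero s b b∈ eq [] = trans (sym (*-identityʳ _)) (trans (sym (+-identityʳ _)) eq)
  monomials-independent {d} (suc k) s b b∈ eq (i ∷ es) = factors-independent s (λ i → b (i ∷ es)) (λ i → b∈ (i ∷ es))
    (monomials-independent k (suc s) inner inner∈ (trans (sym regroup) eq) es) i
    where
    module As = Subring (A-subring (suc s))

    inner : Vec (Fin (suc d)) k → Series
    inner es = ΣS (allFin (suc d)) (λ i → b (i ∷ es) * factor d s (toℕ i))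

    Σ∈ : ∀ {B : Set} (F : B → Series) → (∀ y → A (suc s) (F y)) → ∀ ys → A (suc s) (ΣS ys F)
    Σ∈ F F∈ [] = As.0∈
    Σ∈ F F∈ (y ∷ ys) = As.+∈ (F∈ y) (Σ∈ F F∈ ys)

    inner∈ : ∀ es → A (suc s) (inner es)
    inner∈ es = Σ∈ (λ i → b (i ∷ es) * factor d s (toℕ i)) (λ i → As.*∈ (A⊆ s (b∈ (i ∷ es)))
      (As.*∈ (As.^∈ (As.^∈ (base⊆ (suc s) (poly⇒rational poly-X)) s) (d ∸ toℕ i)) (As.^∈ (x∈ s) (toℕ i)))) (allFin (suc d))

    regroup : ΣS (vecs (suc k)) (λ e → b e * scaledMonomial s e) ≈ ΣS (vecs k) (λ es → inner es * scaledMonomial (suc s) es)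
    regroup = trans (Σ-vecs-suc k (λ e → b e * scaledMonomial s e)) (Σ-cong (λ es →
      trans (Σ-cong (λ i → sym (*-assoc (b (i ∷ es)) (factor d s (toℕ i)) (scaledMonomial (suc s) es))) (allFin (suc d)))
        (Σ-*ʳ (λ i → b (i ∷ es) * factor d s (toℕ i)) (scaledMonomial (suc s) es) (allFin (suc d)))) (vecs k))

  poly-polynomial : ∀ {n} (p : Fin n → K.Carrier) → Poly (polynomial p)
  poly-polynomial {zero} p = 0 , λ _ → K.refl
  poly-polynomial {suc n} p = poly-+ (poly-C (p fzero)) (poly-* poly-X (poly-polynomial (p ∘ fsuc)))

  no-differential-equation : ∀ {n d m} (P : DiffPoly n d m) → evalDiff P f ≈ 0# → ∀ e j → P e j K.≈ K.0#
  no-differential-equation {n} {d} P eq e j = K.trans (K.sym (polynomial-coeff (P e) j))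
    (monomials-independent (suc n) 0 (polynomial ∘ P) (λ e → poly⇒rational (poly-polynomial (P e))) scaled e (toℕ j))
    where
    scaled : ΣS (vecs (suc n)) (λ e → polynomial (P e) * scaledMonomial 0 e) ≈ 0#
    scaled = trans (Σ-cong (λ e → trans (*-congˡ (scaledMonomial≈ 0 e)) (sym (*-assoc (polynomial (P e)) (monomial 0 e) (scaling d 0 (suc n))))) (vecs (suc n)))
      (trans (Σ-*ʳ (λ e → polynomial (P e) * monomial 0 e) (scaling d 0 (suc n)) (vecs (suc n)))
        (trans (*-congʳ (trans (sym (evalDiff≈ P)) eq)) (zeroˡ (scaling d 0 (suc n)))))

theorem1p1 : {c ℓ : Level} (K : CommutativeRing c ℓ) →
    Over.IsField K → Over.CharZero K → Over.AlgClosed K →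
    (a : ℕ → ℕ) → CountsCompleteTrees a →
    Over.DiffTranscendental K (λ n → Over.emb K (a n))
theorem1p1 K field₀ charZero₀ algClosed₀ a counts (n , d , m , P , (e , j , P≉0) , eq) =
  no-differential-equation P (λ k → λ z → z (eq k)) e j P≉0
  where
  open Independence K field₀ charZero₀ algClosed₀ (λ n → Over.emb K (a n)) (GeneratingFunction.functional-equation K counts)
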